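{- There exists an algorithm that, given a metric graph $\Gamma$ and a divisor $D$ on $\Gamma$, computes (in finite time on every input) the rank $r_\Gamma(D)$ of $D$.
   Context: Computational model: since edge lengths and positions of points may be irrational, the algorithm is allowed to perform real arithmetic operations (and comparisons) with infinite precision. The input consists of the underlying finite multigraph, the real edge lengths, and the divisor given as a finite list of points (each described by an edge and a position on it) with integer coefficients. A metric graph $\Gamma$ is a finite connected multigraph (loops and parallel edges allowed) in which each edge is assigned a positive (finite) real length; each edge is identified with a closed interval of that length, with the end points of the interval identified with the end vertices of the edge. The points of $\Gamma$ are all points of these intervals. $\mathrm{Div}(\Gamma)$ is the free abelian group on the set of points of $\Gamma$; a divisor $D=\sum_v D(v)(v)$ is effective ($D\ge0$) if $D(v)\ge 0$ for all $v$, and $\deg(D)=\sum_v D(v)$. A rational function on $\Gamma$ is a continuous function $f:\Gamma\to\mathbb R$ which is piecewise linear with finitely many pieces and integer slopes on every edge. For a point $v$, $\mathrm{ord}_v(f)$ is the sum of the outgoing slopes of $f$ over all segments emanating from $v$, and $\mathrm{div}(f)=\sum_v\mathrm{ord}_v(f)(v)$. Divisors $D,D'$ are equivalent, $D\sim D'$, if $D=D'+\mathrm{div}(f)$ for some rational function $f$. Put $|D|=\{E\in\mathrm{Div}(\Gamma):E\ge0,\ E\sim D\}$. The rank of $D$ is $$r_\Gamma(D)=\min\{\deg(E):E\in\mathrm{Div}(\Gamma),\ E\ge0,\ |D-E|=\emptyset\}-1.$$ -}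

module Defs where

open import Algebra.Core using (Op₁; Op₂)
open import Algebra.Structures using (IsCommutativeRing)
open import Data.Fin.Base using (Fin; toℕ)
open import Data.Fin.Properties using () renaming (_≟_ to _≟F_)
open import Data.Integer.Base as ℤ using (ℤ; +_; -[1+_]; 0ℤ)
open import Data.List.Base using (List; []; _∷_; _++_; map; foldr; tabulate)
open import Data.List.Membership.Propositional using (_∈_)
open import Data.List.Relation.Unary.All as All using (All; []; _∷_)
open import Data.Nat.Base using (ℕ; zero; suc; NonZero)
open import Data.Product.Base using (∃; _×_; _,_; proj₁; proj₂)
open import Data.Sum.Base using (_⊎_; inj₁; inj₂; [_,_]′)
open import Data.Unit.Base using (⊤; tt)
open import Data.Bool.Base using (if_then_else_)
open import Relation.Binary.Construct.Closure.Equivalence using (EqClosure)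
open import Relation.Binary.Core using (Rel)
open import Relation.Binary.Definitions using (DecidableEquality)
open import Relation.Binary.PropositionalEquality using (_≡_; _≢_; refl)
open import Relation.Binary.Structures using (IsStrictTotalOrder)
import Relation.Binary.Construct.StrictToNonStrict as StrictToNonStrict
open import Relation.Nullary using (¬_; yes; no; does)

------------------------------------------------------------------------
-- Real numbers

-- The library has no real numbers, so ℝ enters through its axiomatic
-- characterisation: an ordered field with the least upper bound property,
-- which is unique up to isomorphism.  Trichotomy (the field `compare` of
-- IsStrictTotalOrder) is the classical trichotomy of ℝ; it also provides
-- the exact comparisons of the computational model.
record RealField : Set₁ where
  infix  4 _<_
  infixl 6 _+_
  infixl 7 _*_
  infix  8 -_ _⁻¹
  field
    Carrier             : Set
    _<_                 : Rel Carrier _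
    _+_ _*_             : Op₂ Carrier
    -_ _⁻¹              : Op₁ Carrier
    0# 1#               : Carrier
    isCommutativeRing   : IsCommutativeRing _≡_ _+_ _*_ -_ 0# 1#
    isStrictTotalOrder  : IsStrictTotalOrder _≡_ _<_
    0<1                 : 0# < 1#
    +-monoˡ-<           : ∀ {x y} z → x < y → x + z < y + z
    *-pos               : ∀ {x y} → 0# < x → 0# < y → 0# < x * y
    -- The value of 0# ⁻¹ is left unspecified.
    *-inverseʳ          : ∀ {x} → x ≢ 0# → x * x ⁻¹ ≡ 1#

  open IsStrictTotalOrder isStrictTotalOrder public using (_≟_; _<?_)
  open StrictToNonStrict _≡_ _<_ public using (_≤_)

  UpperBound : (Carrier → Set) → Carrier → Set
  UpperBound P u = ∀ x → P x → x ≤ u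

  field
    supremum : (P : Carrier → Set) → ∃ P → ∃ (UpperBound P) →
               ∃ λ s → UpperBound P s × (∀ u → UpperBound P u → s ≤ u)

  infixl 6 _-_
  _-_ : Op₂ Carrier
  x - y = x + - y

  fromℕ : ℕ → Carrier
  fromℕ zero    = 0#
  fromℕ (suc n) = 1# + fromℕ n

  fromℤ : ℤ → Carrier
  fromℤ (+ n)    = fromℕ n
  fromℤ -[1+ n ] = - fromℕ (suc n)

------------------------------------------------------------------------
-- Algorithms over the reals

-- Programs are syntax.  Terms are those of Gödel's System T (with finite
-- products, sums, lists and integers) extended by a base type `real` whose
-- only operations are the constants 0 and 1, the field operations and
-- branching on x < y.  No other real constants are available and the
-- syntax does not mention any particular RealField.

infixr 5 _⇒_
infixr 6 _⊕_
infixr 7 _⊗_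

data Type : Set where
  unit nat int real : Type
  list              : Type → Type
  _⊗_ _⊕_ _⇒_       : Type → Type → Type

Ctx : Set
Ctx = List Type

data Term (Γ : Ctx) : Type → Set where
  var     : ∀ {A} → A ∈ Γ → Term Γ A
  lam     : ∀ {A B} → Term (A ∷ Γ) B → Term Γ (A ⇒ B)
  app     : ∀ {A B} → Term Γ (A ⇒ B) → Term Γ A → Term Γ B
  unit    : Term Γ unit
  pair    : ∀ {A B} → Term Γ A → Term Γ B → Term Γ (A ⊗ B)
  fst     : ∀ {A B} → Term Γ (A ⊗ B) → Term Γ A
  snd     : ∀ {A B} → Term Γ (A ⊗ B) → Term Γ B
  inl     : ∀ {A B} → Term Γ A → Term Γ (A ⊕ B)
  inr     : ∀ {A B} → Term Γ B → Term Γ (A ⊕ B)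
  case    : ∀ {A B C} → Term Γ (A ⊕ B) →
            Term (A ∷ Γ) C → Term (B ∷ Γ) C → Term Γ C
  zero    : Term Γ nat
  suc     : Term Γ nat → Term Γ nat
  -- The bound variables are the recursive result and the predecessor.
  natrec  : ∀ {A} → Term Γ A → Term (A ∷ nat ∷ Γ) A → Term Γ nat → Term Γ A
  pos     : Term Γ nat → Term Γ int
  negsuc  : Term Γ nat → Term Γ int
  caseint : ∀ {A} → Term Γ int →
            Term (nat ∷ Γ) A → Term (nat ∷ Γ) A → Term Γ A
  nil     : ∀ {A} → Term Γ (list A)
  cons    : ∀ {A} → Term Γ A → Term Γ (list A) → Term Γ (list A)
  -- The bound variables are the recursive result, the head and the tail.
  listrec : ∀ {A B} → Term Γ B → Term (B ∷ A ∷ list A ∷ Γ) B →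
            Term Γ (list A) → Term Γ B
  0r 1r   : Term Γ real
  add mul : Term Γ real → Term Γ real → Term Γ real
  neg inv : Term Γ real → Term Γ real
  ifless  : ∀ {A} → Term Γ real → Term Γ real →
            Term Γ A → Term Γ A → Term Γ A

-- A program iterates `step` from the state `start` of its input until
-- `step` produces an output.  Every term evaluates in finitely many
-- operations, and, as in Kleene's normal form theorem, the single unbounded
-- loop is what gives the full power of register machines over the reals.
-- Halting is not built in.
record Program (Input Output : Type) : Set where
  field
    State : Type
    start : Term (Input ∷ []) State
    step  : Term (State ∷ []) (State ⊕ Output)

module Semantics (R : RealField) where
  open RealField R

  ⟦_⟧ : Type → Set
  ⟦ unit ⟧   = ⊤
  ⟦ nat ⟧    = ℕ
  ⟦ int ⟧    = ℤ
  ⟦ real ⟧   = Carrier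
  ⟦ list A ⟧ = List ⟦ A ⟧
  ⟦ A ⊗ B ⟧  = ⟦ A ⟧ × ⟦ B ⟧
  ⟦ A ⊕ B ⟧  = ⟦ A ⟧ ⊎ ⟦ B ⟧
  ⟦ A ⇒ B ⟧  = ⟦ A ⟧ → ⟦ B ⟧

  ℕ-rec : {A : Set} → A → (A → ℕ → A) → ℕ → A
  ℕ-rec z s zero    = z
  ℕ-rec z s (suc n) = s (ℕ-rec z s n) n

  List-rec : {A B : Set} → B → (B → A → List A → B) → List A → B
  List-rec n c []       = n
  List-rec n c (x ∷ xs) = c (List-rec n c xs) x xs

  ℤ-case : {A : Set} → (ℕ → A) → (ℕ → A) → ℤ → A
  ℤ-case p n (+ k)    = p k
  ℤ-case p n -[1+ k ] = n k

  eval : ∀ {Γ A} → Term Γ A → All ⟦_⟧ Γ → ⟦ A ⟧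
  eval (var x)         ρ = All.lookup ρ x
  eval (lam t)         ρ = λ a → eval t (a ∷ ρ)
  eval (app t u)       ρ = eval t ρ (eval u ρ)
  eval unit            ρ = tt
  eval (pair t u)      ρ = eval t ρ , eval u ρ
  eval (fst t)         ρ = proj₁ (eval t ρ)
  eval (snd t)         ρ = proj₂ (eval t ρ)
  eval (inl t)         ρ = inj₁ (eval t ρ)
  eval (inr t)         ρ = inj₂ (eval t ρ)
  eval (case t u v)    ρ = [ (λ a → eval u (a ∷ ρ)) , (λ b → eval v (b ∷ ρ)) ]′ (eval t ρ)
  eval zero            ρ = zero
  eval (suc t)         ρ = suc (eval t ρ)
  eval (natrec z s t)  ρ = ℕ-rec (eval z ρ) (λ a n → eval s (a ∷ n ∷ ρ)) (eval t ρ)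
  eval (pos t)         ρ = + eval t ρ
  eval (negsuc t)      ρ = -[1+ eval t ρ ]
  eval (caseint t p n) ρ = ℤ-case (λ k → eval p (k ∷ ρ)) (λ k → eval n (k ∷ ρ)) (eval t ρ)
  eval nil             ρ = []
  eval (cons t u)      ρ = eval t ρ ∷ eval u ρ
  eval (listrec n c t) ρ = List-rec (eval n ρ) (λ b x xs → eval c (b ∷ x ∷ xs ∷ ρ)) (eval t ρ)
  eval 0r              ρ = 0#
  eval 1r              ρ = 1#
  eval (add t u)       ρ = eval t ρ + eval u ρ
  eval (mul t u)       ρ = eval t ρ * eval u ρ
  eval (neg t)         ρ = - eval t ρ
  eval (inv t)         ρ = eval t ρ ⁻¹
  eval (ifless t u v w) ρ =
    if does (eval t ρ <? eval u ρ) then eval v ρ else eval w ρ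

  module _ {Input Output : Type} (P : Program Input Output) where
    open Program P

    data Reaches (s : ⟦ State ⟧) (o : ⟦ Output ⟧) : Set where
      halt : eval step (s ∷ []) ≡ inj₂ o → Reaches s o
      next : ∀ {s′} → eval step (s ∷ []) ≡ inj₁ s′ → Reaches s′ o → Reaches s o

  Computes : ∀ {Input Output} → Program Input Output → ⟦ Input ⟧ → ⟦ Output ⟧ → Set
  Computes P i o = Reaches P (eval (Program.start P) (i ∷ [])) o

------------------------------------------------------------------------
-- Metric graphs

record MetricGraph (R : RealField) : Set where
  open RealField R
  field
    #vertices #edges : ℕ
    source target    : Fin #edges → Fin #vertices
    length           : Fin #edges → Carrier
    length>0         : ∀ e → 0# < length e
    nonEmpty         : NonZero #vertices

  Vertex : Set
  Vertex = Fin #vertices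

  Edge : Set
  Edge = Fin #edges

  Adjacent : Vertex → Vertex → Set
  Adjacent v w = ∃ λ e → source e ≡ v × target e ≡ w

  field
    connected : ∀ v w → EqClosure Adjacent v w

module Geometry {R : RealField} (G : MetricGraph R) where
  open RealField R
  open MetricGraph G

  -- The disjoint union of the edge intervals, with end points identified
  -- with vertices: each point of the quotient is either a vertex or an
  -- interior point of exactly one edge.
  data Point : Set where
    vertex   : Vertex → Point
    interior : (e : Edge) (t : Carrier) → .(0# < t) → .(t < length e) → Point

  -- The quotient map from the interval [0, length e] to the points; it is
  -- only used for 0 ≤ t ≤ length e.
  at : Edge → Carrier → Point
  at e t with 0# <? t | t <? length e
  ... | no _  | _     = vertex (source e)
  ... | yes _ | no _  = vertex (target e)
  ... | yes p | yes q = interior e t p q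

  _≟P_ : DecidableEquality Point
  vertex v ≟P vertex w with v ≟F w
  ... | yes refl = yes refl
  ... | no  v≢w  = no λ { refl → v≢w refl }
  vertex _ ≟P interior _ _ _ _ = no λ ()
  interior _ _ _ _ ≟P vertex _ = no λ ()
  interior e t _ _ ≟P interior e′ t′ _ _ with e ≟F e′ | t ≟ t′
  ... | yes refl | yes refl = yes refl
  ... | no e≢e′  | _        = no λ { refl → e≢e′ refl }
  ... | yes _    | no t≢t′  = no λ { refl → t≢t′ refl }

  sumℤ : List ℤ → ℤ
  sumℤ = foldr ℤ._+_ 0ℤ

  ----------------------------------------------------------------------
  -- Divisors

  -- The free abelian group on Point, presented by formal sums.  Two formal
  -- sums are the same divisor when all their coefficients agree; all
  -- notions below depend on a formal sum only through its coefficients.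
  Divisor : Set
  Divisor = List (Point × ℤ)

  coeff : Divisor → Point → ℤ
  coeff D v = sumℤ (map (λ (w , c) → if does (w ≟P v) then c else 0ℤ) D)

  deg : Divisor → ℤ
  deg D = sumℤ (map proj₂ D)

  infixl 6 _⊖_
  _⊖_ : Divisor → Divisor → Divisor
  D ⊖ E = D ++ map (λ (w , c) → w , ℤ.- c) E

  Effective : Divisor → Set
  Effective D = ∀ v → 0ℤ ℤ.≤ coeff D v

  ----------------------------------------------------------------------
  -- Rational functions

  -- φ is piecewise linear on [a, b] with finitely many pieces of integer
  -- slope.  The pieces are closed intervals covering [a, b], so φ is
  -- automatically continuous there.
  record Linear (φ : Carrier → Carrier) (a b : Carrier) : Set where
    field
      a<b    : a < b
      slope  : ℤ
      linear : ∀ t → a ≤ t → t ≤ b → φ t ≡ φ a + fromℤ slope * (t - a)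

  data PiecewiseLinear (φ : Carrier → Carrier) : Carrier → Carrier → Set where
    single : ∀ {a b} → Linear φ a b → PiecewiseLinear φ a b
    _then_ : ∀ {a c b} → Linear φ a c → PiecewiseLinear φ c b →
             PiecewiseLinear φ a b

  -- The slope of φ on [t, t + ε] for small ε > 0, where a ≤ t < b.
  slopeAfter : ∀ {φ a b} → PiecewiseLinear φ a b → Carrier → ℤ
  slopeAfter (single l) t = Linear.slope l
  slopeAfter (_then_ {c = c} l p) t =
    if does (t <? c) then Linear.slope l else slopeAfter p t

  -- The slope of φ on [t - ε, t] for small ε > 0, where a < t ≤ b.
  slopeBefore : ∀ {φ a b} → PiecewiseLinear φ a b → Carrier → ℤ
  slopeBefore (single l) t = Linear.slope l
  slopeBefore (_then_ {c = c} l p) t =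
    if does (c <? t) then slopeBefore p t else Linear.slope l

  record RationalFunction : Set where
    field
      value  : Point → Carrier
      onEdge : ∀ e → PiecewiseLinear (λ t → value (at e t)) 0# (length e)

  -- A segment leaving its base point against the orientation of the edge
  -- has outgoing slope - slopeBefore.  A loop at v contributes both its ends.
  ord : RationalFunction → Point → ℤ
  ord f (vertex v) = sumℤ (tabulate λ e →
    (if does (source e ≟F v) then slopeAfter (onEdge e) 0# else 0ℤ)
      ℤ.+
    (if does (target e ≟F v) then ℤ.- slopeBefore (onEdge e) (length e) else 0ℤ))
    where open RationalFunction f
  ord f (interior e t _ _) =
    slopeAfter (onEdge e) t ℤ.+ ℤ.- slopeBefore (onEdge e) t
    where open RationalFunction f

  ----------------------------------------------------------------------
  -- Linear equivalence and rank

  infix 4 _∼_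
  _∼_ : Divisor → Divisor → Set
  D ∼ D′ = ∃ λ f → ∀ v → coeff D v ≡ coeff D′ v ℤ.+ ord f v

  _∈∣_∣ : Divisor → Divisor → Set
  E ∈∣ D ∣ = Effective E × E ∼ D

  EmptySystem : Divisor → Set
  EmptySystem D = ¬ ∃ λ F → F ∈∣ D ∣

  IsMinimum : (ℤ → Set) → ℤ → Set
  IsMinimum P m = P m × (∀ k → P k → m ℤ.≤ k)

  IsRank : Divisor → ℤ → Set
  IsRank D r = ∃ λ m →
    IsMinimum (λ d → ∃ λ E → Effective E × EmptySystem (D ⊖ E) × deg E ≡ d) m
      × r ≡ m ℤ.- (+ 1)

  ----------------------------------------------------------------------
  -- Inputs

  -- A point as described in an input: an edge with a position on it, end
  -- points included, or a vertex.  A vertex may thus have several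
  -- descriptions.  The vertex form is indispensable only for the graph
  -- without edges.
  data Location : Set where
    vertex : Vertex → Location
    onEdge : (e : Edge) (t : Carrier) → 0# ≤ t → t ≤ length e → Location

  point : Location → Point
  point (vertex v)       = vertex v
  point (onEdge e t _ _) = at e t

  InputDivisor : Set
  InputDivisor = List (Location × ℤ)

  divisor : InputDivisor → Divisor
  divisor = map λ (x , c) → point x , c

-- The number of vertices; the list of edges, as source, target and length;
-- the divisor, with an edge named by its index in the list of edges.
InputType : Type
InputType = nat ⊗ list (nat ⊗ nat ⊗ real) ⊗ list ((nat ⊕ nat ⊗ real) ⊗ int)

module _ {R : RealField} (G : MetricGraph R) where
  open MetricGraph G
  open Geometry G
  open Semantics R

  encodeLocation : Location → ⟦ nat ⊕ nat ⊗ real ⟧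
  encodeLocation (vertex v)       = inj₁ (toℕ v)
  encodeLocation (onEdge e t _ _) = inj₂ (toℕ e , t)

  encode : InputDivisor → ⟦ InputType ⟧
  encode D = #vertices
           , tabulate (λ e → toℕ (source e) , toℕ (target e) , length e)
           , map (λ (x , c) → encodeLocation x , c) D

{-# OPTIONS --safe #-}

-- Cut Γ into segments such that D lives on their end points.  If D + div f ≥ 0, then f
-- is convex along every segment from u to v, of length L say, so its values x and its
-- outgoing slopes a at u and b at v satisfy a L ≤ x v - x u and b L ≤ x u - x v, and D
-- plus these slopes is effective.  Conversely, every integer solution of these conditions
-- extends to a rational function f by interpolation with at most one kink per segment.
-- Summing over a superlevel set of x bounds the slopes by the positive part of D; hence
-- |D| = ∅ is decided by trying all slopes and eliminating x by Fourier–Motzkin.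
--
-- For the rank it suffices to subtract effective divisors supported on the end points of
-- one loopless subdivision carrying D.  Indeed, let p be cut out between two adjacent
-- points u and v, let x solve the conditions for D - u and y those for D - v, with
-- x p = y p, and let z = max (x , y).  Either z has an extra chip at p, or x and y have the
-- same slopes at p; then z p can be lowered, at the expense of the chips which x and y
-- leave at (or send out from) u and v, until one of these chips reaches p.  So D - p is
-- solvable too, and arbitrary points are introduced one after the other.
--
-- The program tests all these divisors of degree k = 0, 1, 2, … and outputs k - 1 at the
-- first failure, which occurs for some k ≤ |deg D| + 1 since div f has degree 0.

module Submission where

open import Defs
open import Data.Product using (Σ; ∃; _×_)
open import Data.Integer using (ℤ)
open import Algebra.Bundles using (CommutativeRing)
import Algebra.Properties.Ring
import Algebra.Solver.Ring
open import Algebra.Solver.Ring.AlmostCommutativeRing using (fromCommutativeRing; _-Raw-AlmostCommutative⟶_)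
open import Data.Bool.Base using (Bool; true; false; if_then_else_; not; _∧_; _∨_)
open import Data.Empty using (⊥; ⊥-elim)
open import Data.Fin.Base as Fin using (Fin; toℕ)
open import Data.Fin.Properties using () renaming (_≟_ to _≟F_)
import Data.Fin.Properties as Finₚ
open import Data.Integer.Base as ℤ using (-[1+_]; 0ℤ) renaming (+_ to ⁺_)
import Data.Integer.Properties as ℤₚ
import Data.Integer.Solver
open import Data.List.Base using (List; []; _∷_; _++_; map; foldr; filter; replicate; concat; concatMap; tabulate) renaming (length to size)
open import Data.List.Membership.Propositional using (_∈_)
import Data.List.Membership.Propositional.Properties as ∈ₚ
import Data.List.Properties as Listₚ
open import Data.List.Relation.Binary.Permutation.Propositional using (_↭_; ↭-trans; ↭-sym; prep; swap)
import Data.List.Relation.Binary.Permutation.Propositional as ↭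
import Data.List.Relation.Binary.Permutation.Propositional.Properties as ↭ₚ
open import Data.List.Relation.Binary.Pointwise using (Pointwise; []; _∷_)
import Data.List.Relation.Binary.Pointwise as Pw
open import Data.List.Relation.Unary.All as All using (All; []; _∷_)
import Data.List.Relation.Unary.All.Properties as Allₚ
open import Data.List.Relation.Unary.Any as Any using (Any; here; there)
open import Data.Maybe.Base using (Maybe; just; nothing)
open import Data.Nat.Base as ℕ using (ℕ; zero; suc)
import Data.Nat.Properties as ℕₚ
open import Data.Product using (_,_; proj₁; proj₂)
open import Data.Product.Properties using (≡-dec)
open import Data.Sum.Base using (_⊎_; inj₁; inj₂)
open import Function.Base using (_∘_)
open import Relation.Binary.Definitions using (DecidableEquality; Tri; tri<; tri≈; tri>)
open import Relation.Binary.PropositionalEquality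
open import Relation.Binary.Structures using (IsStrictTotalOrder)
open import Relation.Nullary using (¬_; Dec; yes; no; does)
open import Relation.Nullary.Decidable using (¬?; dec-true; dec-false; recompute)

-- The reduction to end points hinges on the absence of loops. On a circle with one vertex v the
-- divisor (v) survives the subtraction of v, but (v) - (p) has an empty system for every other
-- point p: a single end does not control the interior of its loop. This is why the midpoint of
-- every edge is among the cut points. Feasibility asks for inequalities, not equalities, between
-- slopes and differences of values. Lowering a slope keeps it valid and raising it keeps the
-- divisor effective. This slack makes the maximum of two solutions a solution, lets the value at
-- one point move by itself, and allows slopes to be normalised into a bounded range. Once the
-- slopes are fixed, only difference constraints on real values remain, a class closed under
-- elimination of a variable. New points enter one at a time because the exchange of chips compares
-- the two ends of one cut segment; the other chips are carried along unchanged.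

module ℤSolver = Data.Integer.Solver.+-*-Solver
open ℤSolver using () renaming (solve to ℤsolve; _:=_ to _⊜_; _:+_ to _⊕′_; _:-_ to _⊖′_; :-_ to ⊝_; con to const)

-- Ordered-field arithmetic and the embedding of the integers.

module Field (R : RealField) where
  open RealField R public
  open import Relation.Binary.Structures using (IsStrictTotalOrder)
  open IsStrictTotalOrder isStrictTotalOrder public
    using (compare) renaming (trans to <-trans; irrefl to <-irrefl; asym to <-asym)

  commutativeRing : CommutativeRing _ _
  commutativeRing = record { isCommutativeRing = isCommutativeRing }

  open CommutativeRing commutativeRing public
    using (+-assoc; +-comm; +-identityˡ; +-identityʳ; -‿inverseʳ; *-comm; *-identityˡ; *-identityʳ; distribʳ; zeroˡ; zeroʳ)
  open import Algebra.Properties.Ring (CommutativeRing.ring commutativeRing)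
    using (-‿distribˡ-*; -‿involutive; -‿+-comm; -0#≈0#)

  fromℕ-+ : ∀ m n → fromℕ (m ℕ.+ n) ≡ fromℕ m + fromℕ n
  fromℕ-+ zero    n = sym (+-identityˡ _)
  fromℕ-+ (suc m) n = trans (cong (λ z → 1# + z) (fromℕ-+ m n)) (sym (+-assoc _ _ _))

  cancel-1+ : ∀ x y → x - y ≡ (1# + x) - (1# + y)
  cancel-1+ x y = sym (begin
    (1# + x) + - (1# + y)     ≡⟨ cong₂ _+_ (+-comm 1# x) (sym (-‿+-comm 1# y)) ⟩
    (x + 1#) + (- 1# + - y)   ≡⟨ +-assoc _ _ _ ⟩
    x + (1# + (- 1# + - y))   ≡⟨ cong (x +_) (sym (+-assoc _ _ _)) ⟩
    x + ((1# + - 1#) + - y)   ≡⟨ cong (λ z → x + (z + - y)) (-‿inverseʳ 1#) ⟩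
    x + (0# + - y)            ≡⟨ cong (x +_) (+-identityˡ _) ⟩
    x + - y                   ∎)
    where open ≡-Reasoning

  fromℤ-⊖ : ∀ m n → fromℤ (m ℤ.⊖ n) ≡ fromℕ m - fromℕ n
  fromℤ-⊖ m zero = sym (trans (cong (fromℕ m +_) -0#≈0#) (+-identityʳ _))
  fromℤ-⊖ zero (suc n) = sym (+-identityˡ _)
  fromℤ-⊖ (suc m) (suc n) = begin
    fromℤ (suc m ℤ.⊖ suc n)          ≡⟨ cong fromℤ (ℤₚ.[1+m]⊖[1+n]≡m⊖n m n) ⟩
    fromℤ (m ℤ.⊖ n)                  ≡⟨ fromℤ-⊖ m n ⟩
    fromℕ m - fromℕ n                ≡⟨ cancel-1+ _ _ ⟩
    fromℕ (suc m) - fromℕ (suc n)    ∎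
    where open ≡-Reasoning

  fromℤ-+ : ∀ i j → fromℤ (i ℤ.+ j) ≡ fromℤ i + fromℤ j
  fromℤ-+ (⁺ m) (⁺ n) = fromℕ-+ m n
  fromℤ-+ (⁺ m) -[1+ n ] = fromℤ-⊖ m (suc n)
  fromℤ-+ -[1+ m ] (⁺ n) = trans (fromℤ-⊖ n (suc m)) (+-comm _ _)
  fromℤ-+ -[1+ m ] -[1+ n ] = begin
    - fromℕ (suc (suc (m ℕ.+ n)))             ≡⟨ cong (λ z → - (1# + (1# + z))) (fromℕ-+ m n) ⟩
    - (1# + (1# + (fromℕ m + fromℕ n)))       ≡⟨ cong (λ z → - (1# + z)) (trans (sym (+-assoc _ _ _)) (trans (cong (_+ fromℕ n) (+-comm _ _)) (+-assoc _ _ _))) ⟩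
    - (1# + (fromℕ m + (1# + fromℕ n)))       ≡⟨ cong -_ (sym (+-assoc _ _ _)) ⟩
    - (fromℕ (suc m) + fromℕ (suc n))         ≡⟨ sym (-‿+-comm _ _) ⟩
    - fromℕ (suc m) + - fromℕ (suc n)         ∎
    where open ≡-Reasoning

  fromℤ-neg : ∀ i → fromℤ (ℤ.- i) ≡ - fromℤ i
  fromℤ-neg (⁺ zero) = sym -0#≈0#
  fromℤ-neg (⁺ suc n) = refl
  fromℤ-neg -[1+ n ] = sym (-‿involutive _)

  private
    fromℤ-*⁺ : ∀ m j → fromℤ (⁺ m ℤ.* j) ≡ fromℕ m * fromℤ j
    fromℤ-*⁺ zero j = sym (zeroˡ _)
    fromℤ-*⁺ (suc m) j = begin
      fromℤ (⁺ suc m ℤ.* j)                      ≡⟨ cong fromℤ (ℤₚ.suc-* (⁺ m) j) ⟩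
      fromℤ (j ℤ.+ (⁺ m) ℤ.* j)                    ≡⟨ fromℤ-+ j _ ⟩
      fromℤ j + fromℤ (⁺ m ℤ.* j)                ≡⟨ cong₂ _+_ (sym (*-identityˡ _)) (fromℤ-*⁺ m j) ⟩
      1# * fromℤ j + fromℕ m * fromℤ j           ≡⟨ sym (distribʳ _ _ _) ⟩
      fromℕ (suc m) * fromℤ j                    ∎
      where open ≡-Reasoning

  fromℤ-* : ∀ i j → fromℤ (i ℤ.* j) ≡ fromℤ i * fromℤ j
  fromℤ-* (⁺ m) j = fromℤ-*⁺ m j
  fromℤ-* -[1+ m ] j = begin
    fromℤ (-[1+ m ] ℤ.* j)              ≡⟨ cong fromℤ (sym (ℤₚ.neg-distribˡ-* (⁺ suc m) j)) ⟩
    fromℤ (ℤ.- (⁺ suc m ℤ.* j))         ≡⟨ fromℤ-neg (⁺ suc m ℤ.* j) ⟩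
    - fromℤ (⁺ suc m ℤ.* j)             ≡⟨ cong -_ (fromℤ-*⁺ (suc m) j) ⟩
    - (fromℕ (suc m) * fromℤ j)         ≡⟨ -‿distribˡ-* _ _ ⟩
    - fromℕ (suc m) * fromℤ j           ∎
    where open ≡-Reasoning

  fromℤ-1 : fromℤ (⁺ 1) ≡ 1#
  fromℤ-1 = +-identityʳ 1#

  fromℤ-morphism : CommutativeRing.rawRing ℤₚ.+-*-commutativeRing
                     -Raw-AlmostCommutative⟶ fromCommutativeRing commutativeRing
  fromℤ-morphism = record
    { ⟦_⟧ = fromℤ ; +-homo = fromℤ-+ ; *-homo = fromℤ-* ; -‿homo = fromℤ-neg
    ; 0-homo = refl ; 1-homo = fromℤ-1 }

  private
    weak≟ : ∀ i j → Maybe (fromℤ i ≡ fromℤ j)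
    weak≟ i j with i ℤₚ.≟ j
    ... | yes p = just (cong fromℤ p)
    ... | no _  = nothing

  module Solver = Algebra.Solver.Ring
    (CommutativeRing.rawRing ℤₚ.+-*-commutativeRing) (fromCommutativeRing commutativeRing) fromℤ-morphism weak≟
  open Solver public using (solve; _:=_; _:+_; _:*_; _:-_; :-_; con)

  ≤-refl : ∀ {x} → x ≤ x
  ≤-refl = inj₂ refl

  <⇒≤ : ∀ {x y} → x < y → x ≤ y
  <⇒≤ = inj₁

  ≤-<-trans : ∀ {x y z} → x ≤ y → y < z → x < z
  ≤-<-trans (inj₁ p)    q = <-trans p q
  ≤-<-trans (inj₂ refl) q = q

  <-≤-trans : ∀ {x y z} → x < y → y ≤ z → x < z
  <-≤-trans p (inj₁ q)    = <-trans p q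
  <-≤-trans p (inj₂ refl) = p

  ≤-trans : ∀ {x y z} → x ≤ y → y ≤ z → x ≤ z
  ≤-trans (inj₁ p)    q = inj₁ (<-≤-trans p q)
  ≤-trans (inj₂ refl) q = q

  <⇒≱ : ∀ {x y} → x < y → ¬ (y ≤ x)
  <⇒≱ p q = <-irrefl refl (<-≤-trans p q)

  <⇒≢ : ∀ {x y} → x < y → x ≢ y
  <⇒≢ p q = <-irrefl q p

  ≮⇒≥ : ∀ {x y} → ¬ (x < y) → y ≤ x
  ≮⇒≥ {x} {y} p with compare x y
  ... | tri< a _ _ = ⊥-elim (p a)
  ... | tri≈ _ b _ = inj₂ (sym b)
  ... | tri> _ _ c = inj₁ c

  ≰⇒> : ∀ {x y} → ¬ (x ≤ y) → y < x
  ≰⇒> {x} {y} p with compare x y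
  ... | tri< a _ _ = ⊥-elim (p (inj₁ a))
  ... | tri≈ _ b _ = ⊥-elim (p (inj₂ b))
  ... | tri> _ _ c = c

  <-or-≥ : ∀ x y → (x < y) ⊎ (y ≤ x)
  <-or-≥ x y with x <? y
  ... | yes p = inj₁ p
  ... | no p  = inj₂ (≮⇒≥ p)

  ≤-total : ∀ x y → (x ≤ y) ⊎ (y ≤ x)
  ≤-total x y with <-or-≥ x y
  ... | inj₁ p = inj₁ (inj₁ p)
  ... | inj₂ p = inj₂ p

  ≤-antisym : ∀ {x y} → x ≤ y → y ≤ x → x ≡ y
  ≤-antisym (inj₂ p) _ = p
  ≤-antisym (inj₁ p) q = ⊥-elim (<⇒≱ p q)

  0<⇒≢0 : ∀ {x} → 0# < x → x ≢ 0#
  0<⇒≢0 p q = <-irrefl (sym q) p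

  private
    x+-x : ∀ x → x + - x ≡ 0#
    x+-x = -‿inverseʳ
    cancel : ∀ x y → (y - x) + x ≡ y
    cancel = solve 2 (λ x y → (y :- x) :+ x := y) refl

  -- Linear inequalities are proved by exhibiting the difference of their sides
  -- as a nonnegative (positive) expression; the ring solver checks the certificate.
  lt : ∀ {x y z} → 0# < z → z ≡ y - x → x < y
  lt {x} {y} p refl = subst₂ _<_ (+-identityˡ x) (cancel x y) (+-monoˡ-< x p)

  le : ∀ {x y z} → 0# ≤ z → z ≡ y - x → x ≤ y
  le (inj₁ p) e = inj₁ (lt p e)
  le {x} {y} (inj₂ refl) e = inj₂ (trans (sym (+-identityˡ x)) (trans (cong (_+ x) e) (cancel x y)))

  lt⁻ : ∀ {x y} → x < y → 0# < y - x
  lt⁻ {x} {y} p = subst (_< y - x) (x+-x x) (+-monoˡ-< (- x) p)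

  le⁻ : ∀ {x y} → x ≤ y → 0# ≤ y - x
  le⁻ (inj₁ p) = inj₁ (lt⁻ p)
  le⁻ {x} (inj₂ refl) = inj₂ (sym (x+-x x))

  infixl 6 _+≤_ _+<_
  infixl 7 _*≤_

  _+<_ : ∀ {x y} → 0# < x → 0# ≤ y → 0# < x + y
  _+<_ {x} {y} p q = <-≤-trans p (le q (solve 2 (λ x y → y := x :+ y :- x) refl x y))

  _+≤_ : ∀ {x y} → 0# ≤ x → 0# ≤ y → 0# ≤ x + y
  inj₁ p    +≤ q = inj₁ (p +< q)
  inj₂ refl +≤ q = subst (0# ≤_) (sym (+-identityˡ _)) q

  _*≤_ : ∀ {x y} → 0# ≤ x → 0# ≤ y → 0# ≤ x * y
  inj₁ p    *≤ inj₁ q    = inj₁ (*-pos p q)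
  inj₁ p    *≤ inj₂ refl = inj₂ (sym (zeroʳ _))
  inj₂ refl *≤ q         = inj₂ (sym (zeroˡ _))

  fromℕ-nonneg : ∀ n → 0# ≤ fromℕ n
  fromℕ-nonneg zero    = ≤-refl
  fromℕ-nonneg (suc n) = inj₁ 0<1 +≤ fromℕ-nonneg n

  fromℕ-pos : ∀ n → 0# < fromℕ (suc n)
  fromℕ-pos n = 0<1 +< fromℕ-nonneg n

  fromℤ-nonneg : ∀ {i} → 0ℤ ℤ.≤ i → 0# ≤ fromℤ i
  fromℤ-nonneg {⁺ n} _ = fromℕ-nonneg n

  fromℤ-nonneg⁻ : ∀ {i} → 0# ≤ fromℤ i → 0ℤ ℤ.≤ i
  fromℤ-nonneg⁻ {⁺ n} p = ℤ.+≤+ ℕ.z≤n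
  fromℤ-nonneg⁻ { -[1+ n ]} p = ⊥-elim (<⇒≱ (lt (fromℕ-pos n) (solve 1 (λ x → x := con 0ℤ :- (:- x)) refl _)) p)

  fromℤ-sub : ∀ i j → fromℤ (i ℤ.- j) ≡ fromℤ i - fromℤ j
  fromℤ-sub i j = trans (fromℤ-+ i (ℤ.- j)) (cong (fromℤ i +_) (fromℤ-neg j))

  fromℤ-mono : ∀ {i j} → i ℤ.≤ j → fromℤ i ≤ fromℤ j
  fromℤ-mono {i} {j} p = le (fromℤ-nonneg (ℤₚ.i≤j⇒0≤j-i p)) (fromℤ-sub j i)

  fromℤ-cancel : ∀ {i j} → fromℤ i ≤ fromℤ j → i ℤ.≤ j
  fromℤ-cancel {i} {j} p = ℤₚ.0≤i-j⇒j≤i (fromℤ-nonneg⁻ (subst (0# ≤_) (sym (fromℤ-sub j i)) (le⁻ p)))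

  fromℤ-cancel-< : ∀ {i j} → fromℤ i < fromℤ j → i ℤ.< j
  fromℤ-cancel-< p = ℤₚ.≰⇒> (λ q → <⇒≱ p (fromℤ-mono q))

  fromℤ-injective : ∀ {i j} → fromℤ i ≡ fromℤ j → i ≡ j
  fromℤ-injective p = ℤₚ.≤-antisym (fromℤ-cancel (inj₂ p)) (fromℤ-cancel (inj₂ (sym p)))

  fromℕ-injective : ∀ {m n} → fromℕ m ≡ fromℕ n → m ≡ n
  fromℕ-injective p = ℤₚ.+-injective (fromℤ-injective p)

  *-monoˡ : ∀ {x y z} → 0# ≤ z → x ≤ y → x * z ≤ y * z
  *-monoˡ {x} {y} {z} p q = le (le⁻ q *≤ p) (solve 3 (λ x y z → (y :- x) :* z := y :* z :- x :* z) refl x y z)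

  *-mono-< : ∀ {x y z} → 0# < z → x < y → x * z < y * z
  *-mono-< {x} {y} {z} p q = lt (*-pos (lt⁻ q) p) (solve 3 (λ x y z → (y :- x) :* z := y :* z :- x :* z) refl x y z)

  *-cancel-≤ : ∀ {x y z} → 0# < z → x * z ≤ y * z → x ≤ y
  *-cancel-≤ p q = ≮⇒≥ (λ r → <⇒≱ (*-mono-< p r) q)

  *-cancel-< : ∀ {x y z} → 0# < z → x * z < y * z → x < y
  *-cancel-< p q = ≰⇒> (λ r → <⇒≱ q (*-monoˡ (inj₁ p) r))

  slope-≤ : ∀ {m n L} → 0# < L → fromℤ m * L ≤ fromℤ n * L → m ℤ.≤ n
  slope-≤ p q = fromℤ-cancel (*-cancel-≤ p q)

  slope-< : ∀ {m n L} → 0# < L → fromℤ m * L < fromℤ n * L → m ℤ.< n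
  slope-< p q = fromℤ-cancel-< (*-cancel-< p q)

ℤ-le : ∀ {i j k} → 0ℤ ℤ.≤ k → k ≡ j ℤ.- i → i ℤ.≤ j
ℤ-le p refl = ℤₚ.0≤i-j⇒j≤i p

ℤ-le⁻ : ∀ {i j} → i ℤ.≤ j → 0ℤ ℤ.≤ j ℤ.- i
ℤ-le⁻ = ℤₚ.i≤j⇒0≤j-i

infixl 6 _⊞_
_⊞_ : ∀ {i j} → 0ℤ ℤ.≤ i → 0ℤ ℤ.≤ j → 0ℤ ℤ.≤ i ℤ.+ j
_⊞_ = ℤₚ.+-mono-≤

if-cong : ∀ {A : Set} {b b′ : Bool} {x y : A} → b ≡ b′ → (if b then x else y) ≡ (if b′ then x else y)
if-cong refl = refl

-- Formal sums of points and effectivity.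

module FormalSums {P : Set} (_≟_ : DecidableEquality P) where

  FormalSum : Set
  FormalSum = List (P × ℤ)

  -- The mass of a formal sum on a set of points. Coefficients are the case of a singleton, the
  -- degree is the case of all points, and superlevel sets of a potential are the case behind the
  -- bound on slopes.
  wsum : (P → Bool) → FormalSum → ℤ
  wsum U F = foldr ℤ._+_ 0ℤ (map (λ (w , c) → if U w then c else 0ℤ) F)

  coeff : FormalSum → P → ℤ
  coeff F v = wsum (λ w → does (w ≟ v)) F

  Effective : FormalSum → Set
  Effective F = ∀ v → 0ℤ ℤ.≤ coeff F v

  wsum-++ : ∀ U F G → wsum U (F ++ G) ≡ wsum U F ℤ.+ wsum U G
  wsum-++ U [] G = sym (ℤₚ.+-identityˡ _)
  wsum-++ U ((w , c) ∷ F) G = trans (cong (ℤ._+_ a) (wsum-++ U F G)) (sym (ℤₚ.+-assoc a _ _))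
    where a = if U w then c else 0ℤ

  wsum-none : ∀ {U} F → (∀ {w c} → (w , c) ∈ F → U w ≡ false) → wsum U F ≡ 0ℤ
  wsum-none {U} [] h = refl
  wsum-none {U} ((w , c) ∷ F) h rewrite h (here refl) = trans (ℤₚ.+-identityˡ _) (wsum-none F (h ∘ there))

  coeff-none : ∀ F v → (∀ {w c} → (w , c) ∈ F → w ≢ v) → coeff F v ≡ 0ℤ
  coeff-none F v h = wsum-none F (λ {w} i → dec-false (w ≟ v) (h i))

  all-sum : FormalSum → ℤ
  all-sum F = foldr ℤ._+_ 0ℤ (map proj₂ F)

  pts : ℤ → List P → FormalSum
  pts c = map (_, c)

  without : P → FormalSum → FormalSum
  without w = filter (λ (w′ , _) → ¬? (w′ ≟ w))

  wsum-without : ∀ U w F → wsum U F ≡ (if U w then coeff F w else 0ℤ) ℤ.+ wsum U (without w F)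
  wsum-without U w [] with U w
  ... | true  = refl
  ... | false = refl
  wsum-without U w ((w′ , c) ∷ F) with w′ ≟ w | wsum-without U w F
  ... | yes refl | ih with U w
  ...   | true  = trans (cong (ℤ._+_ c) ih) (sym (ℤₚ.+-assoc c _ _))
  ...   | false = cong (ℤ._+_ 0ℤ) (trans ih (ℤₚ.+-identityˡ (wsum U (without w F))))
  wsum-without U w ((w′ , c) ∷ F) | no _ | ih with U w
  ...   | true  = trans (cong (ℤ._+_ x) ih) (ℤsolve 3 (λ x a b → x ⊕′ (a ⊕′ b) ⊜ (const 0ℤ ⊕′ a) ⊕′ (x ⊕′ b)) refl x (coeff F w) (wsum U (without w F)))
    where x = if U w′ then c else 0ℤ
  ...   | false = trans (cong (ℤ._+_ x) (trans ih (ℤₚ.+-identityˡ _))) (sym (ℤₚ.+-identityˡ _))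
    where x = if U w′ then c else 0ℤ

  coeff-without-≡ : ∀ w F → coeff (without w F) w ≡ 0ℤ
  coeff-without-≡ w F = coeff-none (without w F) w λ i → proj₂ (∈ₚ.∈-filter⁻ (λ (w′ , _) → ¬? (w′ ≟ w)) {xs = F} i)

  coeff-without-≢ : ∀ w F v → w ≢ v → coeff (without w F) v ≡ coeff F v
  coeff-without-≢ w F v w≢v = sym (trans (wsum-without _ w F)
    (trans (cong (λ b → (if b then coeff F w else 0ℤ) ℤ.+ coeff (without w F) v) (dec-false (w ≟ v) w≢v)) (ℤₚ.+-identityˡ _)))

  effective-without : ∀ w F → Effective F → Effective (without w F)
  effective-without w F eff v with w ≟ v
  ... | yes refl = ℤₚ.≤-reflexive (sym (coeff-without-≡ w F))
  ... | no w≢v = subst (0ℤ ℤ.≤_) (sym (coeff-without-≢ w F v w≢v)) (eff v)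

  wsum-replicate : ∀ U n w → wsum U (pts (⁺ 1) (replicate n w)) ≡ (if U w then ⁺ n else 0ℤ)
  wsum-replicate U zero w with U w
  ... | true  = refl
  ... | false = refl
  wsum-replicate U (suc n) w with U w | wsum-replicate U n w
  ... | true  | ih = cong (ℤ._+_ (⁺ 1)) ih
  ... | false | ih = cong (ℤ._+_ 0ℤ) ih

  Resolves : List P → FormalSum → Set
  Resolves ps F = ∀ U → wsum U F ≡ wsum U (pts (⁺ 1) ps)

  -- A formal sum may list a point several times with coefficients of either sign, so the total
  -- coefficient of its first point is turned into copies of that point and all its occurrences are
  -- removed at once. The remainder is shorter, whence the recursion on a bound for the size.
  effective⇒points : ∀ F → Effective F → ∃ λ ps → Resolves ps F
  effective⇒points F = go (size F) F ℕₚ.≤-refl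
    where
    go : ∀ n F → size F ℕ.≤ n → Effective F → ∃ λ ps → Resolves ps F
    go n [] _ eff = [] , λ U → refl
    go (suc n) F@((w , c) ∷ F′) (ℕ.s≤s le) eff = replicate k w ++ ps , λ U → begin
        wsum U F                                                       ≡⟨ wsum-without U w F ⟩
        (if U w then coeff F w else 0ℤ) ℤ.+ wsum U (without w F)       ≡⟨ cong₂ ℤ._+_ (head U) (res U) ⟩
        wsum U (pts (⁺ 1) (replicate k w)) ℤ.+ wsum U (pts (⁺ 1) ps)     ≡⟨ sym (wsum-++ U (pts (⁺ 1) (replicate k w)) (pts (⁺ 1) ps)) ⟩
        wsum U (pts (⁺ 1) (replicate k w) ++ pts (⁺ 1) ps)               ≡⟨ cong (wsum U) (sym (Listₚ.map-++ (_, ⁺ 1) (replicate k w) ps)) ⟩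
        wsum U (pts (⁺ 1) (replicate k w ++ ps))                       ∎
      where
      open ≡-Reasoning
      shorter : size (without w F) ℕ.≤ n
      shorter = ℕₚ.≤-trans (ℕ.s≤s⁻¹ (Listₚ.filter-notAll (λ (w′ , _) → ¬? (w′ ≟ w)) F (here (λ h → h refl)))) le
      rec = go n (without w F) shorter (effective-without w F eff)
      ps  = proj₁ rec
      res = proj₂ rec
      k   = ℤ.∣ coeff F w ∣
      head : ∀ U → (if U w then coeff F w else 0ℤ) ≡ wsum U (pts (⁺ 1) (replicate k w))
      head U = sym (trans (wsum-replicate U k w) (cong (λ z → if U w then z else 0ℤ) (ℤₚ.0≤i⇒+∣i∣≡i (eff w))))

  wsum-points : ∀ U ps → 0ℤ ℤ.≤ wsum U (pts (⁺ 1) ps)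
  wsum-points U [] = ℤₚ.≤-refl
  wsum-points U (p ∷ ps) with U p
  ... | true  = ℤ.+≤+ ℕ.z≤n ⊞ wsum-points U ps
  ... | false = ℤₚ.≤-refl ⊞ wsum-points U ps

  effective⇒wsum : ∀ F → Effective F → ∀ U → 0ℤ ℤ.≤ wsum U F
  effective⇒wsum F eff U with effective⇒points F eff
  ... | ps , res = subst (0ℤ ℤ.≤_) (sym (res U)) (wsum-points U ps)

  wsum-all : ∀ F → wsum (λ _ → true) F ≡ all-sum F
  wsum-all [] = refl
  wsum-all (x ∷ F) = cong (ℤ._+_ (proj₂ x)) (wsum-all F)

  wsum-pts : ∀ U c ps → wsum U (pts (ℤ.- c) ps) ≡ ℤ.- wsum U (pts c ps)
  wsum-pts U c [] = refl
  wsum-pts U c (p ∷ ps) with U p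
  ... | true  = trans (cong (ℤ._+_ (ℤ.- c)) (wsum-pts U c ps)) (sym (ℤₚ.neg-distrib-+ c _))
  ... | false = trans (cong (ℤ._+_ 0ℤ) (wsum-pts U c ps)) (sym (ℤₚ.neg-distrib-+ 0ℤ (wsum U (pts c ps))))

  -- Elsewhere the coefficient is zero, so effectivity becomes a finite test, which is the one that
  -- the program performs.
  effective-check : ∀ F → (∀ {w c} → (w , c) ∈ F → 0ℤ ℤ.≤ coeff F w) → Effective F
  effective-check F h v with Any.any? (λ (w , _) → w ≟ v) F
  ... | no ∉F = ℤₚ.≤-reflexive (sym (coeff-none F v λ i w≡v → ∉F (Any.map (λ { refl → w≡v }) i)))
  ... | yes ∈F = found F ∈F h
    where
    found : ∀ G → Any (λ (w , _) → w ≡ v) G → (∀ {w c} → (w , c) ∈ G → 0ℤ ℤ.≤ coeff F w) → 0ℤ ℤ.≤ coeff F v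
    found (_ ∷ _) (here refl) h = h (here refl)
    found (_ ∷ G) (there i)   h = found G i (h ∘ there)

  coeff-≢ : ∀ {w v} c F → w ≢ v → coeff ((w , c) ∷ F) v ≡ coeff F v
  coeff-≢ {w} {v} c F w≢v = trans (cong (ℤ._+ coeff F v) (if-cong (dec-false (w ≟ v) w≢v))) (ℤₚ.+-identityˡ _)

  -- Required for all sets and not only for single points, since it is applied to superlevel sets.
  Bounds : ℕ → FormalSum → Set
  Bounds B F = ∀ U → wsum U F ℤ.≤ ⁺ B

-- Slope systems on a weighted graph and the maximum of two solutions.

module Network (R : RealField) {P : Set} (_≟ₚ_ : DecidableEquality P) where
  open Field R
  open FormalSums _≟ₚ_

  Link : Set
  Link = P × P × Carrier

  Sloped : Set
  Sloped = Link × ℤ × ℤ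

  div : List Sloped → FormalSum
  div [] = []
  div (((u , v , _) , a , b) ∷ r) = (u , a) ∷ (v , b) ∷ div r

  Valid : (P → Carrier) → Sloped → Set
  Valid x ((u , v , L) , a , b) = fromℤ a * L ≤ x v - x u × fromℤ b * L ≤ x u - x v

  -- Some integer slopes at the ends of the links, compatible with the values x of a
  -- function that is convex along each link, make D plus its divisor effective.
  record Feasible (N : List Link) (D : FormalSum) : Set where
    constructor feasible
    field
      potential : P → Carrier
      slopes    : List Sloped
      links     : map proj₁ slopes ≡ N
      valid     : All (Valid potential) slopes
      effective : Effective (D ++ div slopes)

  feasible-cong : ∀ {N D D′} → (∀ v → coeff D v ≡ coeff D′ v) → Feasible N D → Feasible N D′
  feasible-cong {_} {D} {D′} h (feasible x r l va eff) = feasible x r l va λ v →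
    subst (0ℤ ℤ.≤_) (trans (wsum-++ _ D (div r)) (trans (cong (λ z → z ℤ.+ coeff (div r) v) (h v)) (sym (wsum-++ _ D′ (div r))))) (eff v)

  wsum-div-↭ : ∀ U {r r′} → r ↭ r′ → wsum U (div r) ≡ wsum U (div r′)
  wsum-div-↭ U ↭.refl = refl
  wsum-div-↭ U (prep ((u , v , _) , a , b) q) =
    cong (λ z → (if U u then a else 0ℤ) ℤ.+ ((if U v then b else 0ℤ) ℤ.+ z)) (wsum-div-↭ U q)
  wsum-div-↭ U (swap ((u , v , _) , a , b) ((u′ , v′ , _) , a′ , b′) q) =
    trans (cong (λ z → i u a ℤ.+ (i v b ℤ.+ (i u′ a′ ℤ.+ (i v′ b′ ℤ.+ z)))) (wsum-div-↭ U q))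
          (ℤsolve 5 (λ s t s′ t′ z → s ⊕′ (t ⊕′ (s′ ⊕′ (t′ ⊕′ z))) ⊜ s′ ⊕′ (t′ ⊕′ (s ⊕′ (t ⊕′ z)))) refl (i u a) (i v b) (i u′ a′) (i v′ b′) _)
    where i = λ w c → if U w then c else 0ℤ
  wsum-div-↭ U (↭.trans q q′) = trans (wsum-div-↭ U q) (wsum-div-↭ U q′)

  feasible-↭ : ∀ {N N′ D} → N ↭ N′ → Feasible N D → Feasible N′ D
  feasible-↭ {D = D} q (feasible x r refl va eff) with ↭ₚ.↭-map-inv proj₁ q
  ... | r′ , l , q′ = feasible x r′ (sym l) (↭ₚ.All-resp-↭ q′ va) λ v →
    subst (0ℤ ℤ.≤_) (trans (wsum-++ _ D (div r)) (trans (cong (λ z → coeff D v ℤ.+ z) (wsum-div-↭ _ q′)) (sym (wsum-++ _ D (div r′))))) (eff v)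

  Avoids : P → Link → Set
  Avoids p (u , v , _) = u ≢ p × v ≢ p

  coeff-avoids : ∀ p r → All (Avoids p) (map proj₁ r) → coeff (div r) p ≡ 0ℤ
  coeff-avoids p [] [] = refl
  coeff-avoids p (((u , v , _) , a , b) ∷ r) ((u≢p , v≢p) ∷ h) =
    trans (coeff-≢ a ((v , b) ∷ div r) u≢p) (trans (coeff-≢ b (div r) v≢p) (coeff-avoids p r h))

  valid-shift : ∀ x c r → All (Valid x) r → All (Valid (λ w → x w + c)) r
  valid-shift x c r = All.map λ { {(u , v , L) , a , b} (p , q) →
      subst (fromℤ a * L ≤_) (shift (x v) (x u)) p , subst (fromℤ b * L ≤_) (shift (x u) (x v)) q }
    where shift = λ s t → solve 3 (λ s t c → s :- t := (s :+ c) :- (t :+ c)) refl s t c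

  fromℤ-pred : ∀ a → fromℤ (a ℤ.- (⁺ 1)) ≡ fromℤ a - 1#
  fromℤ-pred a = trans (fromℤ-sub a (⁺ 1)) (cong (λ z → fromℤ a - z) fromℤ-1)

  fromℤ-suc : ∀ a → fromℤ (a ℤ.+ (⁺ 1)) ≡ fromℤ a + 1#
  fromℤ-suc a = trans (fromℤ-+ a (⁺ 1)) (cong (λ z → fromℤ a + z) fromℤ-1)

  -- The first two hypotheses give `a` ≤ -`β`; the third says that after lowering p by `δ` the slope
  -- from p to u is at most `β` + 1. Hence `a` - 1 still fits, and the lost unit is paid by the chip
  -- left over at u.
  lower-surplus : ∀ {a β L xp xu δ} → fromℤ a * L ≤ xp - xu → β * L ≤ xu - xp →
                  δ ≤ L - (xu - xp - β * L) → fromℤ (a ℤ.- (⁺ 1)) * L ≤ (xp - δ) - xu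
  lower-surplus {a} {β} {L} {xp} {xu} {δ} p q r = le (le⁻ p +≤ le⁻ q +≤ le⁻ r)
    (trans (solve 6 (λ a β L xp xu δ →
        (((xp :- xu) :- a :* L) :+ ((xu :- xp) :- β :* L)) :+ ((L :- ((xu :- xp) :- β :* L)) :- δ)
        := ((xp :- δ) :- xu) :- (a :- con (⁺ 1)) :* L) refl (fromℤ a) β L xp xu δ)
      (cong (λ z → ((xp - δ) - xu) - z * L) (trans (cong (λ o → fromℤ a - o) fromℤ-1) (sym (fromℤ-pred a)))))

  -- Strictness gives `a` < -`β`, and for integers this means `a` ≤ -`β` - 1. The unit of slope that
  -- lowering p may consume is thus already available, and `a` itself is kept.
  lower-strict : ∀ {a β L xp yu δ} → 0# < L → fromℤ a * L ≤ xp - yu → fromℤ β * L < yu - xp →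
                 δ ≤ L - (yu - xp - fromℤ β * L) → fromℤ a * L ≤ (xp - δ) - yu
  lower-strict {a} {β} {L} {xp} {yu} {δ} L>0 p q r = le (le⁻ r +≤ (le⁻ bound *≤ <⇒≤ L>0))
    (trans (cong (λ z → (L - (yu - xp - fromℤ β * L) - δ) + (z - fromℤ a) * L)
        (trans (fromℤ-pred (ℤ.- β)) (cong (λ z → z - 1#) (fromℤ-neg β))))
      (trans (cong (λ o → (L - (yu - xp - fromℤ β * L) - δ) + ((- fromℤ β - o) - fromℤ a) * L) (sym fromℤ-1))
      (solve 6 (λ a β L xp yu δ → ((L :- ((yu :- xp) :- β :* L)) :- δ) :+ (((:- β) :- con (⁺ 1)) :- a) :* L
        := ((xp :- δ) :- yu) :- a :* L) refl (fromℤ a) (fromℤ β) L xp yu δ)))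
    where
    a<-β : a ℤ.< ℤ.- β
    a<-β = slope-< L>0 (≤-<-trans p (lt (lt⁻ q)
      (trans (solve 4 (λ β L xp yu → (yu :- xp) :- β :* L := (:- β) :* L :- (xp :- yu)) refl (fromℤ β) L xp yu)
        (cong (λ z → z * L - (xp - yu)) (sym (fromℤ-neg β))))))
    bound : fromℤ a ≤ fromℤ (ℤ.- β ℤ.- (⁺ 1))
    bound = fromℤ-mono {a} {ℤ.- β ℤ.- (⁺ 1)} (ℤ-le (ℤ-le⁻ (ℤₚ.i<j⇒suc[i]≤j a<-β))
      (ℤsolve 2 (λ a β → (⊝ β) ⊖′ (const (⁺ 1) ⊕′ a) ⊜ ((⊝ β) ⊖′ const (⁺ 1)) ⊖′ a) refl a β))

  uncons : ∀ (e e′ : Link) {N N′ : List Link} → _≡_ {A = List Link} (e ∷ N) (e′ ∷ N′) → e ≡ e′ × N ≡ N′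
  uncons e .e refl = refl , refl

  at? : ∀ {A : Set} → Dec A → ℤ → ℤ
  at? d c = if does d then c else 0ℤ

  -- The maximum of two solutions. Each end of a link keeps the slope of the function chosen at the
  -- point where it sits; the slope stays valid because the value at the other end can only rise,
  -- and the divisor at a point is that of the function chosen there. How ties are broken is left to
  -- `s`.
  module Join {x y : P → Carrier} (s : P → Bool)
    (s-true : ∀ w → s w ≡ true → y w ≤ x w) (s-false : ∀ w → s w ≡ false → x w ≤ y w) where

    join : P → Carrier
    join w = if s w then x w else y w

    x≤join : ∀ w → x w ≤ join w
    x≤join w with s w in eq
    ... | true  = ≤-refl
    ... | false = s-false w eq

    y≤join : ∀ w → y w ≤ join w
    y≤join w with s w in eq
    ... | true  = s-true w eq
    ... | false = ≤-refl

    pick-valid : ∀ u v a a′ L → fromℤ a * L ≤ x v - x u → fromℤ a′ * L ≤ y v - y u →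
                 fromℤ (if s u then a else a′) * L ≤ join v - join u
    pick-valid u v a a′ L p q with s u
    ... | true  = le (le⁻ p +≤ le⁻ (x≤join v)) (solve 4 (λ aL xv xu jv → ((xv :- xu) :- aL) :+ (jv :- xv) := (jv :- xu) :- aL) refl (fromℤ a * L) (x v) (x u) (join v))
    ... | false = le (le⁻ q +≤ le⁻ (y≤join v)) (solve 4 (λ aL xv xu jv → ((xv :- xu) :- aL) :+ (jv :- xv) := (jv :- xu) :- aL) refl (fromℤ a′ * L) (y v) (y u) (join v))

    pick : ∀ (r r′ : List Sloped) → map proj₁ r ≡ map proj₁ r′ → List Sloped
    pick [] _ _ = []
    pick (_ ∷ _) [] ()
    pick (((u , v , L) , a , b) ∷ r) ((_ , a′ , b′) ∷ r′) eq =
      ((u , v , L) , (if s u then a else a′) , (if s v then b else b′)) ∷ pick r r′ (Listₚ.∷-injectiveʳ eq)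

    pick-links : ∀ r r′ eq → map proj₁ (pick r r′ eq) ≡ map proj₁ r
    pick-links [] _ _ = refl
    pick-links (_ ∷ _) [] ()
    pick-links (_ ∷ r) (_ ∷ r′) eq = cong (_ ∷_) (pick-links r r′ (Listₚ.∷-injectiveʳ eq))

    pick-all-valid : ∀ r r′ eq → All (Valid x) r → All (Valid y) r′ → All (Valid join) (pick r r′ eq)
    pick-all-valid [] _ _ _ _ = []
    pick-all-valid (_ ∷ _) [] ()
    pick-all-valid (((u , v , L) , a , b) ∷ r) ((e′ , a′ , b′) ∷ r′) eq ((p , q) ∷ h) ((p′ , q′) ∷ h′)
      with uncons (u , v , L) e′ eq
    ... | refl , _ = (pick-valid u v a a′ L p p′ , pick-valid v u b b′ L q q′) ∷ pick-all-valid r r′ _ h h′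

    pick-coeff : ∀ w r r′ eq → coeff (div (pick r r′ eq)) w ≡ (if s w then coeff (div r) w else coeff (div r′) w)
    pick-coeff w [] [] eq with s w
    ... | true  = refl
    ... | false = refl
    pick-coeff w (_ ∷ _) [] ()
    pick-coeff w (((u , v , L) , a , b) ∷ r) ((e′ , a′ , b′) ∷ r′) eq with uncons (u , v , L) e′ eq
    ... | refl , _ = trans (cong₂ ℤ._+_ (end u a a′ (u ≟ₚ w)) (cong₂ ℤ._+_ (end v b b′ (v ≟ₚ w)) (pick-coeff w r r′ _))) split
      where
      end : ∀ u a a′ (d : Dec (u ≡ w)) → at? d (if s u then a else a′) ≡ (if s w then at? d a else at? d a′)
      end u a a′ (yes refl) = refl
      end u a a′ (no _) with s w
      ... | true  = refl
      ... | false = refl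
      split : ∀ {i j k i′ j′ k′} → (if s w then i else i′) ℤ.+ ((if s w then j else j′) ℤ.+ (if s w then k else k′))
              ≡ (if s w then i ℤ.+ (j ℤ.+ k) else i′ ℤ.+ (j′ ℤ.+ k′))
      split with s w
      ... | true  = refl
      ... | false = refl

  valid-cong : ∀ {z z′ p r} → (∀ w → w ≢ p → z w ≡ z′ w) → All (Avoids p) (map proj₁ r) → All (Valid z) r → All (Valid z′) r
  valid-cong {r = []} h [] [] = []
  valid-cong {r = ((u , v , L) , a , b) ∷ r} h ((u≢p , v≢p) ∷ av) ((p , q) ∷ va) =
    (subst₂ (λ s t → fromℤ a * L ≤ s - t) (h v v≢p) (h u u≢p) p , subst₂ (λ s t → fromℤ b * L ≤ s - t) (h u u≢p) (h v v≢p) q)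
    ∷ valid-cong h av va

-- Exchanging chips at both ends of a segment for a chip inside.

module Exchange (R : RealField) {P : Set} (_≟ₚ_ : DecidableEquality P) where
  open Field R
  open FormalSums _≟ₚ_
  open Network R _≟ₚ_

  -1ℤ : ℤ
  -1ℤ = -[1+ 0 ]

  module _ {u v p : P} {L₁ L₂ : Carrier} {N : List Link} {D : FormalSum}
    (L₁>0 : 0# < L₁) (L₂>0 : 0# < L₂) (u≢v : u ≢ v) (u≢p : u ≢ p) (v≢p : v ≢ p) (avoids : All (Avoids p) N) where

    private
      balance : P → ℤ → ℤ → ℤ → ℤ → ℤ → ℤ → P → ℤ
      balance q c a₁ b₁ a₂ b₂ k w = at? (q ≟ₚ w) c ℤ.+ (coeff D w ℤ.+
        (at? (u ≟ₚ w) a₁ ℤ.+ (at? (p ≟ₚ w) b₁ ℤ.+ (at? (p ≟ₚ w) a₂ ℤ.+ (at? (v ≟ₚ w) b₂ ℤ.+ k)))))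

      balance-≡ : ∀ q c a₁ b₁ a₂ b₂ r w →
        coeff (((q , c) ∷ D) ++ div (((u , p , L₁) , a₁ , b₁) ∷ ((p , v , L₂) , a₂ , b₂) ∷ r)) w
          ≡ balance q c a₁ b₁ a₂ b₂ (coeff (div r) w) w
      balance-≡ q c a₁ b₁ a₂ b₂ r w = cong (λ z → at? (q ≟ₚ w) c ℤ.+ z) (wsum-++ _ D _)

    module Joined (x y : P → Carrier) (xp≡yp : x p ≡ y p) (a₁ b₁ a₂ b₂ a₁′ b₁′ a₂′ b₂′ : ℤ) (r r′ : List Sloped)
      (r-links : map proj₁ r ≡ N) (r′-links : map proj₁ r′ ≡ N)
      (va₁ : Valid x ((u , p , L₁) , a₁ , b₁)) (va₂ : Valid x ((p , v , L₂) , a₂ , b₂)) (va : All (Valid x) r)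
      (vb₁ : Valid y ((u , p , L₁) , a₁′ , b₁′)) (vb₂ : Valid y ((p , v , L₂) , a₂′ , b₂′)) (vb : All (Valid y) r′)
      (eff-x : ∀ w → 0ℤ ℤ.≤ balance u -1ℤ a₁ b₁ a₂ b₂ (coeff (div r) w) w)
      (eff-y : ∀ w → 0ℤ ℤ.≤ balance v -1ℤ a₁′ b₁′ a₂′ b₂′ (coeff (div r′) w) w)
      where

      -- Ties go to `x`, except at `v`, where they go to `y`. With respect to `D`, the solution `x`
      -- has a spare chip at `u` and `y` has one at `v`. So at each of these two ends either the
      -- chosen function has the spare chip, or it lies strictly above the other one; these are the
      -- situations of `lower-surplus` and `lower-strict`.
      s : P → Bool
      s w = if does (w ≟ₚ v) then does (y w <? x w) else not (does (x w <? y w))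

      s-true : ∀ w → s w ≡ true → y w ≤ x w
      s-true w eq with w ≟ₚ v
      s-true w eq | yes _ with y w <? x w
      s-true w eq | yes _ | yes q = <⇒≤ q
      s-true w () | yes _ | no _
      s-true w eq | no _ with x w <? y w
      s-true w () | no _ | yes _
      s-true w eq | no _ | no q = ≮⇒≥ q

      s-false : ∀ w → s w ≡ false → x w ≤ y w
      s-false w eq with w ≟ₚ v
      s-false w eq | yes _ with y w <? x w
      s-false w () | yes _ | yes _
      s-false w eq | yes _ | no q = ≮⇒≥ q
      s-false w eq | no _ with x w <? y w
      s-false w eq | no _ | yes q = <⇒≤ q
      s-false w () | no _ | no _

      s-u : s u ≡ false → x u < y u
      s-u eq with u ≟ₚ v
      ... | yes u≡v = ⊥-elim (u≢v u≡v)
      ... | no _ with x u <? y u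
      ...   | yes q = q
      s-u () | no _ | no _

      s-v : s v ≡ true → y v < x v
      s-v eq with v ≟ₚ v
      s-v eq | no v≢v = ⊥-elim (v≢v refl)
      s-v eq | yes _ with y v <? x v
      ... | yes q = q
      s-v () | yes _ | no _

      open Join s s-true s-false

      eq-links : map proj₁ r ≡ map proj₁ r′
      eq-links = trans r-links (sym r′-links)

      joined : List Sloped
      joined = pick r r′ eq-links

      joined-links : map proj₁ joined ≡ N
      joined-links = trans (pick-links r r′ eq-links) r-links

      avoids-zero : ∀ q → map proj₁ q ≡ N → coeff (div q) p ≡ 0ℤ
      avoids-zero q eq = coeff-avoids p q (subst (All (Avoids p)) (sym eq) avoids)

      -- Away from `u`, `v` and `p` the maximum supplies everything. At `u` the slope may fall by
      -- one if `x` is chosen, because the chip subtracted from `D` there is given back, and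
      -- likewise at `v` if `y` is chosen. What remains open is the value `zp` and the balance at
      -- `p`.
      assemble : ∀ zp A₁ B₁ A₂ B₂ →
        Valid (λ w → if does (w ≟ₚ p) then zp else join w) ((u , p , L₁) , A₁ , B₁) →
        Valid (λ w → if does (w ≟ₚ p) then zp else join w) ((p , v , L₂) , A₂ , B₂) →
        (if s u then a₁ ℤ.- (⁺ 1) else a₁′) ℤ.≤ A₁ → (if s v then b₂ else b₂′ ℤ.- (⁺ 1)) ℤ.≤ B₂ →
        0ℤ ℤ.≤ -1ℤ ℤ.+ (coeff D p ℤ.+ (B₁ ℤ.+ A₂)) →
        Feasible ((u , p , L₁) ∷ (p , v , L₂) ∷ N) ((p , -1ℤ) ∷ D)
      assemble zp A₁ B₁ A₂ B₂ v₁ v₂ le-u le-v le-p = feasible z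
        (((u , p , L₁) , A₁ , B₁) ∷ ((p , v , L₂) , A₂ , B₂) ∷ joined)
        (cong (λ N → (u , p , L₁) ∷ (p , v , L₂) ∷ N) joined-links)
        (v₁ ∷ v₂ ∷ valid-cong (λ w w≢p → sym (if-cong (dec-false (w ≟ₚ p) w≢p)))
                     (subst (All (Avoids p)) (sym joined-links) avoids) (pick-all-valid r r′ eq-links va vb))
        λ w → subst (0ℤ ℤ.≤_) (sym (trans (balance-≡ p -1ℤ A₁ B₁ A₂ B₂ joined w)
                 (cong (λ k → balance p -1ℤ A₁ B₁ A₂ B₂ k w) (pick-coeff w r r′ eq-links))))
               (go w (u ≟ₚ w) (p ≟ₚ w) (v ≟ₚ w) (eff-x w) (eff-y w) )
        where
        z : P → Carrier
        z w = if does (w ≟ₚ p) then zp else join w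
        k = λ w → if s w then coeff (div r) w else coeff (div r′) w
        go : ∀ w (du : Dec (u ≡ w)) (dp : Dec (p ≡ w)) (dv : Dec (v ≡ w)) →
          0ℤ ℤ.≤ at? du -1ℤ ℤ.+ (coeff D w ℤ.+ (at? du a₁ ℤ.+ (at? dp b₁ ℤ.+ (at? dp a₂ ℤ.+ (at? dv b₂ ℤ.+ coeff (div r) w))))) →
          0ℤ ℤ.≤ at? dv -1ℤ ℤ.+ (coeff D w ℤ.+ (at? du a₁′ ℤ.+ (at? dp b₁′ ℤ.+ (at? dp a₂′ ℤ.+ (at? dv b₂′ ℤ.+ coeff (div r′) w))))) →
          0ℤ ℤ.≤ at? dp -1ℤ ℤ.+ (coeff D w ℤ.+ (at? du A₁ ℤ.+ (at? dp B₁ ℤ.+ (at? dp A₂ ℤ.+ (at? dv B₂ ℤ.+ k w)))))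
        go w (yes u≡w) (yes p≡w) _ _ _ = ⊥-elim (u≢p (trans u≡w (sym p≡w)))
        go w (yes u≡w) _ (yes v≡w) _ _ = ⊥-elim (u≢v (trans u≡w (sym v≡w)))
        go w _ (yes p≡w) (yes v≡w) _ _ = ⊥-elim (v≢p (trans v≡w (sym p≡w)))
        go w (no _) (yes refl) (no _) _ _ = subst (0ℤ ℤ.≤_)
          (trans (ℤsolve 3 (λ d b a → const -1ℤ ⊕′ (d ⊕′ (b ⊕′ a)) ⊜ const -1ℤ ⊕′ (d ⊕′ (const 0ℤ ⊕′ (b ⊕′ (a ⊕′ (const 0ℤ ⊕′ const 0ℤ)))))) refl (coeff D p) B₁ A₂)
            (cong (λ k → -1ℤ ℤ.+ (coeff D p ℤ.+ (0ℤ ℤ.+ (B₁ ℤ.+ (A₂ ℤ.+ (0ℤ ℤ.+ k)))))) (sym kp))) le-p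
          where
          kp : k p ≡ 0ℤ
          kp with s p
          ... | true  = avoids-zero r r-links
          ... | false = avoids-zero r′ r′-links
        go w (yes refl) (no _) (no _) hx hy with s u
        ... | true  = subst (0ℤ ℤ.≤_) (ℤsolve 4 (λ d a A k →
              (const -1ℤ ⊕′ (d ⊕′ (a ⊕′ (const 0ℤ ⊕′ (const 0ℤ ⊕′ (const 0ℤ ⊕′ k)))))) ⊕′ (A ⊖′ (a ⊖′ const (⁺ 1)))
              ⊜ const 0ℤ ⊕′ (d ⊕′ (A ⊕′ (const 0ℤ ⊕′ (const 0ℤ ⊕′ (const 0ℤ ⊕′ k)))))) refl (coeff D u) a₁ A₁ (coeff (div r) u)) (hx ⊞ ℤ-le⁻ le-u)
        ... | false = subst (0ℤ ℤ.≤_) (ℤsolve 4 (λ d a A k →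
              (const 0ℤ ⊕′ (d ⊕′ (a ⊕′ (const 0ℤ ⊕′ (const 0ℤ ⊕′ (const 0ℤ ⊕′ k)))))) ⊕′ (A ⊖′ a)
              ⊜ const 0ℤ ⊕′ (d ⊕′ (A ⊕′ (const 0ℤ ⊕′ (const 0ℤ ⊕′ (const 0ℤ ⊕′ k)))))) refl (coeff D u) a₁′ A₁ (coeff (div r′) u)) (hy ⊞ ℤ-le⁻ le-u)
        go w (no _) (no _) (yes refl) hx hy with s v
        ... | true  = subst (0ℤ ℤ.≤_) (ℤsolve 4 (λ d a A k →
              (const 0ℤ ⊕′ (d ⊕′ (const 0ℤ ⊕′ (const 0ℤ ⊕′ (const 0ℤ ⊕′ (a ⊕′ k)))))) ⊕′ (A ⊖′ a)
              ⊜ const 0ℤ ⊕′ (d ⊕′ (const 0ℤ ⊕′ (const 0ℤ ⊕′ (const 0ℤ ⊕′ (A ⊕′ k)))))) refl (coeff D v) b₂ B₂ (coeff (div r) v)) (hx ⊞ ℤ-le⁻ le-v)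
        ... | false = subst (0ℤ ℤ.≤_) (ℤsolve 4 (λ d a A k →
              (const -1ℤ ⊕′ (d ⊕′ (const 0ℤ ⊕′ (const 0ℤ ⊕′ (const 0ℤ ⊕′ (a ⊕′ k)))))) ⊕′ (A ⊖′ (a ⊖′ const (⁺ 1)))
              ⊜ const 0ℤ ⊕′ (d ⊕′ (const 0ℤ ⊕′ (const 0ℤ ⊕′ (const 0ℤ ⊕′ (A ⊕′ k)))))) refl (coeff D v) b₂′ B₂ (coeff (div r′) v)) (hy ⊞ ℤ-le⁻ le-v)
        go w (no _) (no _) (no _) hx hy with s w
        ... | true  = hx
        ... | false = hy

      -- The value at p is lowered by δ; the ends at u and v tolerate this as long as
      -- the slope from p does not exceed the next integer on either side.
      lowered : ∀ δ β α A₂ B₁ → 0# ≤ δ →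
        fromℤ β * L₁ ≤ x u - x p → fromℤ β * L₁ ≤ y u - x p →
        fromℤ α * L₂ ≤ x v - x p → fromℤ α * L₂ ≤ y v - x p →
        δ ≤ L₁ - (join u - x p - fromℤ β * L₁) → δ ≤ L₂ - (join v - x p - fromℤ α * L₂) →
        fromℤ B₁ * L₁ ≤ join u - (x p - δ) → fromℤ A₂ * L₂ ≤ join v - (x p - δ) →
        0ℤ ℤ.≤ -1ℤ ℤ.+ (coeff D p ℤ.+ (B₁ ℤ.+ A₂)) →
        Feasible ((u , p , L₁) ∷ (p , v , L₂) ∷ N) ((p , -1ℤ) ∷ D)
      lowered δ β α A₂ B₁ δ≥0 βx βy αx αy δ₁ δ₂ hB hA tot =
        assemble (x p - δ) _ B₁ A₂ _ (at-u , at-u′) (at-v , at-v′) ℤₚ.≤-refl ℤₚ.≤-refl tot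
        where
        zp = x p - δ
        z : P → Carrier
        z w = if does (w ≟ₚ p) then zp else join w
        z-p : z p ≡ zp
        z-p = if-cong (dec-true (p ≟ₚ p) refl)
        z-≢ : ∀ {w} → w ≢ p → z w ≡ join w
        z-≢ {w} w≢p = if-cong (dec-false (w ≟ₚ p) w≢p)
        low-u : fromℤ (if s u then a₁ ℤ.- (⁺ 1) else a₁′) * L₁ ≤ zp - join u
        low-u with s u in eq
        ... | true  = lower-surplus {a₁} (proj₁ va₁) βx δ₁
        ... | false = lower-strict {a₁′} {β} L₁>0 (subst (λ o → fromℤ a₁′ * L₁ ≤ o - y u) (sym xp≡yp) (proj₁ vb₁))
                        (≤-<-trans βx (lt (lt⁻ (s-u eq)) (solve 3 (λ a b c → b :- a := (b :- c) :- (a :- c)) refl (x u) (y u) (x p)))) δ₁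
        low-v : fromℤ (if s v then b₂ else b₂′ ℤ.- (⁺ 1)) * L₂ ≤ zp - join v
        low-v with s v in eq
        ... | true  = lower-strict {b₂} {α} L₂>0 (proj₂ va₂)
                        (≤-<-trans αy (lt (lt⁻ (s-v eq)) (solve 3 (λ a b c → b :- a := (b :- c) :- (a :- c)) refl (y v) (x v) (x p)))) δ₂
        ... | false = lower-surplus {b₂′} (subst (λ o → fromℤ b₂′ * L₂ ≤ o - y v) (sym xp≡yp) (proj₂ vb₂)) αy δ₂
        at-u : fromℤ (if s u then a₁ ℤ.- (⁺ 1) else a₁′) * L₁ ≤ z p - z u
        at-u = subst₂ (λ i j → _ ≤ i - j) (sym z-p) (sym (z-≢ u≢p)) low-u
        at-u′ : fromℤ B₁ * L₁ ≤ z u - z p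
        at-u′ = subst₂ (λ i j → _ ≤ i - j) (sym (z-≢ u≢p)) (sym z-p) hB
        at-v : fromℤ A₂ * L₂ ≤ z v - z p
        at-v = subst₂ (λ i j → _ ≤ i - j) (sym (z-≢ v≢p)) (sym z-p) hA
        at-v′ : fromℤ (if s v then b₂ else b₂′ ℤ.- (⁺ 1)) * L₂ ≤ z p - z v
        at-v′ = subst₂ (λ i j → _ ≤ i - j) (sym z-p) (sym (z-≢ v≢p)) low-v

      -- With `αm`, the slopes of the maximum out of `p`: both functions pass through the same value
      -- there, so on either side the larger slope is available.
      βm = b₁ ℤ.⊔ b₁′
      αm = a₂ ℤ.⊔ a₂′

      ⊔-valid : ∀ i j {L X} → fromℤ i * L ≤ X → fromℤ j * L ≤ X → fromℤ (i ℤ.⊔ j) * L ≤ X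
      ⊔-valid i j hi hj with ℤₚ.≤-total i j
      ... | inj₁ q rewrite ℤₚ.i≤j⇒i⊔j≡j q = hj
      ... | inj₂ q rewrite ℤₚ.i≥j⇒i⊔j≡i q = hi

      sub-mono : ∀ {i j} c → i ≤ j → i - c ≤ j - c
      sub-mono {i} {j} c p = le (le⁻ p) (solve 3 (λ i j c → j :- i := (j :- c) :- (i :- c)) refl i j c)

      b₁x : fromℤ b₁ * L₁ ≤ x u - x p
      b₁x = proj₂ va₁
      b₁y : fromℤ b₁′ * L₁ ≤ y u - x p
      b₁y = subst (λ o → _ ≤ y u - o) (sym xp≡yp) (proj₂ vb₁)
      a₂x : fromℤ a₂ * L₂ ≤ x v - x p
      a₂x = proj₁ va₂
      a₂y : fromℤ a₂′ * L₂ ≤ y v - x p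
      a₂y = subst (λ o → _ ≤ y v - o) (sym xp≡yp) (proj₁ vb₂)

      βm-valid : fromℤ βm * L₁ ≤ join u - x p
      βm-valid = ⊔-valid b₁ b₁′ (≤-trans b₁x (sub-mono _ (x≤join u))) (≤-trans b₁y (sub-mono _ (y≤join u)))
      αm-valid : fromℤ αm * L₂ ≤ join v - x p
      αm-valid = ⊔-valid a₂ a₂′ (≤-trans a₂x (sub-mono _ (x≤join v))) (≤-trans a₂y (sub-mono _ (y≤join v)))

      bal-x : 0ℤ ℤ.≤ coeff D p ℤ.+ (b₁ ℤ.+ a₂)
      bal-x with eff-x p
      ... | h with u ≟ₚ p | p ≟ₚ p | v ≟ₚ p
      ...   | yes e | _ | _ = ⊥-elim (u≢p e)
      ...   | _ | no e | _ = ⊥-elim (e refl)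
      ...   | _ | _ | yes e = ⊥-elim (v≢p e)
      ...   | no _ | yes _ | no _ rewrite avoids-zero r r-links = subst (0ℤ ℤ.≤_)
        (ℤsolve 3 (λ d b a → const 0ℤ ⊕′ (d ⊕′ (const 0ℤ ⊕′ (b ⊕′ (a ⊕′ (const 0ℤ ⊕′ const 0ℤ))))) ⊜ d ⊕′ (b ⊕′ a)) refl (coeff D p) b₁ a₂) h

      bal-y : 0ℤ ℤ.≤ coeff D p ℤ.+ (b₁′ ℤ.+ a₂′)
      bal-y with eff-y p
      ... | h with u ≟ₚ p | p ≟ₚ p | v ≟ₚ p
      ...   | yes e | _ | _ = ⊥-elim (u≢p e)
      ...   | _ | no e | _ = ⊥-elim (e refl)
      ...   | _ | _ | yes e = ⊥-elim (v≢p e)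
      ...   | no _ | yes _ | no _ rewrite avoids-zero r′ r′-links = subst (0ℤ ℤ.≤_)
        (ℤsolve 3 (λ d b a → const 0ℤ ⊕′ (d ⊕′ (const 0ℤ ⊕′ (b ⊕′ (a ⊕′ (const 0ℤ ⊕′ const 0ℤ))))) ⊜ d ⊕′ (b ⊕′ a)) refl (coeff D p) b₁′ a₂′) h

      join-p : join p ≡ x p
      join-p with s p
      ... | true  = refl
      ... | false = sym xp≡yp

      unmoved : ∀ B₁ A₂ → fromℤ B₁ * L₁ ≤ join u - x p → fromℤ A₂ * L₂ ≤ join v - x p →
        0ℤ ℤ.≤ -1ℤ ℤ.+ (coeff D p ℤ.+ (B₁ ℤ.+ A₂)) →
        Feasible ((u , p , L₁) ∷ (p , v , L₂) ∷ N) ((p , -1ℤ) ∷ D)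
      unmoved B₁ A₂ hB hA tot = assemble (x p) _ B₁ A₂ _
        ( subst₂ (λ i j → fromℤ (if s u then a₁ else a₁′) * L₁ ≤ i - j) (sym z-p) (sym (z-≢ u≢p))
            (subst (λ o → fromℤ (if s u then a₁ else a₁′) * L₁ ≤ o - join u) join-p (pick-valid u p a₁ a₁′ L₁ (proj₁ va₁) (proj₁ vb₁)))
        , subst₂ (λ i j → _ ≤ i - j) (sym (z-≢ u≢p)) (sym z-p) hB )
        ( subst₂ (λ i j → _ ≤ i - j) (sym (z-≢ v≢p)) (sym z-p) hA
        , subst₂ (λ i j → fromℤ (if s v then b₂ else b₂′) * L₂ ≤ i - j) (sym z-p) (sym (z-≢ v≢p))
            (subst (λ o → fromℤ (if s v then b₂ else b₂′) * L₂ ≤ o - join v) join-p (pick-valid v p b₂ b₂′ L₂ (proj₂ va₂) (proj₂ vb₂))) )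
        below-u below-v tot
        where
        z : P → Carrier
        z w = if does (w ≟ₚ p) then x p else join w
        z-p : z p ≡ x p
        z-p = if-cong (dec-true (p ≟ₚ p) refl)
        z-≢ : ∀ {w} → w ≢ p → z w ≡ join w
        z-≢ {w} w≢p = if-cong (dec-false (w ≟ₚ p) w≢p)
        below-u : (if s u then a₁ ℤ.- (⁺ 1) else a₁′) ℤ.≤ (if s u then a₁ else a₁′)
        below-u with s u
        ... | true  = ℤₚ.i-j≤i a₁ (⁺ 1)
        ... | false = ℤₚ.≤-refl
        below-v : (if s v then b₂ else b₂′ ℤ.- (⁺ 1)) ℤ.≤ (if s v then b₂ else b₂′)
        below-v with s v
        ... | true  = ℤₚ.≤-refl
        ... | false = ℤₚ.i-j≤i b₂′ (⁺ 1)

      S : ℤ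
      S = coeff D p ℤ.+ (βm ℤ.+ αm)

      S≥0 : 0ℤ ℤ.≤ S
      S≥0 = ℤₚ.≤-trans bal-x (ℤₚ.+-monoʳ-≤ (coeff D p) (ℤₚ.+-mono-≤ (ℤₚ.i≤i⊔j b₁ b₁′) (ℤₚ.i≤i⊔j a₂ a₂′)))

      suc-valid : ∀ β L X → L ≤ X - fromℤ β * L → fromℤ (β ℤ.+ (⁺ 1)) * L ≤ X
      suc-valid β L X h = le (le⁻ h) (trans
        (solve 3 (λ b L X → (X :- b :* L) :- L := X :- (b :+ con (⁺ 1)) :* L) refl (fromℤ β) L X)
        (cong (λ z → X - z * L) (trans (cong (λ o → fromℤ β + o) fromℤ-1) (sym (fromℤ-suc β)))))

      move-by : ∀ β {δ L j} → δ ≡ L - (j - x p - fromℤ β * L) → fromℤ (β ℤ.+ (⁺ 1)) * L ≤ j - (x p - δ)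
      move-by β {δ} {L} {j} e = suc-valid β L _ (le (≤-refl {0#}) (trans
        (solve 5 (λ b L j xp d → con 0ℤ := ((j :- (xp :- (L :- ((j :- xp) :- b :* L)))) :- b :* L) :- L) refl (fromℤ β) L j (x p) δ)
        (cong (λ d → ((j - (x p - d)) - fromℤ β * L) - L) (sym e))))

      slack : ∀ {δ k j} → 0# ≤ δ → k ≤ j - x p → k ≤ j - (x p - δ)
      slack {δ} {k} {j} p q = le (le⁻ q +≤ p) (solve 4 (λ k j xp d → ((j :- xp) :- k) :+ d := (j :- (xp :- d)) :- k) refl k j (x _) δ)

      sum-β : S ≡ -1ℤ ℤ.+ (coeff D p ℤ.+ ((βm ℤ.+ (⁺ 1)) ℤ.+ αm))
      sum-β = ℤsolve 3 (λ d b a → d ⊕′ (b ⊕′ a) ⊜ const -1ℤ ⊕′ (d ⊕′ ((b ⊕′ const (⁺ 1)) ⊕′ a))) refl (coeff D p) βm αm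

      sum-α : S ≡ -1ℤ ℤ.+ (coeff D p ℤ.+ (βm ℤ.+ (αm ℤ.+ (⁺ 1))))
      sum-α = ℤsolve 3 (λ d b a → d ⊕′ (b ⊕′ a) ⊜ const -1ℤ ⊕′ (d ⊕′ (b ⊕′ (a ⊕′ const (⁺ 1))))) refl (coeff D p) βm αm

      -- `S` is the number of chips of the maximum at `p`. If it is positive, or if the rise towards
      -- a neighbour leaves room for a slope larger by one, the value at `p` stays. Otherwise it is
      -- lowered by the smaller of `δ₁` and `δ₂`, the amounts after which the slope to `u` or to `v`
      -- reaches the next integer and sends a chip to `p`.
      conclusion : Feasible ((u , p , L₁) ∷ (p , v , L₂) ∷ N) ((p , -1ℤ) ∷ D)
      conclusion with 0ℤ ℤₚ.≤? -1ℤ ℤ.+ S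
      ... | yes gain = unmoved βm αm βm-valid αm-valid gain
      ... | no ¬gain with <-or-≥ (join u - x p - fromℤ βm * L₁) L₁ | <-or-≥ (join v - x p - fromℤ αm * L₂) L₂
      ...   | inj₂ far | _ = unmoved (βm ℤ.+ (⁺ 1)) αm (suc-valid βm L₁ _ far) αm-valid (subst (0ℤ ℤ.≤_) sum-β S≥0)
      ...   | inj₁ _ | inj₂ far = unmoved βm (αm ℤ.+ (⁺ 1)) βm-valid (suc-valid αm L₂ _ far) (subst (0ℤ ℤ.≤_) sum-α S≥0)
      ...   | inj₁ near₁ | inj₁ near₂ = lower (≤-total δ₁ δ₂)
        where
        S≤0 : 0ℤ ℤ.≤ ℤ.- S
        S≤0 = subst (0ℤ ℤ.≤_) (ℤₚ.+-identityˡ (ℤ.- S)) (ℤ-le⁻ {S} {0ℤ} (ℤₚ.≮⇒≥ λ 0<S → ¬gain (ℤ-le (ℤ-le⁻ (ℤₚ.i<j⇒suc[i]≤j 0<S))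
          (ℤsolve 1 (λ s → s ⊖′ (const (⁺ 1) ⊕′ const 0ℤ) ⊜ (const -1ℤ ⊕′ s) ⊖′ const 0ℤ) refl S))))
        below : ∀ d b a b′ a′ → 0ℤ ℤ.≤ d ℤ.+ (b ℤ.+ a) → 0ℤ ℤ.≤ ℤ.- (d ℤ.+ (b′ ℤ.+ a′)) → a ℤ.≤ a′ → b′ ℤ.≤ b
        below d b a b′ a′ h h′ q = ℤ-le (h ⊞ h′ ⊞ ℤ-le⁻ q) (ℤsolve 5 (λ d b a b′ a′ →
          ((d ⊕′ (b ⊕′ a)) ⊕′ (⊝ (d ⊕′ (b′ ⊕′ a′)))) ⊕′ (a′ ⊖′ a) ⊜ b ⊖′ b′) refl d b a b′ a′)
        below′ : ∀ d b a b′ a′ → 0ℤ ℤ.≤ d ℤ.+ (b ℤ.+ a) → 0ℤ ℤ.≤ ℤ.- (d ℤ.+ (b′ ℤ.+ a′)) → b ℤ.≤ b′ → a′ ℤ.≤ a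
        below′ d b a b′ a′ h h′ q = ℤ-le (h ⊞ h′ ⊞ ℤ-le⁻ q) (ℤsolve 5 (λ d b a b′ a′ →
          ((d ⊕′ (b ⊕′ a)) ⊕′ (⊝ (d ⊕′ (b′ ⊕′ a′)))) ⊕′ (b′ ⊖′ b) ⊜ a ⊖′ a′) refl d b a b′ a′)
        weaken : ∀ {i j L X} → 0# < L → i ℤ.≤ j → fromℤ j * L ≤ X → fromℤ i * L ≤ X
        weaken L>0 q h = ≤-trans (*-monoˡ (<⇒≤ L>0) (fromℤ-mono q)) h
        -- The balances of `x` and of `y` at `p` are nonnegative while that of the maximum is at
        -- most zero. So neither has a slope at `p` below `βm` or `αm`, and the inequalities for
        -- these slopes hold for `x` and `y` separately.
        βx = weaken L₁>0 (below (coeff D p) b₁ a₂ βm αm bal-x S≤0 (ℤₚ.i≤i⊔j a₂ a₂′)) b₁x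
        βy = weaken L₁>0 (below (coeff D p) b₁′ a₂′ βm αm bal-y S≤0 (ℤₚ.i≤j⊔i a₂ a₂′)) b₁y
        αx = weaken L₂>0 (below′ (coeff D p) b₁ a₂ βm αm bal-x S≤0 (ℤₚ.i≤i⊔j b₁ b₁′)) a₂x
        αy = weaken L₂>0 (below′ (coeff D p) b₁′ a₂′ βm αm bal-y S≤0 (ℤₚ.i≤j⊔i b₁ b₁′)) a₂y
        δ₁ = L₁ - (join u - x p - fromℤ βm * L₁)
        δ₂ = L₂ - (join v - x p - fromℤ αm * L₂)
        lower : δ₁ ≤ δ₂ ⊎ δ₂ ≤ δ₁ → Feasible ((u , p , L₁) ∷ (p , v , L₂) ∷ N) ((p , -1ℤ) ∷ D)
        lower (inj₁ q) = lowered δ₁ βm αm αm (βm ℤ.+ (⁺ 1)) (<⇒≤ (lt⁻ near₁)) βx βy αx αy ≤-refl q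
          (move-by βm refl) (slack (<⇒≤ (lt⁻ near₁)) αm-valid) (subst (0ℤ ℤ.≤_) sum-β S≥0)
        lower (inj₂ q) = lowered δ₂ βm αm (αm ℤ.+ (⁺ 1)) βm (<⇒≤ (lt⁻ near₂)) βx βy αx αy q ≤-refl
          (slack (<⇒≤ (lt⁻ near₂)) βm-valid) (move-by αm refl) (subst (0ℤ ℤ.≤_) sum-α S≥0)

    -- Only differences of values matter, so a constant is added to `y` to make the two solutions
    -- agree at `p`.
    exchange : Feasible ((u , p , L₁) ∷ (p , v , L₂) ∷ N) ((u , -1ℤ) ∷ D) →
               Feasible ((u , p , L₁) ∷ (p , v , L₂) ∷ N) ((v , -1ℤ) ∷ D) →
               Feasible ((u , p , L₁) ∷ (p , v , L₂) ∷ N) ((p , -1ℤ) ∷ D)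
    exchange (feasible x ((_ , a₁ , b₁) ∷ (_ , a₂ , b₂) ∷ r) refl (va₁ ∷ va₂ ∷ va) eff)
             (feasible y ((_ , a₁′ , b₁′) ∷ (_ , a₂′ , b₂′) ∷ r′) eq vb eff′) with uncons _ _ eq
    ... | refl , eq′ with uncons _ _ eq′
    ...   | refl , eq″ with valid-shift y (x p - y p) _ vb
    ...     | vb₁ ∷ vb₂ ∷ vb′ = Joined.conclusion x (λ w → y w + (x p - y p))
      (solve 2 (λ a b → a := b :+ (a :- b)) refl (x p) (y p)) a₁ b₁ a₂ b₂ a₁′ b₁′ a₂′ b₂′ r r′ refl eq″
      va₁ va₂ va vb₁ vb₂ vb′
      (λ w → subst (0ℤ ℤ.≤_) (balance-≡ u -1ℤ a₁ b₁ a₂ b₂ r w) (eff w))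
      (λ w → subst (0ℤ ℤ.≤_) (balance-≡ v -1ℤ a₁′ b₁′ a₂′ b₂′ r′ w) (eff′ w))

-- Bounding the slopes by the positive part of the divisor.

module SlopeBound (R : RealField) {P : Set} (_≟ₚ_ : DecidableEquality P) where
  open Field R
  open FormalSums _≟ₚ_
  open Network R _≟ₚ_

  Positive : Link → Set
  Positive (_ , _ , L) = 0# < L

  slope-nonpos : ∀ {a L X} → 0# < L → fromℤ a * L ≤ X → X ≤ 0# → a ℤ.≤ 0ℤ
  slope-nonpos L>0 p q = slope-≤ {n = 0ℤ} L>0 (≤-trans p (≤-trans q (inj₂ (sym (zeroˡ _)))))

  -- Adding the two inequalities cancels the values. This is convexity along a link, expressed by
  -- its outgoing slopes.
  opposite-slopes : ∀ {a b L s t} → 0# < L → fromℤ a * L ≤ s - t → fromℤ b * L ≤ t - s → a ℤ.+ b ℤ.≤ 0ℤ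
  opposite-slopes {a} {b} {L} {s} {t} L>0 p q = slope-nonpos L>0 (le (le⁻ p +≤ le⁻ q)
    (trans (solve 5 (λ a b L s t → ((s :- t) :- a :* L) :+ ((t :- s) :- b :* L) := con 0ℤ :- (a :+ b) :* L) refl (fromℤ a) (fromℤ b) L s t)
      (cong (λ z → 0# - z * L) (sym (fromℤ-+ a b))))) ≤-refl

  sub-nonpos : ∀ {s t} → s ≤ t → s - t ≤ 0#
  sub-nonpos {s} {t} p = le (le⁻ p) (solve 2 (λ s t → t :- s := con 0ℤ :- (s :- t)) refl s t)

  neg≤0 : ∀ B → ℤ.- (⁺ B) ℤ.≤ 0ℤ
  neg≤0 ℕ.zero = ℤₚ.≤-refl
  neg≤0 (ℕ.suc _) = ℤ.-≤+

  module _ (x : P → Carrier) where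

    above : Carrier → P → Bool
    above θ w = not (does (x w <? θ))

    -- A link with one end in the superlevel set leaves it downhill, so the slope at that end is
    -- nonpositive; if both ends are in the set, convexity applies.
    end-contributions : ∀ θ u v L a b → 0# < L → Valid x ((u , v , L) , a , b) →
      (if above θ u then a else 0ℤ) ℤ.+ (if above θ v then b else 0ℤ) ℤ.≤ 0ℤ
    end-contributions θ u v L a b L>0 (p , q) with x u <? θ | x v <? θ
    ... | yes _  | yes _  = ℤₚ.≤-refl
    ... | yes u< | no v≥  = subst (ℤ._≤ 0ℤ) (sym (ℤₚ.+-identityˡ b)) (slope-nonpos L>0 q (sub-nonpos (≤-trans (<⇒≤ u<) (≮⇒≥ v≥))))
    ... | no u≥  | yes v< = subst (ℤ._≤ 0ℤ) (sym (ℤₚ.+-identityʳ a)) (slope-nonpos L>0 p (sub-nonpos (≤-trans (<⇒≤ v<) (≮⇒≥ u≥))))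
    ... | no _   | no _   = opposite-slopes {a} {b} L>0 p q

    div-nonpos : ∀ θ r → All (Positive ∘ proj₁) r → All (Valid x) r → wsum (above θ) (div r) ℤ.≤ 0ℤ
    div-nonpos θ [] _ _ = ℤₚ.≤-refl
    div-nonpos θ (((u , v , L) , a , b) ∷ r) (L>0 ∷ ps) (va ∷ vs) =
      subst (ℤ._≤ 0ℤ) (ℤₚ.+-assoc i j _) (ℤₚ.+-mono-≤ (end-contributions θ u v L a b L>0 va) (div-nonpos θ r ps vs))
      where i = if above θ u then a else 0ℤ
            j = if above θ v then b else 0ℤ

    -- The superlevel set at an upper end of a link loses the slope at that end.
    div-≤-target : ∀ {u v L a b} r → ((u , v , L) , a , b) ∈ r → x u < x v →
      All (Positive ∘ proj₁) r → All (Valid x) r → wsum (above (x v)) (div r) ℤ.≤ b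
    div-≤-target {u} {v} {a = a} {b} (_ ∷ r) (here refl) u<v (_ ∷ ps) (_ ∷ vs) with x u <? x v | x v <? x v
    ... | no u≮v | _ = ⊥-elim (u≮v u<v)
    ... | _ | yes v<v = ⊥-elim (<-irrefl refl v<v)
    ... | yes _ | no _ = subst₂ ℤ._≤_ (sym (ℤₚ.+-identityˡ _)) (ℤₚ.+-identityʳ b) (ℤₚ.+-monoʳ-≤ b (div-nonpos (x v) r ps vs))
    div-≤-target {v = v} {b = b} (((u′ , v′ , L′) , a′ , b′) ∷ r) (there i) u<v (L>0 ∷ ps) (va ∷ vs) =
      subst₂ ℤ._≤_ (ℤₚ.+-assoc s t _) (ℤₚ.+-identityˡ b)
        (ℤₚ.+-mono-≤ (end-contributions (x v) u′ v′ L′ a′ b′ L>0 va) (div-≤-target r i u<v ps vs))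
      where s = if above (x v) u′ then a′ else 0ℤ
            t = if above (x v) v′ then b′ else 0ℤ

    div-≤-source : ∀ {u v L a b} r → ((u , v , L) , a , b) ∈ r → x v < x u →
      All (Positive ∘ proj₁) r → All (Valid x) r → wsum (above (x u)) (div r) ℤ.≤ a
    div-≤-source {u} {v} {a = a} {b} (_ ∷ r) (here refl) v<u (_ ∷ ps) (_ ∷ vs) with x u <? x u | x v <? x u
    ... | yes u<u | _ = ⊥-elim (<-irrefl refl u<u)
    ... | _ | no v≮u = ⊥-elim (v≮u v<u)
    ... | no _ | yes _ = subst₂ ℤ._≤_ (cong (λ z → a ℤ.+ z) (sym (ℤₚ.+-identityˡ _))) (ℤₚ.+-identityʳ a) (ℤₚ.+-monoʳ-≤ a (div-nonpos (x u) r ps vs))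
    div-≤-source {u} {a = a} (((u′ , v′ , L′) , a′ , b′) ∷ r) (there i) v<u (L>0 ∷ ps) (va ∷ vs) =
      subst₂ ℤ._≤_ (ℤₚ.+-assoc s t _) (ℤₚ.+-identityˡ a)
        (ℤₚ.+-mono-≤ (end-contributions (x u) u′ v′ L′ a′ b′ L>0 va) (div-≤-source r i v<u ps vs))
      where s = if above (x u) u′ then a′ else 0ℤ
            t = if above (x u) v′ then b′ else 0ℤ

    Within : ℕ → ℤ → Set
    Within B a = ℤ.- (⁺ B) ℤ.≤ a × a ℤ.≤ ⁺ B

    BoundedSlopes : ℕ → Sloped → Set
    BoundedSlopes B (_ , a , b) = Within B a × Within B b

    -- The superlevel argument reaches only the upper end of a link. Lower ends and level links are
    -- treated in `flatten-slopes`.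
    Steep : ℕ → Sloped → Set
    Steep B ((u , v , _) , a , b) = (x u < x v → ℤ.- (⁺ B) ℤ.≤ b) × (x v < x u → ℤ.- (⁺ B) ℤ.≤ a)

    -- On the superlevel set through the upper end, `D` plus the divisor has nonnegative mass, `D`
    -- has mass at most `B`, and the divisor has mass at most the slope in question.
    steep : ∀ {B D} r → All (Positive ∘ proj₁) r → All (Valid x) r → Bounds B D → Effective (D ++ div r) → All (Steep B) r
    steep {B} {D} r ps vs bd eff = All.tabulate λ { {(u , v , L) , a , b} i →
        (λ u<v → bound _ b (div-≤-target r i u<v ps vs)) , (λ v<u → bound _ a (div-≤-source r i v<u ps vs)) }
      where
      bound : ∀ U c → wsum U (div r) ℤ.≤ c → ℤ.- (⁺ B) ℤ.≤ c
      bound U c h = ℤ-le (subst (0ℤ ℤ.≤_) (wsum-++ U D (div r)) (effective⇒wsum (D ++ div r) eff U) ⊞ ℤ-le⁻ (bd U) ⊞ ℤ-le⁻ h)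
        (ℤsolve 4 (λ d e B c → ((d ⊕′ e) ⊕′ (B ⊖′ d)) ⊕′ (c ⊖′ e) ⊜ c ⊖′ (⊝ B)) refl (wsum U D) (wsum U (div r)) (⁺ B) c)

    zero-valid : ∀ {L s t} → t ≤ s → fromℤ 0ℤ * L ≤ s - t
    zero-valid p = ≤-trans (inj₂ (zeroˡ _)) (le⁻ p)

    -- Raising a slope keeps the divisor effective, and zero is a valid slope at the lower end of a
    -- link and at both ends of a level one. The upper bound at the lower end follows from the lower
    -- bound at the other end, since the two slopes have nonpositive sum.
    flatten-slopes : ∀ {B} s → Positive (proj₁ s) → Valid x s → Steep B s →
      ∃ λ ((a′ , b′) : ℤ × ℤ) → proj₁ (proj₂ s) ℤ.≤ a′ × proj₂ (proj₂ s) ℤ.≤ b′ × Valid x (proj₁ s , a′ , b′) × BoundedSlopes B (proj₁ s , a′ , b′)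
    flatten-slopes {B} ((u , v , L) , a , b) L>0 (p , q) (sb , sa) with compare (x u) (x v)
    ... | tri≈ _ u≡v _ = (0ℤ , 0ℤ)
      , slope-nonpos L>0 p (sub-nonpos (inj₂ (sym u≡v))) , slope-nonpos L>0 q (sub-nonpos (inj₂ u≡v))
      , (zero-valid (inj₂ u≡v) , zero-valid (inj₂ (sym u≡v)))
      , (neg≤0 B , ℤ.+≤+ ℕ.z≤n) , (neg≤0 B , ℤ.+≤+ ℕ.z≤n)
    ... | tri< u<v _ _ = (a ℤ.⊔ 0ℤ , b) , ℤₚ.i≤i⊔j a 0ℤ , ℤₚ.≤-refl
      , (⊔-valid , q)
      , (ℤₚ.≤-trans (neg≤0 B) (ℤₚ.i≤j⊔i a 0ℤ)
        , ℤₚ.⊔-lub (ℤ-le (ℤ-le⁻ (opposite-slopes {a} {b} L>0 p q) ⊞ ℤ-le⁻ (sb u<v))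
             (ℤsolve 3 (λ a b B → (const 0ℤ ⊖′ (a ⊕′ b)) ⊕′ (b ⊖′ (⊝ B)) ⊜ B ⊖′ a) refl a b (⁺ B))) (ℤ.+≤+ ℕ.z≤n))
      , (sb u<v , ℤₚ.≤-trans (slope-nonpos L>0 q (sub-nonpos (<⇒≤ u<v))) (ℤ.+≤+ ℕ.z≤n))
      where
      ⊔-valid : fromℤ (a ℤ.⊔ 0ℤ) * L ≤ x v - x u
      ⊔-valid with ℤₚ.≤-total a 0ℤ
      ... | inj₁ h rewrite ℤₚ.i≤j⇒i⊔j≡j h = zero-valid (<⇒≤ u<v)
      ... | inj₂ h rewrite ℤₚ.i≥j⇒i⊔j≡i h = p
    ... | tri> _ _ v<u = (a , b ℤ.⊔ 0ℤ) , ℤₚ.≤-refl , ℤₚ.i≤i⊔j b 0ℤ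
      , (p , ⊔-valid)
      , (sa v<u , ℤₚ.≤-trans (slope-nonpos L>0 p (sub-nonpos (<⇒≤ v<u))) (ℤ.+≤+ ℕ.z≤n))
      , (ℤₚ.≤-trans (neg≤0 B) (ℤₚ.i≤j⊔i b 0ℤ)
        , ℤₚ.⊔-lub (ℤ-le (ℤ-le⁻ (opposite-slopes {a} {b} L>0 p q) ⊞ ℤ-le⁻ (sa v<u))
             (ℤsolve 3 (λ a b B → (const 0ℤ ⊖′ (a ⊕′ b)) ⊕′ (a ⊖′ (⊝ B)) ⊜ B ⊖′ b) refl a b (⁺ B))) (ℤ.+≤+ ℕ.z≤n))
      where
      ⊔-valid : fromℤ (b ℤ.⊔ 0ℤ) * L ≤ x u - x v
      ⊔-valid with ℤₚ.≤-total b 0ℤ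
      ... | inj₁ h rewrite ℤₚ.i≤j⇒i⊔j≡j h = zero-valid (<⇒≤ v<u)
      ... | inj₂ h rewrite ℤₚ.i≥j⇒i⊔j≡i h = q

    if-mono : ∀ (b : Bool) {i j} → i ℤ.≤ j → (if b then i else 0ℤ) ℤ.≤ (if b then j else 0ℤ)
    if-mono true  p = p
    if-mono false _ = ℤₚ.≤-refl

    flatten : ∀ {B} r → All (Positive ∘ proj₁) r → All (Valid x) r → All (Steep B) r →
      ∃ λ r′ → map proj₁ r′ ≡ map proj₁ r × All (Valid x) r′ × All (BoundedSlopes B) r′ × (∀ w → coeff (div r) w ℤ.≤ coeff (div r′) w)
    flatten [] _ _ _ = [] , refl , [] , [] , λ _ → ℤₚ.≤-refl
    flatten (s@((u , v , L) , a , b) ∷ r) (p ∷ ps) (va ∷ vs) (st ∷ sts) with flatten-slopes s p va st | flatten r ps vs sts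
    ... | (a′ , b′) , a≤ , b≤ , va′ , bd | r′ , l , vs′ , bds , mono = ((u , v , L) , a′ , b′) ∷ r′
      , cong (λ N → (u , v , L) ∷ N) l , va′ ∷ vs′ , bd ∷ bds
      , λ w → ℤₚ.+-mono-≤ (if-mono (does (u ≟ₚ w)) a≤) (ℤₚ.+-mono-≤ (if-mono (does (v ≟ₚ w)) b≤) (mono w))

  -- This makes the search over slopes finite without losing a solution: the values stay the same
  -- and only slopes are raised.
  feasible-bounded : ∀ {B N D} → All Positive N → Bounds B D → Feasible N D →
    ∃ λ (f : Feasible N D) → All (BoundedSlopes (Feasible.potential f) B) (Feasible.slopes f)
  feasible-bounded {D = D} Npos bd (feasible x r refl va eff) with flatten x r (Allₚ.map⁻ Npos) va (steep x {D = D} r (Allₚ.map⁻ Npos) va bd eff)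
  ... | r′ , l , va′ , bds , mono = feasible x r′ l va′ (λ w → subst (0ℤ ℤ.≤_) (sym (wsum-++ _ D (div r′)))
        (ℤₚ.≤-trans (subst (0ℤ ℤ.≤_) (wsum-++ _ D (div r)) (eff w)) (ℤₚ.+-monoʳ-≤ (coeff D w) (mono w)))) , bds

-- Booleans and finite sums of integers.

∧-true : ∀ {a b} → a ∧ b ≡ true → a ≡ true × b ≡ true
∧-true {true} e = refl , e

does-true : ∀ {A : Set} (d : Dec A) → does d ≡ true → A
does-true (yes a) _ = a

sumMap : ∀ {A : Set} → (A → ℤ) → List A → ℤ
sumMap f xs = foldr ℤ._+_ 0ℤ (map f xs)

module _ {A : Set} where

  sumMap-++ : ∀ (f : A → ℤ) xs ys → sumMap f (xs ++ ys) ≡ sumMap f xs ℤ.+ sumMap f ys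
  sumMap-++ f [] ys = sym (ℤₚ.+-identityˡ _)
  sumMap-++ f (x ∷ xs) ys = trans (cong (λ z → f x ℤ.+ z) (sumMap-++ f xs ys)) (sym (ℤₚ.+-assoc (f x) _ _))

  sumMap-+ : ∀ (f g : A → ℤ) xs → sumMap (λ x → f x ℤ.+ g x) xs ≡ sumMap f xs ℤ.+ sumMap g xs
  sumMap-+ f g [] = refl
  sumMap-+ f g (x ∷ xs) = trans (cong (λ z → (f x ℤ.+ g x) ℤ.+ z) (sumMap-+ f g xs))
    (ℤsolve 4 (λ a b c d → (a ⊕′ b) ⊕′ (c ⊕′ d) ⊜ (a ⊕′ c) ⊕′ (b ⊕′ d)) refl (f x) (g x) (sumMap f xs) (sumMap g xs))

  sumMap-zero : ∀ (f : A → ℤ) xs → (∀ {x} → x ∈ xs → f x ≡ 0ℤ) → sumMap f xs ≡ 0ℤ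
  sumMap-zero f [] h = refl
  sumMap-zero f (x ∷ xs) h rewrite h (here refl) = trans (ℤₚ.+-identityˡ _) (sumMap-zero f xs (h ∘ there))

  sumMap-nonneg : ∀ (f : A → ℤ) xs → (∀ x → 0ℤ ℤ.≤ f x) → 0ℤ ℤ.≤ sumMap f xs
  sumMap-nonneg f [] h = ℤₚ.≤-refl
  sumMap-nonneg f (x ∷ xs) h = h x ⊞ sumMap-nonneg f xs h

  sumMap-member : ∀ (f : A → ℤ) xs {x} → (∀ x → 0ℤ ℤ.≤ f x) → x ∈ xs → f x ℤ.≤ sumMap f xs
  sumMap-member f (x ∷ xs) h (here refl) = subst (ℤ._≤ (f x ℤ.+ sumMap f xs)) (ℤₚ.+-identityʳ (f x)) (ℤₚ.+-monoʳ-≤ (f x) (sumMap-nonneg f xs h))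
  sumMap-member f (x ∷ xs) h (there i) = subst (ℤ._≤ (f x ℤ.+ sumMap f xs)) (ℤₚ.+-identityˡ _) (ℤₚ.+-mono-≤ (h x) (sumMap-member f xs h i))

  sumMap-concat : ∀ (f : A → ℤ) n (S : Fin n → List A) →
    sumMap f (concat (tabulate S)) ≡ foldr ℤ._+_ 0ℤ (tabulate (λ i → sumMap f (S i)))
  sumMap-concat f zero S = refl
  sumMap-concat f (suc n) S = trans (sumMap-++ f (S Fin.zero) _) (cong (λ z → sumMap f (S Fin.zero) ℤ.+ z) (sumMap-concat f n (S ∘ Fin.suc)))

sum-tabulate-cong : ∀ n {f g : Fin n → ℤ} → (∀ i → f i ≡ g i) → foldr ℤ._+_ 0ℤ (tabulate f) ≡ foldr ℤ._+_ 0ℤ (tabulate g)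
sum-tabulate-cong n h = cong (foldr ℤ._+_ 0ℤ) (Listₚ.tabulate-cong h)

sum-tabulate-zero : ∀ n {f : Fin n → ℤ} → (∀ i → f i ≡ 0ℤ) → foldr ℤ._+_ 0ℤ (tabulate f) ≡ 0ℤ
sum-tabulate-zero zero h = refl
sum-tabulate-zero (suc n) h = cong₂ ℤ._+_ (h Fin.zero) (sum-tabulate-zero n (h ∘ Fin.suc))

sum-tabulate-single : ∀ n (f : Fin n → ℤ) i → (∀ j → j ≢ i → f j ≡ 0ℤ) → foldr ℤ._+_ 0ℤ (tabulate f) ≡ f i
sum-tabulate-single (suc n) f Fin.zero h =
  trans (cong (λ z → f Fin.zero ℤ.+ z) (sum-tabulate-zero n (λ j → h (Fin.suc j) λ ()))) (ℤₚ.+-identityʳ _)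
sum-tabulate-single (suc n) f (Fin.suc i) h =
  trans (cong₂ ℤ._+_ (h Fin.zero λ ()) (sum-tabulate-single n (f ∘ Fin.suc) i (λ j j≢i → h (Fin.suc j) λ { refl → j≢i refl }))) (ℤₚ.+-identityˡ _)

-- Subdivisions of the metric graph and orders at points.

module Subdivision {R : RealField} (G : MetricGraph R) where
  open Field R public
  open MetricGraph G public
  open Geometry G public hiding (coeff; Effective) renaming (onEdge to location)
  open FormalSums _≟P_ public
  open Network R _≟P_ public

  at-0 : ∀ e → at e 0# ≡ vertex (source e)
  at-0 e with 0# <? 0#
  ... | yes p = ⊥-elim (<-irrefl refl p)
  ... | no _  = refl

  at-length : ∀ e → at e (length e) ≡ vertex (target e)
  at-length e with 0# <? length e | length e <? length e
  ... | no p | _     = ⊥-elim (p (length>0 e))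
  ... | yes _ | yes p = ⊥-elim (<-irrefl refl p)
  ... | yes _ | no _  = refl

  at-interior : ∀ e {t} (p : 0# < t) (q : t < length e) → at e t ≡ interior e t p q
  at-interior e {t} p q with 0# <? t | t <? length e
  ... | no n  | _     = ⊥-elim (n p)
  ... | yes _ | no n  = ⊥-elim (n q)
  ... | yes _ | yes _ = refl

  at≡interior : ∀ e a {e′ t} .{p : 0# < t} .{q : t < length e′} → at e a ≡ interior e′ t p q → e ≡ e′ × a ≡ t
  at≡interior e a eq with 0# <? a | a <? length e
  at≡interior e a () | no _ | _
  at≡interior e a () | yes _ | no _
  at≡interior e a refl | yes _ | yes _ = refl , refl

  Segment : Set
  Segment = Edge × Carrier × Carrier

  toLink : Segment → Link
  toLink (e , a , b) = at e a , at e b , b - a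

  covers : Segment → Point → Bool
  covers _ (vertex _) = false
  covers (e , a , b) (interior e′ t _ _) = does (e ≟F e′) ∧ (does (a <? t) ∧ does (t <? b))

  covers-true : ∀ {e a b e′ t} .{p : 0# < t} .{q : t < length e′} → covers (e , a , b) (interior e′ t p q) ≡ true → e ≡ e′ × a < t × t < b
  covers-true {e} {a} {b} {e′} {t} h with ∧-true {does (e ≟F e′)} h
  ... | h₁ , h₂ with ∧-true {does (a <? t)} h₂
  ...   | h₃ , h₄ = does-true (e ≟F e′) h₁ , does-true (a <? t) h₃ , does-true (t <? b) h₄

  covers-intro : ∀ {e a b t} .{p : 0# < t} .{q : t < length e} → a < t → t < b → covers (e , a , b) (interior e t p q) ≡ true
  covers-intro {e} {a} {b} {t} h h′ rewrite dec-true (e ≟F e) refl | dec-true (a <? t) h | dec-true (t <? b) h′ = refl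

  Proper : Segment → Set
  Proper (e , a , b) = 0# ≤ a × a < b × b ≤ length e

  -- The one-sided slopes are arbitrary integers. Besides those of a rational function, constant
  -- ones are used, which turn sums of slopes into counts of the segments that start or finish at a
  -- point.
  module Slopes (φ⁺ φ⁻ : Edge → Carrier → ℤ) where

    jump : Point → ℤ
    jump (vertex _) = 0ℤ
    jump (interior e t _ _) = φ⁺ e t ℤ.+ ℤ.- φ⁻ e t

    ends : Point → Segment → ℤ
    ends v (e , a , b) = at? (at e a ≟P v) (φ⁺ e a) ℤ.+ at? (at e b ≟P v) (ℤ.- φ⁻ e b)

    cover : Point → Segment → ℤ
    cover v s = if covers s v then jump v else 0ℤ

    -- Additive under cutting a segment in two, hence constant under subdivision.
    weight : Point → Segment → ℤ
    weight v s = ends v s ℤ.+ cover v s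

    end-no : ∀ e s v {x} → at e s ≢ v → at? (at e s ≟P v) x ≡ 0ℤ
    end-no e s v ≢v = if-cong (dec-false (at e s ≟P v) ≢v)

    end-yes : ∀ e s v {x} → at e s ≡ v → at? (at e s ≟P v) x ≡ x
    end-yes e s v ≡v = if-cong (dec-true (at e s ≟P v) ≡v)

    private
      shape : ∀ v e a b {x y z} → at? (at e a ≟P v) (φ⁺ e a) ≡ x → at? (at e b ≟P v) (ℤ.- φ⁻ e b) ≡ y →
              cover v (e , a , b) ≡ z → weight v (e , a , b) ≡ (x ℤ.+ y) ℤ.+ z
      shape v e a b refl refl refl = refl

    private
      weight-split-off : ∀ e′ t .(p : 0# < t) .(q : t < length e′) e {a c b} → e ≢ e′ → let v = interior e′ t p q in
        0# ≤ a → a < c → c < b → b ≤ length e →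
        weight v (e , a , b) ≡ weight v (e , a , c) ℤ.+ weight v (e , c , b)
      weight-split-off e′ t p q e {a} {c} {b} e≢e′ 0≤a a<c c<b b≤L = trans (shape v e a b (off a) (off b) refl-cov)
          (sym (cong₂ ℤ._+_ (shape v e a c (off a) (off c) refl-cov) (shape v e c b (off c) (off b) refl-cov)))
        where
        v = interior e′ t p q
        off : ∀ s {x} → at? (at e s ≟P v) x ≡ 0ℤ
        off s = end-no e s v λ eq → e≢e′ (proj₁ (at≡interior e s eq))
        refl-cov : ∀ {s s′} → cover v (e , s , s′) ≡ 0ℤ
        refl-cov rewrite dec-false (e ≟F e′) e≢e′ = refl

      weight-split-on : ∀ e t .(p : 0# < t) .(q : t < length e) {a c b} → Tri (t < c) (t ≡ c) (c < t) → let v = interior e t p q in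
        0# ≤ a → a < c → c < b → b ≤ length e →
        weight v (e , a , b) ≡ weight v (e , a , c) ℤ.+ weight v (e , c , b)
      weight-split-on e t p q {a} {c} {b} (tri< t<c _ _) 0≤a a<c c<b b≤L = trans (shape v e a b refl (off (<-trans t<c c<b)) refl)
          (trans (cong (λ z → (at? (at e a ≟P v) (φ⁺ e a) ℤ.+ 0ℤ) ℤ.+ z) same)
            (trans (ℤsolve 2 (λ x y → (x ⊕′ const 0ℤ) ⊕′ y ⊜ ((x ⊕′ const 0ℤ) ⊕′ y) ⊕′ ((const 0ℤ ⊕′ const 0ℤ) ⊕′ const 0ℤ)) refl
                (at? (at e a ≟P v) (φ⁺ e a)) (cover v (e , a , c)))
              (sym (cong₂ ℤ._+_ (shape v e a c refl (off t<c) refl) (shape v e c b (off t<c) (off (<-trans t<c c<b)) none)))))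
        where
        v = interior e t p q
        off : ∀ {s x} → t < s → at? (at e s ≟P v) x ≡ 0ℤ
        off {s} t<s = end-no e s v λ eq → <⇒≢ t<s (sym (proj₂ (at≡interior e s eq)))
        same : cover v (e , a , b) ≡ cover v (e , a , c)
        same rewrite dec-true (t <? b) (<-trans t<c c<b) | dec-true (t <? c) t<c = refl
        none : cover v (e , c , b) ≡ 0ℤ
        none rewrite dec-true (e ≟F e) refl | dec-false (c <? t) (<-asym t<c) = refl
      -- The cut is made at the point itself: the jump of the covering segment becomes the sum of
      -- the slopes at the two new ends.
      weight-split-on e t p q {a} {c} {b} (tri≈ _ refl _) 0≤a a<c c<b b≤L = trans (shape v e a b (off λ eq → <⇒≢ a<c eq) (off λ eq → <⇒≢ c<b (sym eq)) full)
          (trans (ℤsolve 2 (λ x y → (const 0ℤ ⊕′ const 0ℤ) ⊕′ (x ⊕′ y) ⊜ ((const 0ℤ ⊕′ y) ⊕′ const 0ℤ) ⊕′ ((x ⊕′ const 0ℤ) ⊕′ const 0ℤ)) refl (φ⁺ e t) (ℤ.- φ⁻ e t))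
            (sym (cong₂ ℤ._+_ (shape v e a c (off λ eq → <⇒≢ a<c eq) on none₁) (shape v e c b on (off λ eq → <⇒≢ c<b (sym eq)) none₂))))
        where
        v = interior e t p q
        off : ∀ {s x} → s ≢ t → at? (at e s ≟P v) x ≡ 0ℤ
        off {s} s≢t = end-no e s v λ eq → s≢t (proj₂ (at≡interior e s eq))
        on : ∀ {x} → at? (at e t ≟P v) x ≡ x
        on = end-yes e t v (at-interior e (≤-<-trans 0≤a a<c) (<-≤-trans c<b b≤L))
        full : cover v (e , a , b) ≡ jump v
        full rewrite dec-true (e ≟F e) refl | dec-true (a <? t) a<c | dec-true (t <? b) c<b = refl
        none₁ : cover v (e , a , t) ≡ 0ℤ
        none₁ rewrite dec-true (e ≟F e) refl | dec-true (a <? t) a<c | dec-false (t <? t) (<-irrefl refl) = refl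
        none₂ : cover v (e , t , b) ≡ 0ℤ
        none₂ rewrite dec-true (e ≟F e) refl | dec-false (t <? t) (<-irrefl refl) = refl
      weight-split-on e t p q {a} {c} {b} (tri> _ _ c<t) 0≤a a<c c<b b≤L = trans (shape v e a b (off (<-trans a<c c<t)) refl refl)
          (trans (cong (λ z → (0ℤ ℤ.+ at? (at e b ≟P v) (ℤ.- φ⁻ e b)) ℤ.+ z) same)
            (trans (ℤsolve 2 (λ x y → (const 0ℤ ⊕′ x) ⊕′ y ⊜ ((const 0ℤ ⊕′ const 0ℤ) ⊕′ const 0ℤ) ⊕′ ((const 0ℤ ⊕′ x) ⊕′ y)) refl
                (at? (at e b ≟P v) (ℤ.- φ⁻ e b)) (cover v (e , c , b)))
              (sym (cong₂ ℤ._+_ (shape v e a c (off (<-trans a<c c<t)) (off c<t) none) (shape v e c b (off c<t) refl refl)))))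
        where
        v = interior e t p q
        off : ∀ {s x} → s < t → at? (at e s ≟P v) x ≡ 0ℤ
        off {s} s<t = end-no e s v λ eq → <⇒≢ s<t (proj₂ (at≡interior e s eq))
        same : cover v (e , a , b) ≡ cover v (e , c , b)
        same rewrite dec-true (a <? t) (<-trans a<c c<t) | dec-true (c <? t) c<t = refl
        none : cover v (e , a , c) ≡ 0ℤ
        none rewrite dec-true (e ≟F e) refl | dec-true (a <? t) (<-trans a<c c<t) | dec-false (t <? c) (<-asym c<t) = refl

    weight-split : ∀ v e {a c b} → 0# ≤ a → a < c → c < b → b ≤ length e →
      weight v (e , a , b) ≡ weight v (e , a , c) ℤ.+ weight v (e , c , b)
    weight-split (vertex w) e {a} {c} {b} 0≤a a<c c<b b≤L = trans
      (ℤsolve 2 (λ x y → (x ⊕′ y) ⊕′ const 0ℤ ⊜ ((x ⊕′ const 0ℤ) ⊕′ const 0ℤ) ⊕′ ((const 0ℤ ⊕′ y) ⊕′ const 0ℤ)) refl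
        (at? (at e a ≟P vertex w) (φ⁺ e a)) (at? (at e b ≟P vertex w) (ℤ.- φ⁻ e b)))
      (sym (cong₂ ℤ._+_ (shape (vertex w) e a c refl (end-no e c (vertex w) c≢) refl) (shape (vertex w) e c b (end-no e c (vertex w) c≢) refl refl)))
      where
      c≢ : at e c ≢ vertex w
      c≢ eq with trans (sym eq) (at-interior e (≤-<-trans 0≤a a<c) (<-≤-trans c<b b≤L))
      ... | ()
    weight-split v@(interior e′ t p q) e {a} {c} {b} 0≤a a<c c<b b≤L = go (e ≟F e′)
      where
      go : Dec (e ≡ e′) → _
      go (no e≢e′) = weight-split-off e′ t p q e e≢e′ 0≤a a<c c<b b≤L
      go (yes e≡e′) = transport e≡e′ p q
        where
        transport : ∀ {e′} → e ≡ e′ → .(p : 0# < t) .(q : t < length e′) → let v = interior e′ t p q in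
          weight v (e , a , b) ≡ weight v (e , a , c) ℤ.+ weight v (e , c , b)
        transport refl p q = weight-split-on e t p q (compare t c) 0≤a a<c c<b b≤L

  data Chain (e : Edge) : Carrier → Carrier → List Segment → Set where
    [_] : ∀ {a b} → a < b → Chain e a b ((e , a , b) ∷ [])
    _∷_ : ∀ {a c b ss} → a < c → Chain e c b ss → Chain e a b ((e , a , c) ∷ ss)

  chain-< : ∀ {e a b ss} → Chain e a b ss → a < b
  chain-< [ p ] = p
  chain-< (p ∷ c) = <-trans p (chain-< c)

  chain-proper : ∀ {e a b ss} → Chain e a b ss → 0# ≤ a → b ≤ length e → All Proper ss
  chain-proper [ p ] ha hb = (ha , p , hb) ∷ []
  chain-proper (p ∷ c) ha hb = (ha , p , ≤-trans (<⇒≤ (chain-< c)) hb) ∷ chain-proper c (≤-trans ha (<⇒≤ p)) hb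

  record Model : Set where
    field
      segments : Edge → List Segment
      chain    : ∀ e → Chain e 0# (length e) (segments e)

    flat : List Segment
    flat = concat (tabulate segments)

    net : List Link
    net = map toLink flat

    proper : All Proper flat
    proper = Allₚ.concat⁺ (Allₚ.tabulate⁺ λ e → chain-proper (chain e) ≤-refl ≤-refl)

  open Model public

  module _ (φ⁺ φ⁻ : Edge → Carrier → ℤ) where
    open Slopes φ⁺ φ⁻

    -- The formula of `ord`, with arbitrary one-sided slopes in place of those of a function.
    total : Point → ℤ
    total (vertex v) = sumℤ (tabulate λ e →
      (if does (source e ≟F v) then φ⁺ e 0# else 0ℤ) ℤ.+ (if does (target e ≟F v) then ℤ.- φ⁻ e (length e) else 0ℤ))
    total (interior e t _ _) = φ⁺ e t ℤ.+ ℤ.- φ⁻ e t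

    weight-chain : ∀ v {e a b ss} → Chain e a b ss → 0# ≤ a → b ≤ length e → sumMap (weight v) ss ≡ weight v (e , a , b)
    weight-chain v [ p ] ha hb = ℤₚ.+-identityʳ _
    weight-chain v (p ∷ c) ha hb = trans (cong (λ z → weight v _ ℤ.+ z) (weight-chain v c (≤-trans ha (<⇒≤ p)) hb))
      (sym (weight-split v _ ha p (chain-< c) hb))

    does-vertex : ∀ u w → does (vertex u ≟P vertex w) ≡ does (u ≟F w)
    does-vertex u w with u ≟F w
    ... | yes refl = refl
    ... | no _     = refl

    -- By additivity the segments of an edge may be merged into the whole edge, so the sum is the
    -- same for all models.
    weight-total : ∀ M v → sumMap (weight v) (flat M) ≡ total v
    weight-total M v = trans (sumMap-concat (weight v) _ (segments M))
      (trans (sum-tabulate-cong _ (λ e → weight-chain v (chain M e) ≤-refl ≤-refl)) (edges v))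
      where
      edges : ∀ v → sumℤ (tabulate (λ e → weight v (e , 0# , length e))) ≡ total v
      edges (vertex w) = sum-tabulate-cong _ λ e → trans (ℤₚ.+-identityʳ _)
        (cong₂ ℤ._+_ (if-cong (trans (cong (λ q → does (q ≟P vertex w)) (at-0 e)) (does-vertex (source e) w)))
                     (if-cong (trans (cong (λ q → does (q ≟P vertex w)) (at-length e)) (does-vertex (target e) w))))
      edges v@(interior e t p q) = trans (sum-tabulate-single _ _ e other)
        (trans (cong₂ ℤ._+_ (cong₂ ℤ._+_ (ends-off e (inj₁ refl)) (ends-off e (inj₂ refl))) full) (ℤₚ.+-identityˡ _))
        where
        p′ : 0# < t
        p′ = recompute (0# <? t) p
        q′ : t < length e
        q′ = recompute (t <? length e) q
        ends-off : ∀ e′ {s x} → s ≡ 0# ⊎ s ≡ length e′ → at? (at e′ s ≟P v) x ≡ 0ℤ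
        ends-off e′ (inj₁ refl) = end-no e′ 0# v λ eq → <⇒≢ p′ (proj₂ (at≡interior e′ 0# eq))
        ends-off e′ (inj₂ refl) = end-no e′ (length e′) v λ eq → absurd (trans (sym (at-length e′)) eq)
          where absurd : ∀ {w} → vertex w ≡ v → ⊥
                absurd ()
        full : cover v (e , 0# , length e) ≡ jump v
        full rewrite dec-true (e ≟F e) refl | dec-true (0# <? t) p′ | dec-true (t <? length e) q′ = refl
        other : ∀ e′ → e′ ≢ e → weight v (e′ , 0# , length e′) ≡ 0ℤ
        other e′ e′≢e rewrite dec-false (e′ ≟F e) e′≢e = cong₂ (λ x y → (x ℤ.+ y) ℤ.+ 0ℤ) (ends-off e′ (inj₁ refl)) (ends-off e′ (inj₂ refl))

-- Points on a model, cutting at a point, and looplessness.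

module Refinement {R : RealField} (G : MetricGraph R) where
  open Subdivision G public
  open Exchange R _≟P_ public

  module _ (φ⁺ φ⁻ : Edge → Carrier → ℤ) where
    open Slopes φ⁺ φ⁻

    sloped : Segment → Sloped
    sloped s@(e , a , b) = toLink s , φ⁺ e a , ℤ.- φ⁻ e b

    coeff-sloped : ∀ v ss → coeff (div (map sloped ss)) v ≡ sumMap (ends v) ss
    coeff-sloped v [] = refl
    coeff-sloped v (s@(e , a , b) ∷ ss) = trans (sym (ℤₚ.+-assoc (at? (at e a ≟P v) (φ⁺ e a)) _ _))
      (cong (λ z → ends v s ℤ.+ z) (coeff-sloped v ss))

    -- The counting identity behind the incidence lemmas: the order at a point is seen through the
    -- segment ends at it or through a segment that covers it.
    ends+covers : ∀ M v → sumMap (ends v) (flat M) ℤ.+ sumMap (cover v) (flat M) ≡ total φ⁺ φ⁻ v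
    ends+covers M v = trans (sym (sumMap-+ (ends v) (cover v) (flat M))) (weight-total φ⁺ φ⁻ M v)

    module _ {M : Model} {v : Point} (ends≥0 : ∀ s → 0ℤ ℤ.≤ ends v s) (jump≡1 : jump v ≡ ⁺ 1) (total≡1 : total φ⁺ φ⁻ v ≡ ⁺ 1) where

      cover≥0 : ∀ s → 0ℤ ℤ.≤ cover v s
      cover≥0 s with covers s v
      ... | true  = subst (0ℤ ℤ.≤_) (sym jump≡1) (ℤ.+≤+ ℕ.z≤n)
      ... | false = ℤₚ.≤-refl

      cover-true : ∀ {s} → covers s v ≡ true → cover v s ≡ ⁺ 1
      cover-true h = trans (if-cong h) jump≡1

      -- Ends count nonnegatively and the total is 1, so a covering segment, with its jump of 1,
      -- uses up the total. The next lemma applies the same count to a second covering segment.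
      no-end : ∀ {s s′} → s ∈ flat M → covers s v ≡ true → s′ ∈ flat M → (⁺ 1) ℤ.≤ ends v s′ → ⊥
      no-end {s} i c j h = 2≰1 (subst ((⁺ 2) ℤ.≤_) (trans (ends+covers M v) total≡1) (ℤₚ.+-mono-≤
          (ℤₚ.≤-trans h (sumMap-member (ends v) (flat M) ends≥0 j))
          (subst (ℤ._≤ sumMap (cover v) (flat M)) (cover-true {s} c) (sumMap-member (cover v) (flat M) cover≥0 i))))
        where 2≰1 : (⁺ 2) ℤ.≤ ⁺ 1 → ⊥
              2≰1 (ℤ.+≤+ (ℕ.s≤s ()))

      no-other-cover : ∀ {N₁ s N₂} → flat M ≡ N₁ ++ s ∷ N₂ → covers s v ≡ true → ∀ {s′} → s′ ∈ N₁ ++ N₂ → covers s′ v ≡ true → ⊥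
      no-other-cover {N₁} {s} {N₂} eq c {s′} i c′ = 2≰1 (ℤₚ.≤-trans
          (ℤₚ.+-mono-≤ (ℤₚ.≤-reflexive (sym (cover-true {s} c))) (ℤₚ.≤-trans (ℤₚ.≤-reflexive (sym (cover-true {s′} c′))) (sumMap-member (cover v) (N₁ ++ N₂) cover≥0 i)))
          (ℤₚ.≤-trans (ℤₚ.≤-reflexive (sym reorder)) (ℤ-le (sumMap-nonneg (ends v) (flat M) ends≥0)
            (trans (ℤsolve 2 (λ x y → x ⊜ (x ⊕′ y) ⊖′ y) refl (sumMap (ends v) (flat M)) (sumMap (cover v) (flat M)))
              (cong (λ z → z ℤ.- sumMap (cover v) (flat M)) (trans (ends+covers M v) total≡1))))))
        where
        2≰1 : (⁺ 2) ℤ.≤ ⁺ 1 → ⊥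
        2≰1 (ℤ.+≤+ (ℕ.s≤s ()))
        reorder : sumMap (cover v) (flat M) ≡ cover v s ℤ.+ sumMap (cover v) (N₁ ++ N₂)
        reorder rewrite eq | sumMap-++ (cover v) N₁ (s ∷ N₂) | sumMap-++ (cover v) N₁ N₂ =
          ℤsolve 3 (λ x y z → x ⊕′ (y ⊕′ z) ⊜ y ⊕′ (x ⊕′ z)) refl (sumMap (cover v) N₁) (cover v s) (sumMap (cover v) N₂)

  0≤if : ∀ (b : Bool) n → 0ℤ ℤ.≤ (if b then ⁺ n else 0ℤ)
  0≤if true  n = ℤ.+≤+ ℕ.z≤n
  0≤if false n = ℤₚ.≤-refl

  covered-avoids : ∀ M {v s} → s ∈ flat M → covers s v ≡ true → All (Avoids v) (net M)
  covered-avoids M {v@(interior e t _ _)} {s} i c = Allₚ.map⁺ (All.tabulate λ { {e′ , a , b} j →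
      -- Slope 1 after and 0 before every point: the ends count the segments that start at `v`.
      (λ a≡v → no-end (λ _ _ → ⁺ 1) (λ _ _ → 0ℤ) {M} {v} (λ (e , a , b) → 0≤if (does (at e a ≟P v)) 1 ⊞ 0≤if (does (at e b ≟P v)) 0) refl refl i c j
        (subst ((⁺ 1) ℤ.≤_) (cong (λ z → z ℤ.+ at? (at e′ b ≟P v) 0ℤ) (sym (if-cong (dec-true (at e′ a ≟P v) a≡v))))
          (ℤₚ.+-monoʳ-≤ (⁺ 1) (0≤if (does (at e′ b ≟P v)) 0)))) ,
      -- Slope 0 after and -1 before every point: the ends count the segments that finish at `v`,
      -- again with jump and total 1.
      (λ b≡v → no-end (λ _ _ → 0ℤ) (λ _ _ → -[1+ 0 ]) {M} {v} (λ (e , a , b) → 0≤if (does (at e a ≟P v)) 0 ⊞ 0≤if (does (at e b ≟P v)) 1) refl refl i c j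
        (subst ((⁺ 1) ℤ.≤_) (cong (λ z → at? (at e′ a ≟P v) 0ℤ ℤ.+ z) (sym (if-cong (dec-true (at e′ b ≟P v) b≡v))))
          (ℤₚ.+-monoˡ-≤ (⁺ 1) (0≤if (does (at e′ a ≟P v)) 0)))) })

  cover-unique : ∀ M {v N₁ s N₂} → flat M ≡ N₁ ++ s ∷ N₂ → covers s v ≡ true → ∀ {s′} → s′ ∈ N₁ ++ N₂ → covers s′ v ≡ true → ⊥
  cover-unique M {v@(interior _ _ _ _)} = no-other-cover (λ _ _ → ⁺ 1) (λ _ _ → 0ℤ) {M} {v}
    (λ (e , a , b) → 0≤if (does (at e a ≟P v)) 1 ⊞ 0≤if (does (at e b ≟P v)) 0) refl refl

  -- Stated negatively, which gives decidability by a scan of the segments. A point that is not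
  -- inside any segment is a vertex or an end of a segment; this positive form is extracted in
  -- `points⁺`.
  On : Model → Point → Set
  On M v = ∀ {s} → s ∈ flat M → covers s v ≡ false

  true≢false : ∀ {b} → b ≡ true → b ≡ false → ⊥
  true≢false refl ()

  on? : ∀ M v → On M v ⊎ ∃ λ s → s ∈ flat M × covers s v ≡ true
  on? M v = go (flat M)
    where
    go : ∀ ss → (∀ {s} → s ∈ ss → covers s v ≡ false) ⊎ ∃ λ s → s ∈ ss × covers s v ≡ true
    go [] = inj₁ λ ()
    go (s ∷ ss) with covers s v in eq | go ss
    ... | true  | _ = inj₂ (s , here refl , eq)
    ... | false | inj₂ (s′ , i , c) = inj₂ (s′ , there i , c)
    ... | false | inj₁ h = inj₁ λ { (here refl) → eq ; (there i) → h i }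

  split : Point → Segment → List Segment
  split (vertex _) s = s ∷ []
  split v@(interior _ t _ _) s@(e , a , b) = if covers s v then (e , a , t) ∷ (e , t , b) ∷ [] else s ∷ []

  chain-++ : ∀ {e a c b ss ss′} → Chain e a c ss → Chain e c b ss′ → Chain e a b (ss ++ ss′)
  chain-++ [ p ] d = p ∷ d
  chain-++ (p ∷ c) d = p ∷ chain-++ c d

  split-chain₁ : ∀ v e {a b} → a < b → Chain e a b (split v (e , a , b))
  split-chain₁ (vertex _) e p = [ p ]
  split-chain₁ v@(interior e′ t q r) e {a} {b} p with covers (e , a , b) v in eq
  ... | false = [ p ]
  ... | true with covers-true {e} {a} {b} {e′} {t} {q} {r} eq
  ...   | _ , a<t , t<b = a<t ∷ [ t<b ]

  split-chain : ∀ v {e a b ss} → Chain e a b ss → Chain e a b (concatMap (split v) ss)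
  split-chain v {e} [ p ] = subst (Chain e _ _) (sym (Listₚ.++-identityʳ _)) (split-chain₁ v e p)
  split-chain v {e} (p ∷ c) = chain-++ (split-chain₁ v e p) (split-chain v c)

  refine : Point → Model → Model
  refine v M = record { segments = λ e → concatMap (split v) (segments M e) ; chain = λ e → split-chain v (chain M e) }

  concatMap-concat-tabulate : ∀ {A B : Set} (f : A → List B) n (S : Fin n → List A) →
    concat (tabulate (λ i → concatMap f (S i))) ≡ concatMap f (concat (tabulate S))
  concatMap-concat-tabulate f zero S = refl
  concatMap-concat-tabulate f (suc n) S = trans (cong (λ z → concatMap f (S Fin.zero) ++ z) (concatMap-concat-tabulate f n (S ∘ Fin.suc)))
    (sym (Listₚ.concatMap-++ f (S Fin.zero) _))

  flat-refine : ∀ v M → flat (refine v M) ≡ concatMap (split v) (flat M)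
  flat-refine v M = concatMap-concat-tabulate (split v) _ (segments M)

  split-uncovered : ∀ v s → covers s v ≡ false → split v s ≡ s ∷ []
  split-uncovered (vertex _) s _ = refl
  split-uncovered (interior _ _ _ _) s h = if-cong h

  concatMap-uncovered : ∀ v ss → (∀ {s} → s ∈ ss → covers s v ≡ false) → concatMap (split v) ss ≡ ss
  concatMap-uncovered v [] h = refl
  concatMap-uncovered v (s ∷ ss) h rewrite split-uncovered v s (h (here refl)) = cong (s ∷_) (concatMap-uncovered v ss (h ∘ there))

  ∈-split : ∀ v {s s′} → s′ ∈ split v s → s′ ≡ s ⊎
    ∃ λ e → ∃ λ a → ∃ λ b → ∃ λ t → s ≡ (e , a , b) × a < t × t < b × at e t ≡ v × (s′ ≡ (e , a , t) ⊎ s′ ≡ (e , t , b))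
  ∈-split (vertex _) (here refl) = inj₁ refl
  ∈-split v@(interior e′ t p q) {s@(e , a , b)} i with covers s v in eq
  ∈-split v@(interior e′ t p q) {s@(e , a , b)} (here refl) | false = inj₁ refl
  ∈-split v@(interior e′ t p q) {s@(e , a , b)} i | true with covers-true {e} {a} {b} {e′} {t} {p} {q} eq
  ... | refl , a<t , t<b = inj₂ (e , a , b , t , refl , a<t , t<b , at-interior e (recompute (0# <? t) p) (recompute (t <? length e) q) , half i)
    where
    half : ∀ {s′} → s′ ∈ (e , a , t) ∷ (e , t , b) ∷ [] → s′ ≡ (e , a , t) ⊎ s′ ≡ (e , t , b)
    half (here refl) = inj₁ refl
    half (there (here refl)) = inj₂ refl

  ∈-refine⁻ : ∀ v M {s′} → s′ ∈ flat (refine v M) → ∃ λ s → s ∈ flat M × s′ ∈ split v s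
  ∈-refine⁻ v M {s′} i with ∈ₚ.∈-concatMap⁻ (split v) {xs = flat M} (subst (s′ ∈_) (flat-refine v M) i)
  ... | j = go (flat M) j
    where
    go : ∀ ss → Any (λ s → s′ ∈ split v s) ss → ∃ λ s → s ∈ ss × s′ ∈ split v s
    go (s ∷ ss) (here k) = s , here refl , k
    go (s ∷ ss) (there k) with go ss k
    ... | s , i , k = s , there i , k

  ∈-refine⁺ : ∀ v M {s s′} → s ∈ flat M → s′ ∈ split v s → s′ ∈ flat (refine v M)
  ∈-refine⁺ v M {s} {s′} i j = subst (s′ ∈_) (sym (flat-refine v M)) (∈ₚ.∈-concatMap⁺ (split v) (Any.map (λ { refl → j }) i))

  covers-mono : ∀ {e a b c d} w → a ≤ c → d ≤ b → covers (e , c , d) w ≡ true → covers (e , a , b) w ≡ true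
  covers-mono {e} {c = c} {d} (interior e′ t p q) ac db h with covers-true {e} {c} {d} {e′} {t} {p} {q} h
  ... | refl , c<t , t<d = covers-intro {p = p} {q} (≤-<-trans ac c<t) (<-≤-trans t<d db)

  on-refine : ∀ v {M w} → On M w → On (refine v M) w
  on-refine v {M} {w} on {s′} i with covers s′ w in eq
  ... | false = refl
  ... | true with ∈-refine⁻ v M i
  ...   | s , j , k with ∈-split v k
  ...     | inj₁ refl = ⊥-elim (true≢false eq (on j))
  ...     | inj₂ (e , a , b , t , refl , a<t , t<b , _ , inj₁ refl) = ⊥-elim (true≢false (covers-mono w ≤-refl (<⇒≤ t<b) eq) (on j))
  ...     | inj₂ (e , a , b , t , refl , a<t , t<b , _ , inj₂ refl) = ⊥-elim (true≢false (covers-mono w (<⇒≤ a<t) ≤-refl eq) (on j))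

  on-refined : ∀ v M → On (refine v M) v
  on-refined (vertex _) M _ = refl
  on-refined v@(interior e′ t′ p q) M {s′@(e″ , c , d)} i with covers s′ v in eq
  ... | false = refl
  ... | true with ∈-refine⁻ v M i
  ...   | s , j , k with ∈-split v k
  ...     | inj₂ (e , a , b , t , refl , a<t , t<b , at≡ , h) = ⊥-elim (no-half h (at≡interior e t at≡) (covers-true {e″} {c} {d} {e′} {t′} {p} {q} eq))
    where
    no-half : ∀ {s′} → s′ ≡ (e , a , t) ⊎ s′ ≡ (e , t , b) → e ≡ e′ × t ≡ t′ →
              proj₁ s′ ≡ e′ × proj₁ (proj₂ s′) < t′ × t′ < proj₂ (proj₂ s′) → ⊥
    no-half (inj₁ refl) (_ , refl) (_ , _ , x) = <-irrefl refl x
    no-half (inj₂ refl) (_ , refl) (_ , x , _) = <-irrefl refl x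
  ...     | inj₁ refl = ⊥-elim (uncovered k)
    where
    uncovered : s ∈ split v s → ⊥
    uncovered k rewrite eq with covers-true {e″} {c} {d} {e′} {t′} {p} {q} eq
    uncovered (here refl) | _ , _ , d<d = <-irrefl refl d<d
    uncovered (there (here refl)) | _ , c<c , _ = <-irrefl refl c<c

  -- A point that was covered before the cut is inside one of the two halves after it, unless it is
  -- the cut point itself.
  on-refine⁻ : ∀ v M {w} → On (refine v M) w → On M w ⊎ w ≡ v
  on-refine⁻ v M {w} on with on? M w
  ... | inj₁ h = inj₁ h
  ... | inj₂ (s@(e , a , b) , i , c) = inside v w on c
    where
    inside : ∀ v w → On (refine v M) w → covers s w ≡ true → On M w ⊎ w ≡ v
    inside (vertex x) w on c = ⊥-elim (true≢false c (on (∈-refine⁺ (vertex x) M i (here refl))))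
    inside v@(interior e′ t p q) w on c with covers s v in eq
    ... | false = ⊥-elim (true≢false c (on (∈-refine⁺ v M i (subst (s ∈_) (sym (split-uncovered v s eq)) (here refl)))))
    inside v@(interior e′ t p q) w@(interior e″ t″ p″ q″) on c | true
      with covers-true {e} {a} {b} {e′} {t} {p} {q} eq | covers-true {e} {a} {b} {e″} {t″} {p″} {q″} c
    ... | refl , a<t , t<b | refl , a<t″ , t″<b = pieces (compare t″ t)
      where
      cut : split v s ≡ (e , a , t) ∷ (e , t , b) ∷ []
      cut = if-cong eq
      pieces : Tri (t″ < t) (t″ ≡ t) (t < t″) → On M w ⊎ w ≡ v
      pieces (tri≈ _ refl _) = inj₂ refl
      pieces (tri< t″<t _ _) = ⊥-elim (true≢false (covers-intro {e′} {p = p″} {q″} a<t″ t″<t)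
        (on (∈-refine⁺ v M i (subst ((e′ , a , t) ∈_) (sym cut) (here refl)))))
      pieces (tri> _ _ t<t″) = ⊥-elim (true≢false (covers-intro {e′} {p = p″} {q″} t<t″ t″<b)
        (on (∈-refine⁺ v M i (subst ((e′ , t , b) ∈_) (sym cut) (there (here refl))))))

  Loopless : Model → Set
  Loopless M = ∀ {e a b} → (e , a , b) ∈ flat M → at e a ≢ at e b

  at-injective-interior : ∀ {e a t} → 0# < t → t < length e → at e a ≡ at e t → a ≡ t
  at-injective-interior {e} {a} {t} p q eq = proj₂ (at≡interior e a (trans eq (at-interior e p q)))

  -- Each half of a cut segment ends in the cut point, which is interior to its edge and therefore
  -- has only one parameter on it.
  loopless-refine : ∀ v M → Loopless M → Loopless (refine v M)
  loopless-refine v M loopless {e} {a} {b} i with ∈-refine⁻ v M i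
  ... | s , j , k with ∈-split v k | All.lookup (proper M) j
  ...   | inj₁ refl | _ = loopless j
  ...   | inj₂ (e , a , b , t , refl , a<t , t<b , _ , inj₁ refl) | 0≤a , _ , b≤L =
      λ eq → <⇒≢ a<t (at-injective-interior (≤-<-trans 0≤a a<t) (<-≤-trans t<b b≤L) eq)
  ...   | inj₂ (e , a , b , t , refl , a<t , t<b , _ , inj₂ refl) | 0≤a , _ , b≤L =
      λ eq → <⇒≢ t<b (sym (at-injective-interior (≤-<-trans 0≤a a<t) (<-≤-trans t<b b≤L) (sym eq)))

  -- The two halves of the cut segment are moved to the front, the form that `exchange` expects. By
  -- `cover-unique` no other segment is cut, and by `covered-avoids` no other link touches the cut
  -- point.
  feasible-exchange : ∀ M {D e a b t} .{p : 0# < t} .{q : t < length e} → let v = interior e t p q in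
    (e , a , b) ∈ flat M → covers (e , a , b) v ≡ true → at e a ≢ at e b →
    Feasible (net (refine v M)) ((at e a , -1ℤ) ∷ D) → Feasible (net (refine v M)) ((at e b , -1ℤ) ∷ D) →
    Feasible (net (refine v M)) ((v , -1ℤ) ∷ D)
  feasible-exchange M {D} {e} {a} {b} {t} {p} {q} i c a≢b fa fb with ∈ₚ.∈-∃++ i | covers-true {e} {a} {b} {e} {t} {p} {q} c
  ... | N₁ , N₂ , eq | _ , a<t , t<b = feasible-↭ (↭-sym perm)
      (exchange {D = D} (lt⁻ a<t) (lt⁻ t<b) a≢b (proj₁ off-s) (proj₂ off-s) off (feasible-↭ perm fa) (feasible-↭ perm fb))
    where
    v = interior e t p q
    s = (e , a , b)
    flat≡ : flat (refine v M) ≡ N₁ ++ (e , a , t) ∷ (e , t , b) ∷ N₂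
    flat≡ = trans (flat-refine v M) (trans (cong (concatMap (split v)) eq) (trans (Listₚ.concatMap-++ (split v) N₁ (s ∷ N₂))
      (cong₂ _++_ (concatMap-uncovered v N₁ (un ∘ ∈ₚ.∈-++⁺ˡ))
        (cong₂ _++_ (if-cong c) (concatMap-uncovered v N₂ (un ∘ ∈ₚ.∈-++⁺ʳ N₁))))))
      where
      un : ∀ {s′} → s′ ∈ N₁ ++ N₂ → covers s′ v ≡ false
      un {s′} j with covers s′ v in eq′
      ... | false = refl
      ... | true  = ⊥-elim (cover-unique M {v} eq c j eq′)
    at-t : at e t ≡ v
    at-t = at-interior e (recompute (0# <? t) p) (recompute (t <? length e) q)
    net≡ : net (refine v M) ≡ map toLink N₁ ++ (at e a , v , t - a) ∷ (v , at e b , b - t) ∷ map toLink N₂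
    net≡ = trans (cong (map toLink) flat≡) (trans (Listₚ.map-++ toLink N₁ _)
      (cong (λ w → map toLink N₁ ++ (at e a , w , t - a) ∷ (w , at e b , b - t) ∷ map toLink N₂) at-t))
    perm : net (refine v M) ↭ (at e a , v , t - a) ∷ (v , at e b , b - t) ∷ (map toLink N₁ ++ map toLink N₂)
    perm = subst (_↭ ((at e a , v , t - a) ∷ (v , at e b , b - t) ∷ (map toLink N₁ ++ map toLink N₂))) (sym net≡) (↭-trans (↭ₚ.shift _ (map toLink N₁) _) (prep _ (↭ₚ.shift _ (map toLink N₁) _)))
    all-off : All (Avoids v) (map toLink N₁ ++ toLink s ∷ map toLink N₂)
    all-off = subst (All (Avoids v)) (trans (cong (map toLink) eq) (Listₚ.map-++ toLink N₁ _)) (covered-avoids M i c)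
    off-s : at e a ≢ v × at e b ≢ v
    off-s = All.head (Allₚ.++⁻ʳ (map toLink N₁) all-off)
    off : All (Avoids v) (map toLink N₁ ++ map toLink N₂)
    off = Allₚ.++⁺ (Allₚ.++⁻ˡ (map toLink N₁) all-off) (All.tail (Allₚ.++⁻ʳ (map toLink N₁) all-off))

-- From rational functions to slope systems.

module Functions {R : RealField} (G : MetricGraph R) where
  open Refinement G public

  module _ {φ : Carrier → Carrier} where

    pl-< : ∀ {a b} → PiecewiseLinear φ a b → a < b
    pl-< (single l) = Linear.a<b l
    pl-< (l then p) = <-trans (Linear.a<b l) (pl-< p)

    after-head : ∀ {a c b t} (l : Linear φ a c) (p : PiecewiseLinear φ c b) → t < c → slopeAfter (l then p) t ≡ Linear.slope l
    after-head {c = c} {t = t} l p h = if-cong (dec-true (t <? c) h)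

    after-tail : ∀ {a c b t} (l : Linear φ a c) (p : PiecewiseLinear φ c b) → c ≤ t → slopeAfter (l then p) t ≡ slopeAfter p t
    after-tail {c = c} {t = t} l p h = if-cong (dec-false (t <? c) λ q → <⇒≱ q h)

    before-head : ∀ {a c b t} (l : Linear φ a c) (p : PiecewiseLinear φ c b) → t ≤ c → slopeBefore (l then p) t ≡ Linear.slope l
    before-head {c = c} {t = t} l p h = if-cong (dec-false (c <? t) λ q → <⇒≱ q h)

    before-tail : ∀ {a c b t} (l : Linear φ a c) (p : PiecewiseLinear φ c b) → c < t → slopeBefore (l then p) t ≡ slopeBefore p t
    before-tail {c = c} {t = t} l p h = if-cong (dec-true (c <? t) h)

    linear-difference : ∀ {a b s t} (l : Linear φ a b) → a ≤ s → s ≤ b → a ≤ t → t ≤ b → φ t - φ s ≡ fromℤ (Linear.slope l) * (t - s)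
    linear-difference {a} {b} {s} {t} l as sb at tb = trans (cong₂ _-_ (Linear.linear l t at tb) (Linear.linear l s as sb))
      (solve 5 (λ f k t s a → (f :+ k :* (t :- a)) :- (f :+ k :* (s :- a)) := k :* (t :- s)) refl (φ a) (fromℤ (Linear.slope l)) t s a)

    Convex : ∀ {a b} → PiecewiseLinear φ a b → Carrier → Carrier → Set
    Convex p s t = ∀ u → s < u → u < t → slopeBefore p u ℤ.≤ slopeAfter p u

    -- Induction along the pieces. Convexity at each breakpoint makes the slopes of consecutive
    -- pieces increase, so the first slope bounds the rise over each later piece from below and the
    -- last slope bounds the rise over each earlier one from above.
    convex-bounds : ∀ {a b s t} (p : PiecewiseLinear φ a b) → a ≤ s → s < t → t ≤ b → Convex p s t →
      fromℤ (slopeAfter p s) * (t - s) ≤ φ t - φ s × φ t - φ s ≤ fromℤ (slopeBefore p t) * (t - s)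
    convex-bounds (single l) as st tb cv =
      inj₂ (sym (linear-difference l as (≤-trans (<⇒≤ st) tb) (≤-trans as (<⇒≤ st)) tb)) ,
      inj₂ (linear-difference l as (≤-trans (<⇒≤ st) tb) (≤-trans as (<⇒≤ st)) tb)
    convex-bounds {s = s} {t} (_then_ {c = c} l p) as st tb cv with <-or-≥ c t | <-or-≥ s c
    ... | inj₂ t≤c | _ rewrite after-head l p (<-≤-trans st t≤c) | before-head l p t≤c =
      inj₂ (sym (linear-difference l as (≤-trans (<⇒≤ st) t≤c) (≤-trans as (<⇒≤ st)) t≤c)) ,
      inj₂ (linear-difference l as (≤-trans (<⇒≤ st) t≤c) (≤-trans as (<⇒≤ st)) t≤c)
    ... | inj₁ c<t | inj₂ c≤s rewrite after-tail l p c≤s | before-tail l p c<t =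
      convex-bounds p c≤s st tb λ u su ut → subst₂ ℤ._≤_ (before-tail l p (≤-<-trans c≤s su)) (after-tail l p (≤-trans c≤s (<⇒≤ su))) (cv u su ut)
    ... | inj₁ c<t | inj₁ s<c rewrite after-head l p s<c | before-tail l p c<t = low , high
      where
      k = Linear.slope l
      rest = convex-bounds p ≤-refl c<t tb λ u cu ut →
        subst₂ ℤ._≤_ (before-tail l p cu) (after-tail l p (<⇒≤ cu)) (cv u (<-trans s<c cu) ut)
      k≤ : k ℤ.≤ slopeAfter p c
      k≤ = subst₂ ℤ._≤_ (before-head l p ≤-refl) (after-tail l p ≤-refl) (cv c s<c c<t)
      step : φ c - φ s ≡ fromℤ k * (c - s)
      step = linear-difference l as (<⇒≤ s<c) (≤-trans as (<⇒≤ s<c)) ≤-refl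
      k≤′ : k ℤ.≤ slopeBefore p t
      k≤′ = slope-≤ (lt⁻ c<t) (≤-trans (*-monoˡ (<⇒≤ (lt⁻ c<t)) (fromℤ-mono k≤)) (≤-trans (proj₁ rest) (proj₂ rest)))
      low : fromℤ k * (t - s) ≤ φ t - φ s
      low = le (le⁻ (≤-trans (*-monoˡ (<⇒≤ (lt⁻ c<t)) (fromℤ-mono k≤)) (proj₁ rest)) +≤ le⁻ (inj₂ (sym step)))
        (solve 7 (λ k t c s ft fc fs → ((ft :- fc) :- k :* (t :- c)) :+ ((fc :- fs) :- k :* (c :- s)) := (ft :- fs) :- k :* (t :- s)) refl
          (fromℤ k) t c s (φ t) (φ c) (φ s))
      high : φ t - φ s ≤ fromℤ (slopeBefore p t) * (t - s)
      high = le (le⁻ (proj₂ rest) +≤ le⁻ (≤-trans (inj₂ step) (*-monoˡ (<⇒≤ (lt⁻ s<c)) (fromℤ-mono k≤′))))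
        (solve 7 (λ k t c s ft fc fs → (k :* (t :- c) :- (ft :- fc)) :+ (k :* (c :- s) :- (fc :- fs)) := k :* (t :- s) :- (ft :- fs)) refl
          (fromℤ (slopeBefore p t)) t c s (φ t) (φ c) (φ s))

  module _ (f : RationalFunction) where
    open RationalFunction f

    after before : Edge → Carrier → ℤ
    after e = slopeAfter (onEdge e)
    before e = slopeBefore (onEdge e)

    total-ord : ∀ v → total after before v ≡ ord f v
    total-ord (vertex v) = refl
    total-ord (interior _ _ _ _) = refl

  cover-zero : ∀ φ⁺ φ⁻ M v → On M v → sumMap (Slopes.cover φ⁺ φ⁻ v) (flat M) ≡ 0ℤ
  cover-zero φ⁺ φ⁻ M v on = sumMap-zero (Slopes.cover φ⁺ φ⁻ v) (flat M) (λ i → if-cong (on i))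

  ends-on : ∀ φ⁺ φ⁻ M v → On M v → sumMap (Slopes.ends φ⁺ φ⁻ v) (flat M) ≡ total φ⁺ φ⁻ v
  ends-on φ⁺ φ⁻ M v on = trans (sym (ℤₚ.+-identityʳ _))
    (trans (cong (λ z → sumMap (Slopes.ends φ⁺ φ⁻ v) (flat M) ℤ.+ z) (sym (cover-zero φ⁺ φ⁻ M v on))) (ends+covers φ⁺ φ⁻ M v))

  SupportedOn : Model → Divisor → Set
  SupportedOn M D = ∀ {w c} → (w , c) ∈ D → On M w

  coeff-covered : ∀ M {D s v} → SupportedOn M D → s ∈ flat M → covers s v ≡ true → coeff D v ≡ 0ℤ
  coeff-covered M {D} {s} {v} sup i c = coeff-none D v λ j w≡v → true≢false c (subst (λ w → covers s w ≡ false) w≡v (sup j i))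

  -- A function with D + div f ≥ 0 is convex along the segments of a model carrying D.
  function⇒feasible : ∀ M {D} → SupportedOn M D → ∀ f → (∀ v → 0ℤ ℤ.≤ coeff D v ℤ.+ ord f v) → Feasible (net M) D
  function⇒feasible M {D} sup f h = feasible value (map (sloped φ⁺ φ⁻) (flat M)) (sym (Listₚ.map-∘ (flat M)))
      (Allₚ.map⁺ (All.tabulate validity)) effective
    where
    open RationalFunction f
    φ⁺ = after f
    φ⁻ = before f
    validity : ∀ {s} → s ∈ flat M → Valid value (sloped φ⁺ φ⁻ s)
    validity {e , a , b} i with All.lookup (proper M) i
    ... | 0≤a , a<b , b≤L with convex-bounds (onEdge e) 0≤a a<b b≤L convex
      where
      convex : Convex (onEdge e) a b
      -- Inside a segment `D` has coefficient zero, so nonnegativity of D + div f is convexity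
      -- there.
      convex t a<t t<b = ℤₚ.0≤i-j⇒j≤i (subst (0ℤ ℤ.≤_)
        (trans (cong (λ z → z ℤ.+ ord f v) (coeff-covered M sup i (covers-intro {e} {p = p} {q} a<t t<b))) (ℤₚ.+-identityˡ _)) (h v))
        where
        p = ≤-<-trans 0≤a a<t
        q = <-≤-trans t<b b≤L
        v = interior e t p q
    ... | low , high = low , le (le⁻ high) (trans (solve 4 (λ k L x y → k :* L :- (y :- x) := (x :- y) :- (:- k) :* L) refl
        (fromℤ (φ⁻ e b)) (b - a) (value (at e a)) (value (at e b)))
        (cong (λ z → (value (at e a) - value (at e b)) - z * (b - a)) (sym (fromℤ-neg (φ⁻ e b)))))
    effective : ∀ v → 0ℤ ℤ.≤ coeff (D ++ div (map (sloped φ⁺ φ⁻) (flat M))) v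
    effective v rewrite wsum-++ (λ w → does (w ≟P v)) D (div (map (sloped φ⁺ φ⁻) (flat M))) with on? M v
    ... | inj₁ on = subst (0ℤ ℤ.≤_) (cong (λ z → coeff D v ℤ.+ z) (sym (trans (coeff-sloped φ⁺ φ⁻ v (flat M))
            (trans (ends-on φ⁺ φ⁻ M v on) (total-ord f v))))) (h v)
    -- A covered point carries neither a coefficient of `D` nor an end of a link.
    ... | inj₂ (s , i , c) = ℤₚ.≤-reflexive (sym (cong₂ ℤ._+_ (coeff-covered M sup i c)
            (coeff-avoids v _ (subst (All (Avoids v)) (Listₚ.map-∘ (flat M)) (covered-avoids M i c)))))

  pieces : ∀ {φ a b} → Edge → PiecewiseLinear φ a b → List Segment
  pieces {a = a} {b} e (single l) = (e , a , b) ∷ []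
  pieces {a = a} e (_then_ {c = c} l p) = (e , a , c) ∷ pieces e p

  pieces-chain : ∀ {φ a b} e (p : PiecewiseLinear φ a b) → Chain e a b (pieces e p)
  pieces-chain e (single l) = [ Linear.a<b l ]
  pieces-chain e (l then p) = Linear.a<b l ∷ pieces-chain e p

  chain-start : ∀ {e a b ss} → Chain e a b ss → All (λ (e′ , c , _) → e′ ≡ e × a ≤ c) ss
  chain-start [ p ] = (refl , ≤-refl) ∷ []
  chain-start (p ∷ c) = (refl , ≤-refl) ∷ All.map (λ (e , q) → e , ≤-trans (<⇒≤ p) q) (chain-start c)

  pieces-smooth : ∀ {φ a b} e (p : PiecewiseLinear φ a b) {e′ c d t} → (e′ , c , d) ∈ pieces e p → c < t → t < d →
    slopeAfter p t ≡ slopeBefore p t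
  pieces-smooth e (single l) (here refl) ct td = refl
  pieces-smooth e (l then p) (here refl) ct td = trans (after-head l p td) (sym (before-head l p (<⇒≤ td)))
  pieces-smooth e (l then p) (there i) ct td with All.lookup (chain-start (pieces-chain e p)) i
  ... | _ , c≤ = trans (after-tail l p (<⇒≤ (≤-<-trans c≤ ct)))
    (trans (pieces-smooth e p i ct td) (sym (before-tail l p (≤-<-trans c≤ ct))))

  module _ (f : RationalFunction) where
    open RationalFunction f

    piecesModel : Model
    piecesModel = record { segments = λ e → pieces e (onEdge e) ; chain = λ e → pieces-chain e (onEdge e) }

    -- An element of |D| has to be a finite formal sum, whereas `ord f` is a function on all points.
    -- Cutting at the breakpoints of `f` leaves no jump inside a segment, so the slopes at the
    -- segment ends list all of div f.
    divisorOf : Divisor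
    divisorOf = div (map (sloped (after f) (before f)) (flat piecesModel))

    covered-smooth : ∀ {s} v → s ∈ flat piecesModel → Slopes.cover (after f) (before f) v s ≡ 0ℤ
    covered-smooth (vertex _) i = refl
    covered-smooth {e , a , b} v@(interior e′ t p q) i with covers (e , a , b) v in eq
    ... | false = refl
    ... | true with covers-true {e} {a} {b} {e′} {t} {p} {q} eq | ∈ₚ.∈-concat⁻′ (tabulate (segments piecesModel)) i
    ...   | refl , a<t , t<b | ss , j , k with ∈ₚ.∈-tabulate⁻ k
    ...     | e″ , refl with All.lookup (chain-start (pieces-chain e″ (onEdge e″))) j
    ...       | refl , _ = trans (cong (λ z → z ℤ.+ ℤ.- before f e t) (pieces-smooth e (onEdge e) j a<t t<b)) (ℤₚ.+-inverseʳ (before f e t))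

    coeff-divisorOf : ∀ v → coeff divisorOf v ≡ ord f v
    coeff-divisorOf v = trans (coeff-sloped (after f) (before f) v (flat piecesModel)) (trans (sym (ℤₚ.+-identityʳ _))
      (trans (cong (λ z → sumMap (Slopes.ends (after f) (before f) v) (flat piecesModel) ℤ.+ z)
               (sym (sumMap-zero (Slopes.cover (after f) (before f) v) (flat piecesModel) (covered-smooth v))))
        (trans (ends+covers (after f) (before f) piecesModel v) (total-ord f v))))

  function⇒system : ∀ {D} f → (∀ v → 0ℤ ℤ.≤ coeff D v ℤ.+ ord f v) → ∃ λ F → F ∈∣ D ∣
  function⇒system {D} f h = D ++ divisorOf f , (λ v → subst (0ℤ ℤ.≤_) (sym (same v)) (h v)) , f , same
    where
    same : ∀ v → coeff (D ++ divisorOf f) v ≡ coeff D v ℤ.+ ord f v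
    same v = trans (wsum-++ _ D (divisorOf f)) (cong (λ z → coeff D v ℤ.+ z) (coeff-divisorOf f v))

  system⇒function : ∀ {D} → (∃ λ F → F ∈∣ D ∣) → ∃ λ f → ∀ v → 0ℤ ℤ.≤ coeff D v ℤ.+ ord f v
  system⇒function (F , eff , f , h) = f , λ v → subst (0ℤ ℤ.≤_) (h v) (eff v)

-- From slope systems to rational functions.

split-++ : ∀ {A B : Set} (f : A → B) rs {xs ys} → map f rs ≡ xs ++ ys →
  ∃ λ rs₁ → ∃ λ rs₂ → rs ≡ rs₁ ++ rs₂ × map f rs₁ ≡ xs × map f rs₂ ≡ ys
split-++ f rs {[]} eq = [] , rs , refl , refl , eq
split-++ f (r ∷ rs) {x ∷ xs} eq with split-++ f rs {xs} (Listₚ.∷-injectiveʳ eq)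
... | rs₁ , rs₂ , refl , eq₁ , eq₂ = r ∷ rs₁ , rs₂ , refl , cong₂ _∷_ (Listₚ.∷-injectiveˡ eq) eq₁ , eq₂

-- The slopes of a solution form one list for the whole net, while interpolation proceeds edge by
-- edge; this distributes them over the edges.
split-concat : ∀ {A B C : Set} (f : A → B) (g : C → B) n (S : Fin n → List C) rs → map f rs ≡ map g (concat (tabulate S)) →
  ∃ λ (T : Fin n → List A) → rs ≡ concat (tabulate T) × (∀ i → map f (T i) ≡ map g (S i))
split-concat f g zero S [] eq = (λ ()) , refl , λ ()
split-concat f g (suc n) S rs eq with split-++ f rs (trans eq (Listₚ.map-++ g (S Fin.zero) _))
... | rs₁ , rs₂ , refl , eq₁ , eq₂ with split-concat f g n (S ∘ Fin.suc) rs₂ eq₂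
...   | T , refl , h = (λ { Fin.zero → rs₁ ; (Fin.suc i) → T i }) , refl , λ { Fin.zero → eq₁ ; (Fin.suc i) → h i }

Pointwise-concat : ∀ {A B : Set} {_∼ₚ_ : A → B → Set} n (S : Fin n → List A) (T : Fin n → List B) →
  (∀ i → Pointwise _∼ₚ_ (S i) (T i)) → Pointwise _∼ₚ_ (concat (tabulate S)) (concat (tabulate T))
Pointwise-concat zero S T h = []
Pointwise-concat (suc n) S T h = Pw.++⁺ (h Fin.zero) (Pointwise-concat n (S ∘ Fin.suc) (T ∘ Fin.suc) (h ∘ Fin.suc))

Pointwise-lookup : ∀ {A B : Set} {_∼ₚ_ : A → B → Set} {xs ys x} → Pointwise _∼ₚ_ xs ys → x ∈ xs → ∃ λ y → x ∼ₚ y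
Pointwise-lookup (p ∷ _) (here refl) = _ , p
Pointwise-lookup (_ ∷ ps) (there i) = Pointwise-lookup ps i

module Interpolation {R : RealField} (G : MetricGraph R) where
  open Functions G public

  module _ {φ : Carrier → Carrier} where

    infixr 5 _⧺_
    _⧺_ : ∀ {a c b} → PiecewiseLinear φ a c → PiecewiseLinear φ c b → PiecewiseLinear φ a b
    single l ⧺ q = l then q
    (l then p) ⧺ q = l then (p ⧺ q)

    after-⧺ˡ : ∀ {a c b t} (p : PiecewiseLinear φ a c) (q : PiecewiseLinear φ c b) → t < c → slopeAfter (p ⧺ q) t ≡ slopeAfter p t
    after-⧺ˡ (single l) q h = after-head l q h
    after-⧺ˡ {t = t} (_then_ {c = d} l p) q h with t <? d
    ... | yes _ = refl
    ... | no _  = after-⧺ˡ p q h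

    before-⧺ˡ : ∀ {a c b t} (p : PiecewiseLinear φ a c) (q : PiecewiseLinear φ c b) → t ≤ c → slopeBefore (p ⧺ q) t ≡ slopeBefore p t
    before-⧺ˡ (single l) q h = before-head l q h
    before-⧺ˡ {t = t} (_then_ {c = d} l p) q h with d <? t
    ... | yes _ = before-⧺ˡ p q h
    ... | no _  = refl

    after-⧺ʳ : ∀ {a c b t} (p : PiecewiseLinear φ a c) (q : PiecewiseLinear φ c b) → c ≤ t → slopeAfter (p ⧺ q) t ≡ slopeAfter q t
    after-⧺ʳ (single l) q h = after-tail l q h
    after-⧺ʳ (l then p) q h = trans (after-tail l (p ⧺ q) (≤-trans (<⇒≤ (pl-< p)) h)) (after-⧺ʳ p q h)

    before-⧺ʳ : ∀ {a c b t} (p : PiecewiseLinear φ a c) (q : PiecewiseLinear φ c b) → c < t → slopeBefore (p ⧺ q) t ≡ slopeBefore q t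
    before-⧺ʳ (single l) q h = before-tail l q h
    before-⧺ʳ (l then p) q h = trans (before-tail l (p ⧺ q) (<-trans (pl-< p) h)) (before-⧺ʳ p q h)

    -- The outgoing slopes of the function need only dominate the prescribed ones: a larger outgoing
    -- slope adds chips at the end concerned.
    Fit : ∀ {A B} → PiecewiseLinear φ A B → Segment → Sloped → Set
    Fit p s@(e , a , b) (l , m , n) = l ≡ toLink s × m ℤ.≤ slopeAfter p a × slopeBefore p b ℤ.≤ ℤ.- n × Convex p a b

    fit-⧺ˡ : ∀ {a c b e s t σ} (p : PiecewiseLinear φ a c) (q : PiecewiseLinear φ c b) → s < t → t ≤ c → Fit p (e , s , t) σ → Fit (p ⧺ q) (e , s , t) σ
    fit-⧺ˡ p q st tc (l , h , h′ , cv) = l , subst (_ ℤ.≤_) (sym (after-⧺ˡ p q (<-≤-trans st tc))) h , subst (ℤ._≤ _) (sym (before-⧺ˡ p q tc)) h′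
      , λ u su ut → subst₂ ℤ._≤_ (sym (before-⧺ˡ p q (≤-trans (<⇒≤ ut) tc))) (sym (after-⧺ˡ p q (<-≤-trans ut tc))) (cv u su ut)

    fit-⧺ʳ : ∀ {a c b e s t σ} (p : PiecewiseLinear φ a c) (q : PiecewiseLinear φ c b) → s < t → c ≤ s → Fit q (e , s , t) σ → Fit (p ⧺ q) (e , s , t) σ
    fit-⧺ʳ p q st cs (l , h , h′ , cv) = l , subst (_ ℤ.≤_) (sym (after-⧺ʳ p q cs)) h , subst (ℤ._≤ _) (sym (before-⧺ʳ p q (≤-<-trans cs st))) h′
      , λ u su ut → subst₂ ℤ._≤_ (sym (before-⧺ʳ p q (≤-<-trans cs su))) (sym (after-⧺ʳ p q (≤-trans cs (<⇒≤ su)))) (cv u su ut)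

    fits-⧺ʳ : ∀ {a c b e ss σs} (p : PiecewiseLinear φ a c) (q : PiecewiseLinear φ c b) → Chain e c b ss →
      Pointwise (Fit q) ss σs → Pointwise (Fit (p ⧺ q)) ss σs
    fits-⧺ʳ {c = c} p q ch fits = go (chain-bounds ch) fits
      where
      chain-bounds : ∀ {e a b ss} → Chain e a b ss → All (λ (_ , s , t) → a ≤ s × s < t) ss
      chain-bounds [ h ] = (≤-refl , h) ∷ []
      chain-bounds (h ∷ ch) = (≤-refl , h) ∷ All.map (λ (i , j) → ≤-trans (<⇒≤ h) i , j) (chain-bounds ch)
      go : ∀ {ss σs} → All (λ (_ , s , t) → c ≤ s × s < t) ss → Pointwise (Fit q) ss σs → Pointwise (Fit (p ⧺ q)) ss σs
      go [] [] = []
      go ((cs , st) ∷ bs) (h ∷ hs) = fit-⧺ʳ p q st cs h ∷ go bs hs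

  -- A profile on [a, b] between the values y and z, kept separate from the function on
  -- the whole edge that will agree with it.
  record Interpolant (a b y z : Carrier) (ss : List Segment) (σs : List Sloped) : Set where
    field
      profile : Carrier → Carrier
      left    : profile a ≡ y
      right   : profile b ≡ z
      realise : ∀ ψ → (∀ t → a ≤ t → t ≤ b → ψ t ≡ profile t) →
                Σ (PiecewiseLinear ψ a b) λ p → Pointwise (Fit p) ss σs

  open Interpolant

  straight : ∀ {e a b y z m n} k → a < b → z ≡ y + fromℤ k * (b - a) → m ℤ.≤ k → k ℤ.≤ ℤ.- n →
    Interpolant a b y z ((e , a , b) ∷ []) ((toLink (e , a , b) , m , n) ∷ [])
  straight {e} {a} {b} {y} k a<b refl mk kn = record
    { profile = λ t → y + fromℤ k * (t - a)
    ; left = solve 3 (λ y k a → y :+ k :* (a :- a) := y) refl y (fromℤ k) a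
    ; right = refl
    ; realise = λ ψ h → single (record { a<b = a<b ; slope = k ; linear = λ t at tb → trans (h t at tb)
        (trans (solve 4 (λ y k t a → y :+ k :* (t :- a) := (y :+ k :* (a :- a)) :+ k :* (t :- a)) refl y (fromℤ k) t a)
          (cong (λ o → o + fromℤ k * (t - a)) (sym (h a ≤-refl (<⇒≤ a<b))))) })
      , (refl , mk , kn , λ _ _ _ → ℤₚ.≤-refl) ∷ [] }

  -- If both inequalities are strict, the mean slope lies strictly between `m` and -`n`. The line of
  -- slope `m` through the left end and the line of slope -`n` through the right end then cross
  -- strictly inside the segment, and the profile is their maximum, which is convex.
  kinked : ∀ {e a b y z m n} → a < b → fromℤ m * (b - a) < z - y → fromℤ n * (b - a) < y - z → 
    Interpolant a b y z ((e , a , b) ∷ []) ((toLink (e , a , b) , m , n) ∷ [])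
  kinked {e} {a} {b} {y} {z} {m} {n} a<b hm hn = record
    { profile = profile′ ; left = trans (if-cong (dec-true (a <? κ) a<κ)) (solve 3 (λ y k a → y :+ k :* (a :- a) := y) refl y M a)
    ; right = trans (if-cong (dec-false (b <? κ) (<-asym κ<b))) (solve 3 (λ z k b → z :+ k :* (b :- b) := z) refl z N b)
    ; realise = λ ψ h → first ψ h then single (second ψ h)
      , (refl , ℤₚ.≤-reflexive (sym (after-head (first ψ h) (single (second ψ h)) a<κ))
        , ℤₚ.≤-reflexive (before-tail (first ψ h) (single (second ψ h)) κ<b) , convex ψ h) ∷ [] }
    where
    M = fromℤ m
    N = fromℤ (ℤ.- n)
    N≡ : N ≡ - fromℤ n
    N≡ = fromℤ-neg n
    hN : z - y < N * (b - a)
    hN = lt (lt⁻ hn) (trans (solve 4 (λ n L y z → (y :- z) :- n :* L := (:- n) :* L :- (z :- y)) refl (fromℤ n) (b - a) y z)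
      (cong (λ o → o * (b - a) - (z - y)) (sym N≡)))
    M<N : M < N
    M<N = *-cancel-< (lt⁻ a<b) (<-trans hm hN)
    K = N - M
    K>0 : 0# < K
    K>0 = lt⁻ M<N
    -- the abscissa where the lines of slope M through (a , y) and N through (b , z) meet
    κ = (y - z + N * b - M * a) * K ⁻¹
    κK : κ * K ≡ y - z + N * b - M * a
    κK = trans (solve 3 (λ s i k → (s :* i) :* k := s :* (k :* i)) refl (y - z + N * b - M * a) (K ⁻¹) K)
      (trans (cong (λ o → (y - z + N * b - M * a) * o) (*-inverseʳ (0<⇒≢0 K>0))) (*-identityʳ _))
    a<κ : a < κ
    a<κ = *-cancel-< K>0 (lt (lt⁻ hN) (trans (solve 6 (λ y z N M a b → N :* (b :- a) :- (z :- y) := ((y :- z) :+ N :* b :- M :* a) :- a :* (N :- M)) refl y z N M a b)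
      (cong (λ o → o - a * K) (sym κK))))
    κ<b : κ < b
    κ<b = *-cancel-< K>0 (lt (lt⁻ hm) (trans (solve 6 (λ y z N M a b → (z :- y) :- M :* (b :- a) := b :* (N :- M) :- ((y :- z) :+ N :* b :- M :* a)) refl y z N M a b)
      (cong (λ o → b * K - o) (sym κK))))
    profile′ : Carrier → Carrier
    profile′ t = if does (t <? κ) then y + M * (t - a) else z + N * (t - b)
    meet : z + N * (κ - b) ≡ y + M * (κ - a)
    meet = trans (solve 7 (λ y z N M a b κ → z :+ N :* (κ :- b) := (y :+ M :* (κ :- a)) :+ (κ :* (N :- M) :- ((y :- z) :+ N :* b :- M :* a))) refl y z N M a b κ)
      (trans (cong (λ o → (y + M * (κ - a)) + (o - (y - z + N * b - M * a))) κK) (solve 2 (λ p q → p :+ (q :- q) := p) refl (y + M * (κ - a)) (y - z + N * b - M * a)))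
    below : ∀ t → t ≤ κ → profile′ t ≡ y + M * (t - a)
    below t (inj₁ h) = if-cong (dec-true (t <? κ) h)
    below t (inj₂ refl) = trans (if-cong (dec-false (t <? t) (<-irrefl refl))) meet
    beyond : ∀ t → κ ≤ t → profile′ t ≡ z + N * (t - b)
    beyond t h = if-cong (dec-false (t <? κ) λ q → <⇒≱ q h)
    module _ (ψ : Carrier → Carrier) (h : ∀ t → a ≤ t → t ≤ b → ψ t ≡ profile′ t) where
      first : Linear ψ a κ
      first = record { a<b = a<κ ; slope = m ; linear = λ t at tκ → trans (h t at (≤-trans tκ (<⇒≤ κ<b))) (trans (below t tκ)
        (trans (solve 4 (λ y k t a → y :+ k :* (t :- a) := (y :+ k :* (a :- a)) :+ k :* (t :- a)) refl y M t a)
          (cong (λ o → o + M * (t - a)) (sym (trans (h a ≤-refl (<⇒≤ a<b)) (below a (<⇒≤ a<κ))))))) }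
      second : Linear ψ κ b
      second = record { a<b = κ<b ; slope = ℤ.- n ; linear = λ t κt tb → trans (h t (≤-trans (<⇒≤ a<κ) κt) tb) (trans (beyond t κt)
        (trans (solve 5 (λ z k t κ b → z :+ k :* (t :- b) := (z :+ k :* (κ :- b)) :+ k :* (t :- κ)) refl z N t κ b)
          (cong (λ o → o + N * (t - κ)) (sym (trans (h κ (<⇒≤ a<κ) (<⇒≤ κ<b)) (beyond κ ≤-refl)))))) }
      convex : Convex (first then single second) a b
      convex t at tb with <-or-≥ t κ | <-or-≥ κ t
      ... | inj₁ tκ | _ = ℤₚ.≤-reflexive (trans (before-head first (single second) (<⇒≤ tκ)) (sym (after-head first (single second) tκ)))
      ... | inj₂ κt | inj₁ κ<t = ℤₚ.≤-reflexive (trans (before-tail first (single second) κ<t) (sym (after-tail first (single second) κt)))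
      ... | inj₂ κt | inj₂ tκ = subst₂ ℤ._≤_ (sym (before-head first (single second) tκ)) (sym (after-tail first (single second) κt))
        (ℤₚ.<⇒≤ (fromℤ-cancel-< M<N))

  -- When one of the inequalities is an equality, the mean slope is an integer and a single piece
  -- does. This separates off the cases in which the kink would fall on an end and leave a piece of
  -- length zero, which `Linear` excludes.
  interpolate : ∀ {e a b y z m n} → a < b → fromℤ m * (b - a) ≤ z - y → fromℤ n * (b - a) ≤ y - z →
    Interpolant a b y z ((e , a , b) ∷ []) ((toLink (e , a , b) , m , n) ∷ [])
  interpolate {e} {a} {b} {y} {z} {m} {n} a<b (inj₂ eq) hn = straight m a<b
      (trans (solve 2 (λ y z → z := y :+ (z :- y)) refl y z) (cong (λ o → y + o) (sym eq))) ℤₚ.≤-refl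
      (slope-≤ (lt⁻ a<b) (le (le⁻ hn) (trans (solve 4 (λ n L y z → (y :- z) :- n :* L := (:- n) :* L :- (z :- y)) refl (fromℤ n) (b - a) y z)
        (cong₂ (λ o w → o * (b - a) - w) (sym (fromℤ-neg n)) (sym eq)))))
  interpolate {e} {a} {b} {y} {z} {m} {n} a<b (inj₁ hm) (inj₂ eq) = straight (ℤ.- n) a<b
      (trans (solve 2 (λ y z → z := y :- (y :- z)) refl y z) (trans (cong (λ o → y - o) (sym eq))
        (trans (solve 3 (λ y n L → y :- n :* L := y :+ (:- n) :* L) refl y (fromℤ n) (b - a)) (cong (λ o → y + o * (b - a)) (sym (fromℤ-neg n))))))
      (slope-≤ (lt⁻ a<b) (<⇒≤ (<-≤-trans hm (inj₂ (trans (solve 2 (λ y z → z :- y := :- (y :- z)) refl y z) (trans (cong (λ o → - o) (sym eq))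
        (trans (solve 2 (λ n L → :- (n :* L) := (:- n) :* L) refl (fromℤ n) (b - a)) (cong (λ o → o * (b - a)) (sym (fromℤ-neg n)))))))))) ℤₚ.≤-refl
  interpolate a<b (inj₁ hm) (inj₁ hn) = kinked a<b hm hn

  glue : ∀ {e a c b y w z s ss σ σs} → a < c → Chain e c b ss → proj₁ (proj₂ s) ≡ a → proj₂ (proj₂ s) ≡ c →
    Interpolant a c y w (s ∷ []) (σ ∷ []) → Interpolant c b w z ss σs → Interpolant a b y z (s ∷ ss) (σ ∷ σs)
  glue {e} {a} {c} {b} {y} {w} {z} {s} {ss} {σ} {σs} a<c ch refl refl I J = record
    { profile = h ; left = trans (if-cong (dec-true (a <? c) a<c)) (left I)
    ; right = trans (if-cong (dec-false (b <? c) (<-asym (chain-< ch)))) (right J)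
    ; realise = λ ψ agree → build ψ (realise I ψ (λ t at tc → trans (agree t at (≤-trans tc (<⇒≤ (chain-< ch)))) (on-I t tc)))
                                    (realise J ψ (λ t ct tb → trans (agree t (≤-trans (<⇒≤ a<c) ct) tb) (on-J t ct))) }
    where
    h : Carrier → Carrier
    h t = if does (t <? c) then profile I t else profile J t
    on-J : ∀ t → c ≤ t → h t ≡ profile J t
    on-J t ct = if-cong (dec-false (t <? c) λ q → <⇒≱ q ct)
    on-I : ∀ t → t ≤ c → h t ≡ profile I t
    on-I t (inj₁ q) = if-cong (dec-true (t <? c) q)
    on-I t (inj₂ refl) = trans (on-J t ≤-refl) (trans (left J) (sym (right I)))
    build : ∀ ψ → Σ (PiecewiseLinear ψ a c) (λ p → Pointwise (Fit p) (s ∷ []) (σ ∷ [])) → Σ (PiecewiseLinear ψ c b) (λ p → Pointwise (Fit p) ss σs) →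
      Σ (PiecewiseLinear ψ a b) λ p → Pointwise (Fit p) (s ∷ ss) (σ ∷ σs)
    build ψ (p , fit ∷ []) (q , fits) = p ⧺ q , fit-⧺ˡ p q a<c ≤-refl fit ∷ fits-⧺ʳ p q ch fits

  interpolate-chain : ∀ {e a b ss} (x : Point → Carrier) → Chain e a b ss → ∀ σs → map proj₁ σs ≡ map toLink ss → All (Valid x) σs →
    Interpolant a b (x (at e a)) (x (at e b)) ss σs
  interpolate-chain x [ h ] ((l , m , n) ∷ []) eq ((p , q) ∷ []) with Listₚ.∷-injectiveˡ eq
  ... | refl = interpolate h p q
  interpolate-chain x (h ∷ ch) ((l , m , n) ∷ σs) eq ((p , q) ∷ va) with Listₚ.∷-injectiveˡ eq | Listₚ.∷-injectiveʳ eq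
  ... | refl | eq′ = glue h ch refl refl (interpolate h p q) (interpolate-chain x ch σs eq′ va)

  module _ {M : Model} {D : Divisor} (F : Feasible (net M) D) where
    open Feasible F renaming (potential to x; slopes to σs; links to σ-links; valid to σ-valid; effective to σ-effective)

    private
      by-edge = split-concat proj₁ toLink _ (segments M) σs σ-links
      σ-edge  = proj₁ by-edge
      σs≡     = proj₁ (proj₂ by-edge)

      profile-on : ∀ e → Interpolant 0# (length e) (x (at e 0#)) (x (at e (length e))) (segments M e) (σ-edge e)
      profile-on e = interpolate-chain x (chain M e) (σ-edge e) (proj₂ (proj₂ by-edge) e)
        (Allₚ.tabulate⁻ (Allₚ.concat⁻ {xss = tabulate σ-edge} (subst (All (Valid x)) σs≡ σ-valid)) e)

      value′ : Point → Carrier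
      value′ (vertex w) = x (vertex w)
      value′ (interior e t _ _) = profile (profile-on e) t

      agree : ∀ e t → 0# ≤ t → t ≤ length e → value′ (at e t) ≡ profile (profile-on e) t
      agree e t (inj₂ refl) _ = trans (cong value′ (at-0 e)) (trans (cong x (sym (at-0 e))) (sym (left (profile-on e))))
      agree e t (inj₁ _) (inj₂ refl) = trans (cong value′ (at-length e)) (trans (cong x (sym (at-length e))) (sym (right (profile-on e))))
      agree e t (inj₁ p) (inj₁ q) = cong value′ (at-interior e p q)

    interpolation : RationalFunction
    interpolation = record { value = value′ ; onEdge = λ e → proj₁ (realise (profile-on e) (λ t → value′ (at e t)) (agree e)) }

    FitsFunction : Segment → Sloped → Set
    FitsFunction s@(e , _ , _) σ = Fit (RationalFunction.onEdge interpolation e) s σ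

    fits : Pointwise FitsFunction (flat M) σs
    fits = subst (Pointwise FitsFunction (flat M)) (sym σs≡) (Pointwise-concat _ (segments M) σ-edge λ e →
      same-edge e (chain-start (chain M e)) (proj₂ (realise (profile-on e) (λ t → value′ (at e t)) (agree e))))
      where
      same-edge : ∀ e {c ss σs} → All (λ (e′ , s , _) → e′ ≡ e × c ≤ s) ss →
        Pointwise (Fit (RationalFunction.onEdge interpolation e)) ss σs → Pointwise FitsFunction ss σs
      same-edge e [] [] = []
      same-edge e ((refl , _) ∷ h) (p ∷ ps) = p ∷ same-edge e h ps

    slopes-≤-ends : ∀ v {ss σs} → Pointwise FitsFunction ss σs →
      coeff (div σs) v ℤ.≤ sumMap (Slopes.ends (after interpolation) (before interpolation) v) ss
    slopes-≤-ends v [] = ℤₚ.≤-refl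
    slopes-≤-ends v {(e , a , b) ∷ ss} {(_ , m , n) ∷ σs} ((refl , hm , hn , _) ∷ h) =
      ℤₚ.≤-trans (ℤₚ.≤-reflexive (sym (ℤₚ.+-assoc (at? (at e a ≟P v) m) _ _)))
        (ℤₚ.+-mono-≤ (ℤₚ.+-mono-≤ (if-mono (does (at e a ≟P v)) hm) (if-mono (does (at e b ≟P v)) hn′)) (slopes-≤-ends v h))
      where
      hn′ : n ℤ.≤ ℤ.- before interpolation e b
      hn′ = subst (ℤ._≤ _) (ℤₚ.neg-involutive n) (ℤₚ.neg-mono-≤ hn)
      if-mono : ∀ (b : Bool) {i j} → i ℤ.≤ j → (if b then i else 0ℤ) ℤ.≤ (if b then j else 0ℤ)
      if-mono true  p = p
      if-mono false _ = ℤₚ.≤-refl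

    feasible⇒function : ∃ λ f → ∀ v → 0ℤ ℤ.≤ coeff D v ℤ.+ ord f v
    feasible⇒function = interpolation , check
      where
      bound : ∀ v → 0ℤ ℤ.≤ coeff D v ℤ.+ coeff (div σs) v
      bound v = subst (0ℤ ℤ.≤_) (wsum-++ _ D (div σs)) (σ-effective v)
      check : ∀ v → 0ℤ ℤ.≤ coeff D v ℤ.+ ord interpolation v
      check v with on? M v
      -- On the model the order is the sum of the end slopes, which dominate the prescribed slopes.
      ... | inj₁ on = ℤₚ.≤-trans (bound v) (ℤₚ.+-monoʳ-≤ (coeff D v) (ℤₚ.≤-trans (slopes-≤-ends v fits)
              (ℤₚ.≤-reflexive (trans (ends-on (after interpolation) (before interpolation) M v on) (total-ord interpolation v)))))
      -- No link touches a covered point, so effectivity of the system says D(v) ≥ 0 there, and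
      -- convexity makes the order nonnegative.
      check v@(interior e t p q) | inj₂ (s@(e′ , a , b) , i , c) with covers-true {e′} {a} {b} {e} {t} {p} {q} c | Pointwise-lookup fits i
      ... | refl , a<t , t<b | _ , _ , _ , _ , convex = subst (0ℤ ℤ.≤_) (ℤₚ.+-identityʳ (coeff D v)) D≥0 ⊞ ℤₚ.i≤j⇒0≤j-i (convex t a<t t<b)
        where
        D≥0 : 0ℤ ℤ.≤ coeff D v ℤ.+ 0ℤ
        D≥0 = subst (λ z → 0ℤ ℤ.≤ coeff D v ℤ.+ z) (coeff-avoids v σs (subst (All (Avoids v)) (sym σ-links) (covered-avoids M i c))) (bound v)

-- The end points of a loopless model determine the rank.

module RankDetermination {R : RealField} (G : MetricGraph R) where
  open Interpolation G public
  open SlopeBound R _≟P_ public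

  positive-net : ∀ M → All Positive (net M)
  positive-net M = Allₚ.map⁺ (All.map (λ { {e , a , b} (_ , a<b , _) → lt⁻ a<b }) (proper M))

  -- Over the set of all points each link contributes its two slopes, whose sum is nonpositive.
  degree-bound : ∀ {N D} → All Positive N → Feasible N D → 0ℤ ℤ.≤ deg D
  degree-bound {D = D} Npos (feasible x r refl va eff) = subst (0ℤ ℤ.≤_) (wsum-all D)
    (ℤ-le (effective⇒wsum (D ++ div r) eff (λ _ → true) ⊞ ℤ-le⁻ (nonpos r (Allₚ.map⁻ Npos) va))
      (trans (cong (λ z → z ℤ.+ (0ℤ ℤ.- wsum (λ _ → true) (div r))) (wsum-++ (λ _ → true) D (div r)))
        (ℤsolve 2 (λ d z → (d ⊕′ z) ⊕′ (const 0ℤ ⊖′ z) ⊜ d ⊖′ const 0ℤ) refl (wsum (λ _ → true) D) (wsum (λ _ → true) (div r)))))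
    where
    nonpos : ∀ r → All (Positive ∘ proj₁) r → All (Valid x) r → wsum (λ _ → true) (div r) ℤ.≤ 0ℤ
    nonpos [] _ _ = ℤₚ.≤-refl
    nonpos (((u , v , L) , a , b) ∷ r) (L>0 ∷ ps) ((p , q) ∷ vs) =
      subst (ℤ._≤ 0ℤ) (ℤₚ.+-assoc a b _) (ℤₚ.+-mono-≤ (opposite-slopes {a} {b} L>0 p q) (nonpos r ps vs))

  minus : List Point → Divisor → Divisor
  minus ps D = pts -1ℤ ps ++ D

  wsum-minus : ∀ U ps D → wsum U (minus ps D) ≡ wsum U D ℤ.- wsum U (pts (⁺ 1) ps)
  wsum-minus U ps D = trans (wsum-++ U (pts -1ℤ ps) D) (trans (ℤₚ.+-comm (wsum U (pts -1ℤ ps)) _)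
    (cong (λ z → wsum U D ℤ.+ z) (wsum-pts U (⁺ 1) ps)))

  wsum-⊖ : ∀ U D E → wsum U (D ⊖ E) ≡ wsum U D ℤ.- wsum U E
  wsum-⊖ U D E = trans (wsum-++ U D _) (cong (λ z → wsum U D ℤ.+ z) (negated E))
    where
    negated : ∀ E → wsum U (map (λ (w , c) → w , ℤ.- c) E) ≡ ℤ.- wsum U E
    negated [] = refl
    negated ((w , c) ∷ E) with U w
    ... | true  = trans (cong (λ z → ℤ.- c ℤ.+ z) (negated E)) (sym (ℤₚ.neg-distrib-+ c (wsum U E)))
    ... | false = trans (ℤₚ.+-identityˡ _) (trans (negated E) (cong (λ z → ℤ.- z) (sym (ℤₚ.+-identityˡ (wsum U E)))))

  supported-minus : ∀ M {ps D} → All (On M) ps → SupportedOn M D → SupportedOn M (minus ps D)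
  supported-minus M [] sup i = sup i
  supported-minus M (h ∷ hs) sup (here refl) = h
  supported-minus M (h ∷ hs) sup (there i) = supported-minus M hs sup i

  supported-refine : ∀ v {M D} → SupportedOn M D → SupportedOn (refine v M) D
  supported-refine v {M} sup {w} i = on-refine v {M} {w} (sup i)

  -- The value and the slopes at the new cut are read off from an interpolating rational function.
  feasible-refine : ∀ v {M D} → SupportedOn M D → Feasible (net M) D → Feasible (net (refine v M)) D
  feasible-refine v {M} {D} sup F with feasible⇒function {M} {D} F
  ... | f , h = function⇒feasible (refine v M) (supported-refine v {M} sup) f h

  ends-on-model : ∀ M {e a b} → (e , a , b) ∈ flat M → On M (at e a) × On M (at e b)
  ends-on-model M {e} {a} {b} i = on (at e a) (λ av → proj₁ av refl) , on (at e b) (λ av → proj₂ av refl)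
    where
    on : ∀ v → (Avoids v (toLink (e , a , b)) → ⊥) → On M v
    on v h {s} j with covers s v in eq
    ... | false = refl
    ... | true  = ⊥-elim (h (All.lookup (Allₚ.map⁻ (covered-avoids M j eq)) i))

  -- Lists with repetitions stand for the effective divisors of degree `k` that are supported on the
  -- points of `M`.
  Everywhere : Model → Divisor → ℕ → Set
  Everywhere M D k = ∀ ps → All (On M) ps → size ps ≡ k → Feasible (net M) (minus ps D)

  -- The chips in `E` lie on the refinement, those in `F` on `M`, and `E` is emptied chip by chip. A
  -- chip on `M` moves over to `F`. A chip at the new point may be replaced by a chip at either end
  -- of the segment it cuts; both replacements are solved by induction, since the ends lie on `M`,
  -- and `feasible-exchange` brings the chip back to the new point. There the two ends must differ,
  -- hence the looplessness.
  everywhere-refine : ∀ v M D k → Loopless M → SupportedOn M D → Everywhere M D k → Everywhere (refine v M) D k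
  everywhere-refine v M D k loopless sup H = λ ps on len → go ps [] on [] (trans (ℕₚ.+-identityʳ _) len)
    where
    move : ∀ E F w → (∀ v → coeff (minus E (minus (w ∷ F) D)) v ≡ coeff (minus (w ∷ E) (minus F D)) v)
    move E F w v = begin
      wsum U (minus E (minus (w ∷ F) D))                              ≡⟨ wsum-minus U E (minus (w ∷ F) D) ⟩
      (z ℤ.+ wsum U (minus F D)) ℤ.- wsum U (pts (⁺ 1) E)             ≡⟨ ℤₚ.+-assoc z _ _ ⟩
      z ℤ.+ (wsum U (minus F D) ℤ.- wsum U (pts (⁺ 1) E))             ≡⟨ cong (λ o → z ℤ.+ o) (sym (wsum-minus U E (minus F D))) ⟩
      wsum U (minus (w ∷ E) (minus F D))                              ∎
      where open ≡-Reasoning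
            U = λ u → does (u ≟P v)
            z = if U w then -1ℤ else 0ℤ
    go : ∀ E F → All (On (refine v M)) E → All (On M) F → size E ℕ.+ size F ≡ k →
      Feasible (net (refine v M)) (minus E (minus F D))
    go [] F _ onF len = feasible-refine v {M} (supported-minus M onF sup) (H F onF len)
    go (p ∷ E) F (onp ∷ onE) onF len = replace (on-refine⁻ v M {p} onp) (on? M p)
      where
      via : ∀ w → On M w → Feasible (net (refine v M)) (minus (w ∷ E) (minus F D))
      via w onw = feasible-cong {D = minus E (minus (w ∷ F) D)} {minus (w ∷ E) (minus F D)} (move E F w) (go E (w ∷ F) onE (onw ∷ onF) (trans (ℕₚ.+-suc _ _) len))
      exchanged : ∀ w → w ≡ v → ∀ {s} → s ∈ flat M → covers s w ≡ true → Feasible (net (refine v M)) (minus (w ∷ E) (minus F D))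
      exchanged w@(interior e t q r) refl {s@(e′ , a , b)} i c with covers-true {e′} {a} {b} {e} {t} {q} {r} c
      ... | refl , _ = feasible-exchange M i c (loopless i) (via (at e a) (proj₁ (ends-on-model M i))) (via (at e b) (proj₂ (ends-on-model M i)))
      replace : On M p ⊎ p ≡ v → On M p ⊎ (∃ λ s → s ∈ flat M × covers s p ≡ true) → Feasible (net (refine v M)) (minus (p ∷ E) (minus F D))
      replace (inj₁ on) _ = via p on
      replace _ (inj₁ on) = via p on
      replace (inj₂ p≡v) (inj₂ (s , i , c)) = exchanged p p≡v i c

  refineAll : List Point → Model → Model
  refineAll [] M = M
  refineAll (p ∷ ps) M = refine p (refineAll ps M)

  refineAll-member : ∀ ps M {w} → w ∈ ps → On (refineAll ps M) w
  refineAll-member (p ∷ ps) M (here refl) = on-refined p (refineAll ps M)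
  refineAll-member (p ∷ ps) M {w} (there i) = on-refine p {refineAll ps M} {w} (refineAll-member ps M i)

  everywhere-refineAll : ∀ vs M D k → Loopless M → SupportedOn M D → Everywhere M D k →
    Everywhere (refineAll vs M) D k × Loopless (refineAll vs M) × SupportedOn (refineAll vs M) D
  everywhere-refineAll [] M D k ll sup H = H , ll , sup
  everywhere-refineAll (v ∷ vs) M D k ll sup H with everywhere-refineAll vs M D k ll sup H
  ... | H′ , ll′ , sup′ = everywhere-refine v (refineAll vs M) D k ll′ sup′ H′ ,
    loopless-refine v (refineAll vs M) ll′ , supported-refine v {refineAll vs M} sup′

  length-sum : ∀ (ps : List Point) → all-sum (pts (⁺ 1) ps) ≡ ⁺ size ps
  length-sum [] = refl
  length-sum (p ∷ ps) = cong (λ z → (⁺ 1) ℤ.+ z) (length-sum ps)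

  -- The points `qs` give an empty system in degree `k`. For minimality, the points of an arbitrary
  -- effective divisor of smaller degree are first added to `A` as cut points; by
  -- `everywhere-refineAll` its subtraction is still solvable there.
  rank-criterion : ∀ A D k → Loopless A → SupportedOn A D → (∀ j → j ℕ.< k → Everywhere A D j) →
    (∃ λ qs → All (On A) qs × size qs ≡ k × ¬ Feasible (net A) (minus qs D)) → IsRank D ((⁺ k) ℤ.- (⁺ 1))
  rank-criterion A D k ll sup lower (qs , on , len , infeasible) = ⁺ k , (member , minimal) , refl
    where
    E = pts (⁺ 1) qs
    member : ∃ λ E → Effective E × EmptySystem (D ⊖ E) × deg E ≡ ⁺ k
    member = E , (λ v → wsum-points _ qs)
      , (λ nonempty → let f , h = system⇒function {D ⊖ E} nonempty in
          infeasible (function⇒feasible A {minus qs D} (supported-minus A on sup) f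
            (λ v → subst (λ z → 0ℤ ℤ.≤ z ℤ.+ ord f v) (trans (wsum-⊖ _ D E) (sym (wsum-minus _ qs D))) (h v))))
      , trans (length-sum qs) (cong ⁺_ len)
    minimal : ∀ d → (∃ λ E → Effective E × EmptySystem (D ⊖ E) × deg E ≡ d) → ⁺ k ℤ.≤ d
    minimal d (E′ , eff , empty , refl) with effective⇒points E′ eff
    ... | ps , res = subst ((⁺ k) ℤ.≤_) (sym deg≡) (ℤ.+≤+ (ℕₚ.≮⇒≥ λ short → contradiction′ short))
      where
      deg≡ : deg E′ ≡ ⁺ size ps
      deg≡ = trans (sym (wsum-all E′)) (trans (res (λ _ → true)) (trans (wsum-all (pts (⁺ 1) ps)) (length-sum ps)))
      contradiction′ : size ps ℕ.< k → ⊥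
      contradiction′ short with everywhere-refineAll ps A D (size ps) ll sup (lower (size ps) short)
      ... | H , _ with feasible⇒function {refineAll ps A} {minus ps D} (H ps (All.tabulate λ {w} i → refineAll-member ps A i) refl)
      ...   | f , h = empty (function⇒system {D ⊖ E′} f λ v → subst (λ z → 0ℤ ℤ.≤ z ℤ.+ ord f v)
              (trans (wsum-minus _ ps D) (trans (cong (λ z → coeff D v ℤ.- z) (sym (res _))) (sym (wsum-⊖ _ D E′)))) (h v))

-- A point is coded as a pair of reals, vertices with first component -1 and interior
-- points with the index of their edge; truth values are the reals 1 and 0.
point-code segment-code slope-code constraint-code divisor-code : Type
point-code      = real ⊗ real
segment-code    = (point-code ⊗ point-code) ⊗ (real ⊗ (real ⊗ real))
slope-code      = segment-code ⊗ (real ⊗ real)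
constraint-code = point-code ⊗ (point-code ⊗ real)
divisor-code    = list (point-code ⊗ real)

-- The program.

module Programs where

  v0 : ∀ {Γ A} → Term (A ∷ Γ) A
  v0 = var (here refl)
  v1 : ∀ {Γ A B} → Term (B ∷ A ∷ Γ) A
  v1 = var (there (here refl))
  v2 : ∀ {Γ A B C} → Term (C ∷ B ∷ A ∷ Γ) A
  v2 = var (there (there (here refl)))
  v3 : ∀ {Γ A B C D} → Term (D ∷ C ∷ B ∷ A ∷ Γ) A
  v3 = var (there (there (there (here refl))))
  v4 : ∀ {Γ A B C D E} → Term (E ∷ D ∷ C ∷ B ∷ A ∷ Γ) A
  v4 = var (there (there (there (there (here refl)))))
  v6 : ∀ {Γ A B C D E F G} → Term (G ∷ F ∷ E ∷ D ∷ C ∷ B ∷ A ∷ Γ) A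
  v6 = var (there (there (there (there (there (there (here refl)))))))
  v5 : ∀ {Γ A B C D E F} → Term (F ∷ E ∷ D ∷ C ∷ B ∷ A ∷ Γ) A
  v5 = var (there (there (there (there (there (here refl))))))

  one : ∀ {Γ A} → Term Γ A → Term Γ (list A)
  one t = cons t nil

  appendT : ∀ {Γ A} → Term Γ (list A ⇒ list A ⇒ list A)
  appendT = lam (lam (listrec v0 (cons v1 v0) v1))

  bindT : ∀ {Γ A B} → Term Γ ((A ⇒ list B) ⇒ list A ⇒ list B)
  bindT = lam (lam (listrec nil (app (app appendT (app v4 v1)) v0) v0))

  for : ∀ {Γ A B} → Term Γ (list A) → Term (A ∷ Γ) (list B) → Term Γ (list B)
  for t u = app (app bindT (lam u)) t

  allT : ∀ {Γ A} → Term Γ ((A ⇒ real) ⇒ list A ⇒ real)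
  allT = lam (lam (listrec 1r (ifless 0r (app v4 v1) v0 0r) v0))

  anyT : ∀ {Γ A} → Term Γ ((A ⇒ real) ⇒ list A ⇒ real)
  anyT = lam (lam (listrec 0r (ifless 0r (app v4 v1) 1r v0) v0))

  ifT : ∀ {Γ A} → Term Γ real → Term Γ A → Term Γ A → Term Γ A
  ifT b t u = ifless 0r b t u

  eqRealT : ∀ {Γ} → Term Γ (real ⇒ real ⇒ real)
  eqRealT = lam (lam (ifless v1 v0 0r (ifless v0 v1 0r 1r)))

  eqT : ∀ {Γ} → Term Γ (point-code ⇒ point-code ⇒ real)
  eqT = lam (lam (ifT (app (app eqRealT (fst v1)) (fst v0)) (app (app eqRealT (snd v1)) (snd v0)) 0r))

  fromNatT : ∀ {Γ} → Term Γ (nat ⇒ real)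
  fromNatT = lam (natrec 0r (add 1r v0) v0)

  fromIntT : ∀ {Γ} → Term Γ (int ⇒ real)
  fromIntT = lam (caseint v0 (app fromNatT v0) (neg (app fromNatT (suc v0))))

  vertexT : ∀ {Γ} → Term Γ (nat ⇒ point-code)
  vertexT = lam (pair (neg 1r) (app fromNatT v0))

  edgeT startT endT : ∀ {Γ} → Term Γ segment-code → Term Γ real
  edgeT s  = fst (snd s)
  startT s = fst (snd (snd s))
  endT s   = snd (snd (snd s))

  sourceT targetT : ∀ {Γ} → Term Γ segment-code → Term Γ point-code
  sourceT s = fst (fst s)
  targetT s = snd (fst s)

  lengthT : ∀ {Γ} → Term Γ segment-code → Term Γ real
  lengthT s = add (endT s) (neg (startT s))

  edge-input location-input : Type
  edge-input     = nat ⊗ nat ⊗ real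
  location-input = nat ⊕ nat ⊗ real

  -- The recursion over the edges returns a function of the index of the first of them, so that the
  -- indices can be counted from the front.
  baseStep : ∀ {Γ} → Term ((nat ⇒ list segment-code) ∷ edge-input ∷ Γ) (nat ⇒ list segment-code)
  baseStep = lam (cons (pair (pair (app vertexT (fst v2)) (app vertexT (fst (snd v2))))
                             (pair (app fromNatT v0) (pair 0r (snd (snd v2)))))
                       (app v1 (suc v0)))

  baseT : ∀ {Γ} → Term Γ (list edge-input ⇒ nat ⇒ list segment-code)
  baseT = lam (listrec (lam nil) baseStep v0)

  locateT resolveStep : ∀ {Γ} → Term (point-code ∷ segment-code ∷ list segment-code ∷ (nat ⊗ real) ∷ Γ) point-code
  locateT = ifless 0r (snd v3) (ifless (snd v3) (endT v1) (pair (app fromNatT (fst v3)) (snd v3)) (targetT v1)) (sourceT v1)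
  resolveStep = ifT (app (app eqRealT (edgeT v1)) (app fromNatT (fst v3))) locateT v0

  -- The end positions of an edge become vertex codes, as in `at`, so all descriptions of a vertex
  -- get the same code. The starting value of the recursion is a default for an edge index that is
  -- not in the list.
  resolveT : ∀ {Γ} → Term Γ (list segment-code ⇒ location-input ⇒ point-code)
  resolveT = lam (lam (case v0 (app vertexT v0) (listrec (pair (app fromNatT (fst v0)) (snd v0)) resolveStep v2)))

  divisorBody : ∀ {Γ} → Term ((location-input ⊗ int) ∷ list (location-input ⊗ int) ∷ list segment-code ∷ Γ) divisor-code
  divisorBody = one (pair (app (app resolveT v2) (fst v0)) (app fromIntT (snd v0)))

  divisorT : ∀ {Γ} → Term Γ (list segment-code ⇒ list (location-input ⊗ int) ⇒ divisor-code)
  divisorT = lam (lam (for v0 divisorBody))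

  cutT : ∀ {Γ} → Term (segment-code ∷ point-code ∷ Γ) (list segment-code)
  cutT = ifless (startT v0) (snd v1)
    (ifless (snd v1) (endT v0)
      (cons (pair (pair (sourceT v0) v1) (pair (edgeT v0) (pair (startT v0) (snd v1))))
        (one (pair (pair v1 (targetT v0)) (pair (edgeT v0) (pair (snd v1) (endT v0))))))
      (one v0))
    (one v0)

  -- The first component of a vertex code is -1 and never equals an edge index, so splitting at a
  -- vertex changes nothing.
  splitT : ∀ {Γ} → Term Γ (point-code ⇒ segment-code ⇒ list segment-code)
  splitT = lam (lam (ifT (app (app eqRealT (edgeT v0)) (fst v1)) cutT (one v0)))

  refineBody : ∀ {Γ} → Term (segment-code ∷ list segment-code ∷ point-code ∷ Γ) (list segment-code)
  refineBody = app (app splitT v2) v0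

  refineT : ∀ {Γ} → Term Γ (list point-code ⇒ list segment-code ⇒ list segment-code)
  refineT = lam (lam (listrec v0 (for v0 refineBody) v1))

  -- It is applied to whole edges, which start at 0, so half the end is the midpoint.
  midpointBody : ∀ {Γ} → Term (segment-code ∷ Γ) (list point-code)
  midpointBody = one (pair (edgeT v0) (mul (inv (add 1r 1r)) (endT v0)))

  midpointsT : ∀ {Γ} → Term Γ (list segment-code ⇒ list point-code)
  midpointsT = lam (for v0 midpointBody)

  supportBody : ∀ {Γ} → Term ((point-code ⊗ real) ∷ Γ) (list point-code)
  supportBody = one (fst v0)

  supportT : ∀ {Γ} → Term Γ (divisor-code ⇒ list point-code)
  supportT = lam (for v0 supportBody)

  endsBody : ∀ {Γ} → Term (segment-code ∷ Γ) (list point-code)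
  endsBody = cons (sourceT v0) (one (targetT v0))

  endsT : ∀ {Γ} → Term Γ (list segment-code ⇒ list point-code)
  endsT = lam (for v0 endsBody)

  -- The vertices are listed in addition to the segment ends so that the vertex of a graph without
  -- edges is tested too.
  verticesT : ∀ {Γ} → Term Γ (nat ⇒ list point-code)
  verticesT = lam (natrec nil (cons (app vertexT v1) v0) v0)

  tupleBody : ∀ {Γ} → Term (divisor-code ∷ point-code ∷ Γ) (list divisor-code)
  tupleBody = one (cons (pair v1 (neg 1r)) v0)

  tuplesStep : ∀ {Γ} → Term (list divisor-code ∷ nat ∷ nat ∷ list point-code ∷ Γ) (list divisor-code)
  tuplesStep = for v3 (for v1 tupleBody)

  tuplesT : ∀ {Γ} → Term Γ (list point-code ⇒ nat ⇒ list divisor-code)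
  tuplesT = lam (lam (natrec (one nil) tuplesStep v0))

  widenBody : ∀ {Γ} → Term (real ∷ Γ) (list real)
  widenBody = cons v0 (cons (add v0 1r) (one (add v0 (neg 1r))))

  -- Each unit of a positive coefficient widens the range of candidate slopes by one in both
  -- directions. Starting from 0, the list ends up with all integers between -B and B, where B is
  -- the sum of the positive coefficients. The integers of the input are used because the recursion
  -- has to count.
  slopesStep : ∀ {Γ} → Term (list real ∷ (location-input ⊗ int) ∷ Γ) (list real)
  slopesStep = caseint (snd v1) (natrec v1 (for v0 widenBody) v0) v1

  slopesT : ∀ {Γ} → Term Γ (list (location-input ⊗ int) ⇒ list real)
  slopesT = lam (listrec (one 0r) slopesStep v0)

  decorateBody : ∀ {Γ} → Term (real ∷ real ∷ list slope-code ∷ list (list slope-code) ∷ segment-code ∷ Γ) (list (list slope-code))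
  decorateBody = one (cons (pair v4 (pair v1 v0)) v2)

  decorateStep : ∀ {Γ} → Term (list (list slope-code) ∷ segment-code ∷ list segment-code ∷ list segment-code ∷ list real ∷ Γ) (list (list slope-code))
  decorateStep = for v0 (for v5 (for v6 decorateBody))

  decorateT : ∀ {Γ} → Term Γ (list real ⇒ list segment-code ⇒ list (list slope-code))
  decorateT = lam (lam (listrec (one nil) decorateStep v0))

  divBody : ∀ {Γ} → Term (slope-code ∷ Γ) divisor-code
  divBody = cons (pair (sourceT (fst v0)) (fst (snd v0))) (one (pair (targetT (fst v0)) (snd (snd v0))))

  divT : ∀ {Γ} → Term Γ (list slope-code ⇒ divisor-code)
  divT = lam (for v0 divBody)

  coeffStep : ∀ {Γ} → Term (real ∷ (point-code ⊗ real) ∷ divisor-code ∷ point-code ∷ Γ) real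
  coeffStep = ifT (app (app eqT (fst v1)) v3) (add (snd v1) v0) v0

  coeffT : ∀ {Γ} → Term Γ (divisor-code ⇒ point-code ⇒ real)
  coeffT = lam (lam (listrec 0r coeffStep v1))

  effectiveBody : ∀ {Γ} → Term ((point-code ⊗ real) ∷ divisor-code ∷ Γ) real
  effectiveBody = ifless (app (app coeffT v1) (fst v0)) 0r 0r 1r

  effectiveT : ∀ {Γ} → Term Γ (divisor-code ⇒ real)
  effectiveT = lam (app (app allT (lam effectiveBody)) v0)

  -- (v , u , c) stands for x u + c ≤ x v.
  constraintsBody : ∀ {Γ} → Term (slope-code ∷ Γ) (list constraint-code)
  constraintsBody =
    cons (pair (targetT (fst v0)) (pair (sourceT (fst v0)) (mul (fst (snd v0)) (lengthT (fst v0)))))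
      (one (pair (sourceT (fst v0)) (pair (targetT (fst v0)) (mul (snd (snd v0)) (lengthT (fst v0))))))

  constraintsT : ∀ {Γ} → Term Γ (list slope-code ⇒ list constraint-code)
  constraintsT = lam (for v0 constraintsBody)

  -- Fourier–Motzkin elimination; the eliminated variable is v2, and v3 inside the inner loop.
  combinedT combineBody : ∀ {Γ} → Term (constraint-code ∷ constraint-code ∷ list constraint-code ∷ point-code ∷ Γ) (list constraint-code)
  combinedT   = ifT (app (app eqT (fst (snd v0))) v3) nil (one (pair (fst v1) (pair (fst (snd v0)) (add (snd (snd v1)) (snd (snd v0))))))
  combineBody = ifT (app (app eqT (fst v0)) v3) combinedT nil

  upperT lowerT eliminateBody : ∀ {Γ} → Term (constraint-code ∷ list constraint-code ∷ point-code ∷ Γ) (list constraint-code)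
  upperT        = ifT (app (app eqT (fst (snd v0))) v2) (for v1 combineBody) (one v0)
  lowerT        = ifT (app (app eqT (fst v0)) v2) nil upperT
  eliminateBody = ifT (app (app eqT (fst v0)) (fst (snd v0))) (one v0) lowerT

  eliminateT : ∀ {Γ} → Term Γ (point-code ⇒ list constraint-code ⇒ list constraint-code)
  eliminateT = lam (lam (for v0 eliminateBody))

  eliminateAllT : ∀ {Γ} → Term Γ (list point-code ⇒ list constraint-code ⇒ list constraint-code)
  eliminateAllT = lam (lam (listrec v0 (app (app eliminateT v1) v0) v1))

  -- After the elimination of all points a constraint has equal ends and says that its constant is
  -- at most 0.
  satisfiableBody : ∀ {Γ} → Term (constraint-code ∷ Γ) real
  satisfiableBody = ifless 0r (snd (snd v0)) 0r 1r

  satisfiableT : ∀ {Γ} → Term Γ (list point-code ⇒ list constraint-code ⇒ real)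
  satisfiableT = lam (lam (app (app allT (lam satisfiableBody)) (app (app eliminateAllT v1) v0)))

  totalT : ∀ {Γ} → Term (list slope-code ∷ divisor-code ∷ Γ) divisor-code
  totalT = app (app appendT v1) (app divT v0)

  checkT : ∀ {Γ} → Term Γ (list segment-code ⇒ divisor-code ⇒ list slope-code ⇒ real)
  checkT = lam (lam (lam (ifT (app effectiveT totalT)
    (app (app satisfiableT (app endsT v2)) (app constraintsT v0)) 0r)))

  feasibleT : ∀ {Γ} → Term Γ (list real ⇒ list segment-code ⇒ divisor-code ⇒ real)
  feasibleT = lam (lam (lam (app (app anyT (app (app checkT v1) v0)) (app (app decorateT v2) v1))))

  modelT : ∀ {Γ} → Term Γ (list segment-code ⇒ divisor-code ⇒ list segment-code)
  modelT = lam (lam (app (app refineT (app (app appendT (app midpointsT v1)) (app supportT v0))) v1))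

  everywhereBody : ∀ {Γ} → Term (divisor-code ∷ nat ∷ divisor-code ∷ list point-code ∷ list segment-code ∷ list real ∷ Γ) real
  everywhereBody = app (app (app feasibleT v5) v4) (app (app appendT v0) v2)

  everywhereT : ∀ {Γ} → Term Γ (list real ⇒ list segment-code ⇒ list point-code ⇒ divisor-code ⇒ nat ⇒ real)
  everywhereT = lam (lam (lam (lam (lam (app (app allT (lam everywhereBody)) (app (app tuplesT v2) v0))))))

  Prepared : Type
  Prepared = list real ⊗ (list segment-code ⊗ (list point-code ⊗ divisor-code))

  assembleT : ∀ {Γ} → Term (list segment-code ∷ divisor-code ∷ list segment-code ∷ InputType ∷ Γ) Prepared
  assembleT = pair (app slopesT (snd (snd v3))) (pair v0 (pair (app (app appendT (app verticesT (fst v3))) (app endsT v0)) v1))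

  prepareT : ∀ {Γ} → Term Γ (InputType ⇒ Prepared)
  prepareT = lam (app (lam (app (lam (app (lam assembleT)
      (app (app modelT v1) v0)))
      (app (app divisorT v0) (snd (snd v1)))))
      (app (app baseT (fst (snd v0))) zero))

  -- The value -1 at `zero` is the rank of a divisor whose own system is empty.
  predT : ∀ {Γ} → Term Γ (nat ⇒ int)
  predT = lam (natrec (negsuc zero) (pos v1) v0)

  continueT : ∀ {Γ} → Term (Prepared ⊗ nat ∷ Γ) real
  continueT = app (app (app (app (app everywhereT (fst (fst v0))) (fst (snd (fst v0)))) (fst (snd (snd (fst v0))))) (snd (snd (snd (fst v0))))) (snd v0)

  stepT : ∀ {Γ} → Term (Prepared ⊗ nat ∷ Γ) ((Prepared ⊗ nat) ⊕ int)
  stepT = ifT continueT (inl (pair (fst v0) (suc (snd v0)))) (inr (app predT (snd v0)))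

  initialT : Term (InputType ∷ []) (Prepared ⊗ nat)
  initialT = pair (app prepareT v0) zero

  program : ∀ {I S O} → Term (I ∷ []) S → Term (S ∷ []) (S ⊕ O) → Program I O
  program start step = record { State = _ ; start = start ; step = step }

-- Denotations of the program and its parts.

-- Xᵐ is the function computed by the program XT.  The equations hold in every
-- environment because programs are inlined under the binders of other programs.
module Mirror (R : RealField) where
  open Field R
  open Semantics R public
  open Programs public

  Code Segmentᶜ Slopedᶜ Constraint : Set
  Code       = Carrier × Carrier
  Segmentᶜ   = ⟦ segment-code ⟧
  Slopedᶜ    = ⟦ slope-code ⟧
  Constraint = ⟦ constraint-code ⟧

  Divisorᶜ : Set
  Divisorᶜ = List (Code × Carrier)

  infix 4 _≟C_
  _≟C_ : DecidableEquality Code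
  _≟C_ = ≡-dec _≟_ _≟_

  Env : Ctx → Set
  Env = All ⟦_⟧

  bit : Bool → Carrier
  bit b = if b then 1# else 0#

  every some : ∀ {A : Set} → (A → Bool) → List A → Bool
  every p = foldr (λ x b → p x ∧ b) true
  some p  = foldr (λ x b → p x ∨ b) false

  module _ {Γ : Ctx} (ρ : Env Γ) where

    if-bit : ∀ {A} (b : Term Γ real) (t u : Term Γ A) {c} → eval b ρ ≡ bit c →
      eval (ifT b t u) ρ ≡ (if c then eval t ρ else eval u ρ)
    if-bit b t u {true}  eq rewrite eq | dec-true (0# <? 1#) 0<1 = refl
    if-bit b t u {false} eq rewrite eq | dec-false (0# <? 0#) (<-irrefl refl) = refl

    listrec≡ : ∀ {A B} (n : Term Γ B) (c : Term (B ∷ A ∷ list A ∷ Γ) B) (t : Term Γ (list A)) {f : ⟦ A ⟧ → ⟦ B ⟧ → ⟦ B ⟧} →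
      (∀ b x xs → eval c (b ∷ x ∷ xs ∷ ρ) ≡ f x b) → eval (listrec n c t) ρ ≡ foldr f (eval n ρ) (eval t ρ)
    listrec≡ n c t {f} h = go (eval t ρ)
      where
      go : ∀ xs → List-rec (eval n ρ) (λ b x xs → eval c (b ∷ x ∷ xs ∷ ρ)) xs ≡ foldr f (eval n ρ) xs
      go [] = refl
      go (x ∷ xs) = trans (h _ x xs) (cong (f x) (go xs))

    call₁ : ∀ {A B} (X : Term Γ (A ⇒ B)) (t : Term Γ A) {f : ⟦ A ⟧ → ⟦ B ⟧} → (∀ a → eval X ρ a ≡ f a) → eval (app X t) ρ ≡ f (eval t ρ)
    call₁ X t h = h (eval t ρ)

    call₂ : ∀ {A B C} (X : Term Γ (A ⇒ B ⇒ C)) (t : Term Γ A) (u : Term Γ B) {f : ⟦ A ⟧ → ⟦ B ⟧ → ⟦ C ⟧} → (∀ a b → eval X ρ a b ≡ f a b) →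
      eval (app (app X t) u) ρ ≡ f (eval t ρ) (eval u ρ)
    call₂ X t u h = h (eval t ρ) (eval u ρ)

    call₃ : ∀ {A B C D} (X : Term Γ (A ⇒ B ⇒ C ⇒ D)) (t : Term Γ A) (u : Term Γ B) (v : Term Γ C) {f : ⟦ A ⟧ → ⟦ B ⟧ → ⟦ C ⟧ → ⟦ D ⟧} → (∀ a b c → eval X ρ a b c ≡ f a b c) →
      eval (app (app (app X t) u) v) ρ ≡ f (eval t ρ) (eval u ρ) (eval v ρ)
    call₃ X t u v h = h (eval t ρ) (eval u ρ) (eval v ρ)

  append≡ : ∀ {A Γ} (ρ : Env Γ) (xs ys : List ⟦ A ⟧) → eval (appendT {A = A}) ρ xs ys ≡ xs ++ ys
  append≡ {A} {Γ} ρ xs ys = trans (listrec≡ {list A ∷ list A ∷ Γ} (ys ∷ xs ∷ ρ) {A} {list A} v0 (cons v1 v0) v1 {_∷_} (λ _ _ _ → refl)) (sym (Listₚ.++-is-foldr xs ys))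

  for≡ : ∀ {A B Γ} (ρ : Env Γ) (t : Term Γ (list A)) (u : Term (A ∷ Γ) (list B)) {f : ⟦ A ⟧ → List ⟦ B ⟧} →
    (∀ x → eval u (x ∷ ρ) ≡ f x) → eval (for t u) ρ ≡ concatMap f (eval t ρ)
  for≡ {A} {B} {Γ} ρ t u {f} h = go (eval t ρ)
    where
    ρ₁ : List ⟦ A ⟧ → Env (list A ∷ (A ⇒ list B) ∷ Γ)
    ρ₁ xs = xs ∷ (λ x → eval u (x ∷ ρ)) ∷ ρ
    go₁ : ∀ xs → foldr (λ x b → f x ++ b) [] xs ≡ concatMap f xs
    go₁ [] = refl
    go₁ (x ∷ xs) = cong (f x ++_) (go₁ xs)
    go : ∀ xs → eval (bindT {A = A} {B}) ρ (λ x → eval u (x ∷ ρ)) xs ≡ concatMap f xs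
    go xs = trans (listrec≡ (ρ₁ xs) nil (app (app appendT (app v4 v1)) v0) v0
      (λ b x tl → trans (append≡ {B} {list B ∷ A ∷ list A ∷ list A ∷ (A ⇒ list B) ∷ Γ} (b ∷ x ∷ tl ∷ ρ₁ xs) (eval u (x ∷ ρ)) b) (cong (_++ b) (h x)))) (go₁ xs)

  all≡ : ∀ {A Γ} (ρ : Env Γ) (p : Term Γ (A ⇒ real)) (t : Term Γ (list A)) {q : ⟦ A ⟧ → Bool} →
    (∀ x → eval p ρ x ≡ bit (q x)) → eval (app (app allT p) t) ρ ≡ bit (every q (eval t ρ))
  -- The environment keeps the whole list while the recursion runs through its tails, so the two
  -- occurrences are generalised separately.
  all≡ {A} {Γ} ρ p t {q} h = go (eval t ρ) (eval t ρ)
    where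
    body : Term (real ∷ A ∷ list A ∷ list A ∷ (A ⇒ real) ∷ Γ) real
    body = app v4 v1
    σ : Carrier → ⟦ A ⟧ → List ⟦ A ⟧ → List ⟦ A ⟧ → Env (real ∷ A ∷ list A ∷ list A ∷ (A ⇒ real) ∷ Γ)
    σ b x xs xs₀ = b ∷ x ∷ xs ∷ xs₀ ∷ eval p ρ ∷ ρ
    rec : List ⟦ A ⟧ → List ⟦ A ⟧ → Carrier
    rec xs₀ = List-rec 1# (λ b x tl → eval (ifT body v0 0r) (σ b x tl xs₀))
    go : ∀ xs₀ xs → rec xs₀ xs ≡ bit (every q xs)
    go xs₀ [] = refl
    go xs₀ (x ∷ xs) = trans (if-bit (σ (rec xs₀ xs) x xs xs₀) body v0 0r (h x)) (both (q x) (go xs₀ xs))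
      where
      both : ∀ c {b d} → b ≡ bit d → (if c then b else 0#) ≡ bit (c ∧ d)
      both true  e = e
      both false e = refl

  any≡ : ∀ {A Γ} (ρ : Env Γ) (p : Term Γ (A ⇒ real)) (t : Term Γ (list A)) {q : ⟦ A ⟧ → Bool} →
    (∀ x → eval p ρ x ≡ bit (q x)) → eval (app (app anyT p) t) ρ ≡ bit (some q (eval t ρ))
  any≡ {A} {Γ} ρ p t {q} h = go (eval t ρ) (eval t ρ)
    where
    body : Term (real ∷ A ∷ list A ∷ list A ∷ (A ⇒ real) ∷ Γ) real
    body = app v4 v1
    σ : Carrier → ⟦ A ⟧ → List ⟦ A ⟧ → List ⟦ A ⟧ → Env (real ∷ A ∷ list A ∷ list A ∷ (A ⇒ real) ∷ Γ)
    σ b x xs xs₀ = b ∷ x ∷ xs ∷ xs₀ ∷ eval p ρ ∷ ρ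
    rec : List ⟦ A ⟧ → List ⟦ A ⟧ → Carrier
    rec xs₀ = List-rec 0# (λ b x tl → eval (ifT body 1r v0) (σ b x tl xs₀))
    go : ∀ xs₀ xs → rec xs₀ xs ≡ bit (some q xs)
    go xs₀ [] = refl
    go xs₀ (x ∷ xs) = trans (if-bit (σ (rec xs₀ xs) x xs xs₀) body 1r v0 (h x)) (either (q x) (go xs₀ xs))
      where
      either : ∀ c {b d} → b ≡ bit d → (if c then 1# else b) ≡ bit (c ∨ d)
      either true  e = refl
      either false e = e

  eqReal≡ : ∀ {Γ} (ρ : Env Γ) x y → eval eqRealT ρ x y ≡ bit (does (x ≟ y))
  eqReal≡ ρ x y with compare x y
  ... | tri< _ _ _ = refl
  ... | tri≈ _ refl _ rewrite dec-false (x <? x) (<-irrefl refl) = refl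
  ... | tri> _ _ y<x rewrite dec-true (y <? x) y<x = refl

  eq≡ : ∀ {Γ} (ρ : Env Γ) p q → eval eqT ρ p q ≡ bit (does (p ≟C q))
  eq≡ {Γ} ρ p@(p₁ , p₂) q@(q₁ , q₂) = trans
    (if-bit σ (app (app eqRealT (fst v1)) (fst v0)) (app (app eqRealT (snd v1)) (snd v0)) 0r (eqReal≡ σ p₁ q₁))
    (both (p₁ ≟ q₁) (p₂ ≟ q₂) (eqReal≡ σ p₂ q₂))
    where
    σ : Env (point-code ∷ point-code ∷ Γ)
    σ = q ∷ p ∷ ρ
    both : ∀ (d : Dec (p₁ ≡ q₁)) (d′ : Dec (p₂ ≡ q₂)) {b} → b ≡ bit (does d′) → (if does d then b else 0#) ≡ bit (does (p ≟C q))
    both (yes refl) (yes refl) e = trans e (cong bit (sym (dec-true (p ≟C p) refl)))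
    both (yes refl) (no n) e = trans e (cong bit (sym (dec-false (p ≟C q) (n ∘ cong proj₂))))
    both (no n) _ _ = cong bit (sym (dec-false (p ≟C q) (n ∘ cong proj₁)))

  fromNat≡ : ∀ {Γ} (ρ : Env Γ) n → eval fromNatT ρ n ≡ fromℕ n
  fromNat≡ {Γ} ρ n = go n
    where
    go : ∀ k → ℕ-rec 0# (λ b k → eval (add 1r v0) (_∷_ {x = real} b (_∷_ {x = nat} k (_∷_ {x = nat} n ρ)))) k ≡ fromℕ k
    go zero = refl
    go (suc k) = cong (λ z → 1# + z) (go k)

  fromInt≡ : ∀ {Γ} (ρ : Env Γ) i → eval fromIntT ρ i ≡ fromℤ i
  fromInt≡ {Γ} ρ (⁺ n) = fromNat≡ {nat ∷ int ∷ Γ} (n ∷ ⁺ n ∷ ρ) n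
  fromInt≡ {Γ} ρ -[1+ n ] = cong (λ z → - z) (fromNat≡ {nat ∷ int ∷ Γ} (n ∷ -[1+ n ] ∷ ρ) (suc n))

  vertexᵐ : ℕ → Code
  vertexᵐ n = - 1# , fromℕ n

  vertex≡ : ∀ {Γ} (ρ : Env Γ) n → eval vertexT ρ n ≡ vertexᵐ n
  vertex≡ {Γ} ρ n = cong (- 1# ,_) (fromNat≡ {nat ∷ Γ} (n ∷ ρ) n)

  baseᵐ : List (ℕ × ℕ × Carrier) → ℕ → List Segmentᶜ
  baseᵐ [] n = []
  baseᵐ ((s , t , L) ∷ es) n = ((vertexᵐ s , vertexᵐ t) , (fromℕ n , (0# , L))) ∷ baseᵐ es (suc n)

  base≡ : ∀ {Γ} (ρ : Env Γ) es n → eval baseT ρ es n ≡ baseᵐ es n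
  base≡ {Γ} ρ es = go es
    where
    σ : Env (list edge-input ∷ Γ)
    σ = es ∷ ρ
    rec : List (ℕ × ℕ × Carrier) → ℕ → List Segmentᶜ
    rec = List-rec (λ _ → []) (λ b x tl → eval (baseStep {list edge-input ∷ list edge-input ∷ Γ}) (b ∷ x ∷ tl ∷ σ))
    go : ∀ xs n → rec xs n ≡ baseᵐ xs n
    go [] n = refl
    go (x@(s , t , L) ∷ xs) n = cong₂ _∷_ (cong₂ _,_ (cong₂ _,_ (vertex≡ τ s) (vertex≡ τ t)) (cong (_, (0# , L)) (fromNat≡ τ n))) (go xs (suc n))
      where
      τ : Env (nat ∷ (nat ⇒ list segment-code) ∷ edge-input ∷ list edge-input ∷ list edge-input ∷ Γ)
      τ = n ∷ rec xs ∷ x ∷ xs ∷ σ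

  edgeᵐ startᵐ endᵐ : Segmentᶜ → Carrier
  edgeᵐ s  = proj₁ (proj₂ s)
  startᵐ s = proj₁ (proj₂ (proj₂ s))
  endᵐ s   = proj₂ (proj₂ (proj₂ s))

  sourceᵐ targetᵐ : Segmentᶜ → Code
  sourceᵐ s = proj₁ (proj₁ s)
  targetᵐ s = proj₂ (proj₁ s)

  locateᵐ : ℕ → Carrier → Segmentᶜ → Code
  locateᵐ e t s = if does (0# <? t) then (if does (t <? endᵐ s) then (fromℕ e , t) else targetᵐ s) else sourceᵐ s

  resolveᵐ : List Segmentᶜ → ⟦ location-input ⟧ → Code
  resolveᵐ ss (inj₁ n) = vertexᵐ n
  resolveᵐ ss (inj₂ (e , t)) = foldr (λ s b → if does (edgeᵐ s ≟ fromℕ e) then locateᵐ e t s else b) (fromℕ e , t) ss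

  resolve≡ : ∀ {Γ} (ρ : Env Γ) ss l → eval resolveT ρ ss l ≡ resolveᵐ ss l
  resolve≡ {Γ} ρ ss (inj₁ n) = vertex≡ {nat ∷ location-input ∷ list segment-code ∷ Γ} (n ∷ inj₁ n ∷ ss ∷ ρ) n
  resolve≡ {Γ} ρ ss l@(inj₂ et@(e , t)) = trans (listrec≡ σ (pair (app fromNatT (fst v0)) (snd v0)) resolveStep v2 step)
      (cong (λ q → foldr f (q , t) ss) (fromNat≡ σ e))
    where
    σ : Env ((nat ⊗ real) ∷ location-input ∷ list segment-code ∷ Γ)
    σ = et ∷ l ∷ ss ∷ ρ
    f : Segmentᶜ → Code → Code
    f s b = if does (edgeᵐ s ≟ fromℕ e) then locateᵐ e t s else b
    step : ∀ b s xs → eval (resolveStep {location-input ∷ list segment-code ∷ Γ}) (b ∷ s ∷ xs ∷ σ) ≡ f s b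
    step b s xs = trans (if-bit τ (app (app eqRealT (edgeT v1)) (app fromNatT (fst v3))) locateT v0
        (trans (eqReal≡ τ (edgeᵐ s) (eval (app fromNatT (fst v3)) τ)) (cong (λ z → bit (does (edgeᵐ s ≟ z))) (fromNat≡ τ e))))
        (cong (λ z → if does (edgeᵐ s ≟ fromℕ e) then (if does (0# <? t) then (if does (t <? endᵐ s) then (z , t) else targetᵐ s) else sourceᵐ s) else b) (fromNat≡ τ e))
      where
      τ : Env (point-code ∷ segment-code ∷ list segment-code ∷ (nat ⊗ real) ∷ location-input ∷ list segment-code ∷ Γ)
      τ = b ∷ s ∷ xs ∷ σ

  divisorᵐ : List Segmentᶜ → List (⟦ location-input ⟧ × ℤ) → Divisorᶜ
  divisorᵐ ss = concatMap λ (l , c) → (resolveᵐ ss l , fromℤ c) ∷ []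

  divisor≡ : ∀ {Γ} (ρ : Env Γ) ss D → eval divisorT ρ ss D ≡ divisorᵐ ss D
  divisor≡ {Γ} ρ ss D = for≡ {Γ = list (location-input ⊗ int) ∷ list segment-code ∷ Γ} (D ∷ ss ∷ ρ) v0 divisorBody body
    where
    body : ∀ x → eval (divisorBody {Γ}) (x ∷ D ∷ ss ∷ ρ) ≡ (resolveᵐ ss (proj₁ x) , fromℤ (proj₂ x)) ∷ []
    body x = cong (_∷ []) (cong₂ _,_ (call₂ σ resolveT v2 (fst v0) (resolve≡ σ)) (fromInt≡ σ (proj₂ x)))
      where
      σ : Env ((location-input ⊗ int) ∷ list (location-input ⊗ int) ∷ list segment-code ∷ Γ)
      σ = x ∷ D ∷ ss ∷ ρ

  splitᵐ : Code → Segmentᶜ → List Segmentᶜ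
  splitᵐ q@(e , t) s = if does (edgeᵐ s ≟ e)
    then (if does (startᵐ s <? t)
      then (if does (t <? endᵐ s)
        then ((sourceᵐ s , q) , (edgeᵐ s , (startᵐ s , t))) ∷ ((q , targetᵐ s) , (edgeᵐ s , (t , endᵐ s))) ∷ []
        else s ∷ [])
      else s ∷ [])
    else s ∷ []

  split≡ : ∀ {Γ} (ρ : Env Γ) q s → eval splitT ρ q s ≡ splitᵐ q s
  split≡ {Γ} ρ q s = if-bit σ (app (app eqRealT (edgeT v0)) (fst v1)) cutT (one v0) (eqReal≡ σ (edgeᵐ s) (proj₁ q))
    where
    σ : Env (segment-code ∷ point-code ∷ Γ)
    σ = s ∷ q ∷ ρ

  refineᵐ : List Code → List Segmentᶜ → List Segmentᶜ
  refineᵐ qs ss = foldr (λ q → concatMap (splitᵐ q)) ss qs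

  refine≡ : ∀ {Γ} (ρ : Env Γ) qs ss → eval refineT ρ qs ss ≡ refineᵐ qs ss
  refine≡ {Γ} ρ qs ss = listrec≡ {list segment-code ∷ list point-code ∷ Γ} (ss ∷ qs ∷ ρ) v0 (for v0 refineBody) v1 step
    where
    step : ∀ b q xs → eval (for v0 refineBody) (_∷_ {x = list segment-code} b (_∷_ {x = point-code} q (_∷_ {x = list point-code} xs
      (_∷_ {x = list segment-code} ss (_∷_ {x = list point-code} qs ρ))))) ≡ concatMap (splitᵐ q) b
    step b q xs = for≡ σ v0 refineBody λ s →
        call₂ {segment-code ∷ list segment-code ∷ point-code ∷ list point-code ∷ list segment-code ∷ list point-code ∷ Γ} (s ∷ σ) splitT v2 v0
          (split≡ {segment-code ∷ list segment-code ∷ point-code ∷ list point-code ∷ list segment-code ∷ list point-code ∷ Γ} (s ∷ σ))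
      where
      σ : Env (list segment-code ∷ point-code ∷ list point-code ∷ list segment-code ∷ list point-code ∷ Γ)
      σ = b ∷ q ∷ xs ∷ ss ∷ qs ∷ ρ

  midpointsᵐ : List Segmentᶜ → List Code
  midpointsᵐ = concatMap λ s → (edgeᵐ s , (1# + 1#) ⁻¹ * endᵐ s) ∷ []

  midpoints≡ : ∀ {Γ} (ρ : Env Γ) ss → eval midpointsT ρ ss ≡ midpointsᵐ ss
  midpoints≡ {Γ} ρ ss = for≡ {Γ = list segment-code ∷ Γ} (ss ∷ ρ) v0 midpointBody λ s → refl

  supportᵐ : Divisorᶜ → List Code
  supportᵐ = concatMap λ x → proj₁ x ∷ []

  support≡ : ∀ {Γ} (ρ : Env Γ) F → eval supportT ρ F ≡ supportᵐ F
  support≡ {Γ} ρ F = for≡ {Γ = divisor-code ∷ Γ} (F ∷ ρ) v0 supportBody λ x → refl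

  endsᵐ : List Segmentᶜ → List Code
  endsᵐ = concatMap λ s → sourceᵐ s ∷ targetᵐ s ∷ []

  ends≡ : ∀ {Γ} (ρ : Env Γ) ss → eval endsT ρ ss ≡ endsᵐ ss
  ends≡ {Γ} ρ ss = for≡ {Γ = list segment-code ∷ Γ} (ss ∷ ρ) v0 endsBody λ s → refl

  verticesᵐ : ℕ → List Code
  verticesᵐ zero = []
  verticesᵐ (suc n) = vertexᵐ n ∷ verticesᵐ n

  vertices≡ : ∀ {Γ} (ρ : Env Γ) n → eval verticesT ρ n ≡ verticesᵐ n
  vertices≡ {Γ} ρ n = go n
    where
    σ : List Code → ℕ → Env (list point-code ∷ nat ∷ nat ∷ Γ)
    σ b k = b ∷ k ∷ n ∷ ρ
    rec : ℕ → List Code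
    rec = ℕ-rec [] (λ b k → eval (app vertexT v1) (σ b k) ∷ b)
    go : ∀ k → rec k ≡ verticesᵐ k
    go zero = refl
    go (suc k) = cong₂ _∷_ (vertex≡ (σ (rec k) k) k) (go k)

  tuplesᵐ : List Code → ℕ → List Divisorᶜ
  tuplesᵐ qs zero = [] ∷ []
  tuplesᵐ qs (suc n) = concatMap (λ q → concatMap (λ E → ((q , - 1#) ∷ E) ∷ []) (tuplesᵐ qs n)) qs

  tuples≡ : ∀ {Γ} (ρ : Env Γ) qs n → eval tuplesT ρ qs n ≡ tuplesᵐ qs n
  tuples≡ {Γ} ρ qs n = go n
    where
    rec : ℕ → List Divisorᶜ
    rec = ℕ-rec ([] ∷ []) (λ b k → eval (tuplesStep {Γ}) (b ∷ k ∷ n ∷ qs ∷ ρ))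
    go : ∀ k → rec k ≡ tuplesᵐ qs k
    go zero = refl
    go (suc k) = trans (for≡ σ v3 (for v1 tupleBody) (λ q → for≡ {Γ = point-code ∷ list divisor-code ∷ nat ∷ nat ∷ list point-code ∷ Γ} (q ∷ σ) v1 tupleBody (λ E → refl)))
      (cong (λ Es → concatMap (λ q → concatMap (λ E → ((q , - 1#) ∷ E) ∷ []) Es) qs) (go k))
      where
      σ : Env (list divisor-code ∷ nat ∷ nat ∷ list point-code ∷ Γ)
      σ = rec k ∷ k ∷ n ∷ qs ∷ ρ

  widenᵐ : List Carrier → List Carrier
  widenᵐ = concatMap λ c → c ∷ (c + 1#) ∷ (c + - 1#) ∷ []

  widenByᵐ : ℕ → List Carrier → List Carrier
  widenByᵐ zero cs = cs
  widenByᵐ (suc n) cs = widenᵐ (widenByᵐ n cs)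

  growᵐ : ℤ → List Carrier → List Carrier
  growᵐ (⁺ n) cs = widenByᵐ n cs
  growᵐ -[1+ _ ] cs = cs

  slopesᵐ : List (⟦ location-input ⟧ × ℤ) → List Carrier
  slopesᵐ = foldr (λ x → growᵐ (proj₂ x)) (0# ∷ [])

  slopes≡ : ∀ {Γ} (ρ : Env Γ) D → eval slopesT ρ D ≡ slopesᵐ D
  slopes≡ {Γ} ρ D = listrec≡ {list (location-input ⊗ int) ∷ Γ} (D ∷ ρ) (one 0r) slopesStep v0 step
    where
    step : ∀ b x xs → eval (slopesStep {list (location-input ⊗ int) ∷ list (location-input ⊗ int) ∷ Γ}) (b ∷ x ∷ xs ∷ D ∷ ρ) ≡ growᵐ (proj₂ x) b
    step b (l , -[1+ n ]) xs = refl
    step b x@(l , ⁺ n) xs = go n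
      where
      σ : List Carrier → ℕ → Env (list real ∷ nat ∷ nat ∷ list real ∷ (location-input ⊗ int) ∷ list (location-input ⊗ int) ∷ list (location-input ⊗ int) ∷ Γ)
      σ c j = c ∷ j ∷ n ∷ b ∷ x ∷ xs ∷ D ∷ ρ
      rec : ℕ → List Carrier
      rec = ℕ-rec b (λ c j → eval (for v0 widenBody) (σ c j))
      go : ∀ k → rec k ≡ widenByᵐ k b
      go zero = refl
      go (suc k) = trans (for≡ (σ (rec k) k) v0 widenBody (λ c → refl)) (cong widenᵐ (go k))

  decorateStepᵐ : List Carrier → Segmentᶜ → List (List Slopedᶜ) → List (List Slopedᶜ)
  decorateStepᵐ cs s = concatMap λ r → concatMap (λ a → concatMap (λ b → ((s , (a , b)) ∷ r) ∷ []) cs) cs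

  decorateᵐ : List Carrier → List Segmentᶜ → List (List Slopedᶜ)
  decorateᵐ cs = foldr (decorateStepᵐ cs) ([] ∷ [])

  decorate≡ : ∀ {Γ} (ρ : Env Γ) cs ss → eval decorateT ρ cs ss ≡ decorateᵐ cs ss
  decorate≡ {Γ} ρ cs ss = listrec≡ {list segment-code ∷ list real ∷ Γ} (ss ∷ cs ∷ ρ) (one nil) decorateStep v0 step
    where
    step : ∀ acc s xs → eval (decorateStep {Γ}) (acc ∷ s ∷ xs ∷ ss ∷ cs ∷ ρ) ≡ decorateStepᵐ cs s acc
    step acc s xs = for≡ σ v0 (for v5 (for v6 decorateBody)) λ r → for≡ (σ₁ r) v5 (for v6 decorateBody) λ a → for≡ (σ₂ r a) v6 decorateBody λ b → refl
      where
      σ : Env (list (list slope-code) ∷ segment-code ∷ list segment-code ∷ list segment-code ∷ list real ∷ Γ)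
      σ = acc ∷ s ∷ xs ∷ ss ∷ cs ∷ ρ
      σ₁ : List Slopedᶜ → Env (list slope-code ∷ list (list slope-code) ∷ segment-code ∷ list segment-code ∷ list segment-code ∷ list real ∷ Γ)
      σ₁ r = r ∷ acc ∷ s ∷ xs ∷ ss ∷ cs ∷ ρ
      σ₂ : List Slopedᶜ → Carrier → Env (real ∷ list slope-code ∷ list (list slope-code) ∷ segment-code ∷ list segment-code ∷ list segment-code ∷ list real ∷ Γ)
      σ₂ r a = a ∷ r ∷ acc ∷ s ∷ xs ∷ ss ∷ cs ∷ ρ

  divᵐ : List Slopedᶜ → Divisorᶜ
  divᵐ = concatMap λ (s , (m , n)) → (sourceᵐ s , m) ∷ (targetᵐ s , n) ∷ []

  div≡ : ∀ {Γ} (ρ : Env Γ) r → eval divT ρ r ≡ divᵐ r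
  div≡ {Γ} ρ r = for≡ {Γ = list slope-code ∷ Γ} (r ∷ ρ) v0 divBody λ x → refl

  coeffᵐ : Divisorᶜ → Code → Carrier
  coeffᵐ F q = foldr (λ (p , c) b → if does (p ≟C q) then c + b else b) 0# F

  coeff≡ : ∀ {Γ} (ρ : Env Γ) F q → eval coeffT ρ F q ≡ coeffᵐ F q
  coeff≡ {Γ} ρ F q = listrec≡ {point-code ∷ divisor-code ∷ Γ} (q ∷ F ∷ ρ) 0r coeffStep v1 λ b x xs →
      if-bit (σ b x xs) (app (app eqT (fst v1)) v3) (add (snd v1) v0) v0 (eq≡ (σ b x xs) (proj₁ x) q)
    where
    σ : Carrier → Code × Carrier → Divisorᶜ → Env (real ∷ (point-code ⊗ real) ∷ divisor-code ∷ point-code ∷ divisor-code ∷ Γ)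
    σ b x xs = b ∷ x ∷ xs ∷ q ∷ F ∷ ρ

  effectiveᵐ : Divisorᶜ → Bool
  effectiveᵐ F = every (λ x → not (does (coeffᵐ F (proj₁ x) <? 0#))) F

  not-bit : ∀ d → (if d then 0# else 1#) ≡ bit (not d)
  not-bit true  = refl
  not-bit false = refl

  effective≡ : ∀ {Γ} (ρ : Env Γ) F → eval effectiveT ρ F ≡ bit (effectiveᵐ F)
  effective≡ {Γ} ρ F = all≡ {Γ = divisor-code ∷ Γ} (F ∷ ρ) (lam effectiveBody) v0 λ x →
      trans (cong (λ c → if does (c <? 0#) then 0# else 1#) (call₂ (σ x) coeffT v1 (fst v0) (coeff≡ (σ x)))) (not-bit _)
    where
    σ : Code × Carrier → Env ((point-code ⊗ real) ∷ divisor-code ∷ Γ)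
    σ x = x ∷ F ∷ ρ

  constraintsᵐ : List Slopedᶜ → List Constraint
  constraintsᵐ = concatMap λ (s , (m , n)) →
    (targetᵐ s , (sourceᵐ s , m * (endᵐ s - startᵐ s))) ∷ (sourceᵐ s , (targetᵐ s , n * (endᵐ s - startᵐ s))) ∷ []

  constraints≡ : ∀ {Γ} (ρ : Env Γ) r → eval constraintsT ρ r ≡ constraintsᵐ r
  constraints≡ {Γ} ρ r = for≡ {Γ = list slope-code ∷ Γ} (r ∷ ρ) v0 constraintsBody λ x → refl

  -- From x w + c ≤ x v and x u′ + c′ ≤ x w the value at `w` is eliminated by addition.
  combineᵐ : Code → Constraint → Constraint → List Constraint
  combineᵐ w (v , _ , c) (v′ , u′ , c′) =
    if does (v′ ≟C w) then (if does (u′ ≟C w) then [] else (v , u′ , c + c′) ∷ []) else []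

  -- A constraint with equal ends is kept even if its ends are `w`: it restricts its constant alone,
  -- and such constraints carry the final verdict. Lower bounds on `w` disappear here because each
  -- of them is combined with every upper bound.
  eliminate₁ᵐ : Code → List Constraint → Constraint → List Constraint
  eliminate₁ᵐ w cs k@(v , u , c) =
    if does (v ≟C u) then k ∷ [] else
    if does (v ≟C w) then [] else
    if does (u ≟C w) then concatMap (combineᵐ w k) cs else k ∷ []

  eliminateᵐ : Code → List Constraint → List Constraint
  eliminateᵐ w cs = concatMap (eliminate₁ᵐ w cs) cs

  eliminate≡ : ∀ {Γ} (ρ : Env Γ) w cs → eval eliminateT ρ w cs ≡ eliminateᵐ w cs
  eliminate≡ {Γ} ρ w cs = for≡ {Γ = list constraint-code ∷ point-code ∷ Γ} (cs ∷ w ∷ ρ) v0 eliminateBody body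
    where
    body : ∀ k → eval (eliminateBody {Γ}) (k ∷ cs ∷ w ∷ ρ) ≡ eliminate₁ᵐ w cs k
    body k@(v , u , c) = trans (if-bit σ (app (app eqT (fst v0)) (fst (snd v0))) (one v0) lowerT (eq≡ σ v u)) (cong (λ z → if does (v ≟C u) then k ∷ [] else z)
      (trans (if-bit σ (app (app eqT (fst v0)) v2) nil upperT (eq≡ σ v w)) (cong (λ z → if does (v ≟C w) then [] else z)
        (trans (if-bit σ (app (app eqT (fst (snd v0))) v2) (for v1 combineBody) (one v0) (eq≡ σ u w)) (cong (λ z → if does (u ≟C w) then z else k ∷ [])
          (for≡ σ v1 combineBody inner))))))
      where
      σ : Env (constraint-code ∷ list constraint-code ∷ point-code ∷ Γ)
      σ = k ∷ cs ∷ w ∷ ρ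
      inner : ∀ k₂ → eval (combineBody {Γ}) (k₂ ∷ σ) ≡ combineᵐ w k k₂
      inner k₂@(v′ , u′ , c′) = trans (if-bit τ (app (app eqT (fst v0)) v3) combinedT nil (eq≡ τ v′ w)) (cong (λ z → if does (v′ ≟C w) then z else [])
          (if-bit τ (app (app eqT (fst (snd v0))) v3) nil (one (pair (fst v1) (pair (fst (snd v0)) (add (snd (snd v1)) (snd (snd v0)))))) (eq≡ τ u′ w)))
        where
        τ : Env (constraint-code ∷ constraint-code ∷ list constraint-code ∷ point-code ∷ Γ)
        τ = k₂ ∷ σ

  eliminateAllᵐ : List Code → List Constraint → List Constraint
  eliminateAllᵐ ps cs = foldr eliminateᵐ cs ps

  eliminateAll≡ : ∀ {Γ} (ρ : Env Γ) ps cs → eval eliminateAllT ρ ps cs ≡ eliminateAllᵐ ps cs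
  eliminateAll≡ {Γ} ρ ps cs = listrec≡ {list constraint-code ∷ list point-code ∷ Γ} (cs ∷ ps ∷ ρ) v0 (app (app eliminateT v1) v0) v1 λ b p xs →
      call₂ (σ b p xs) eliminateT v1 v0 (eliminate≡ (σ b p xs))
    where
    σ : List Constraint → Code → List Code → Env (list constraint-code ∷ point-code ∷ list point-code ∷ list constraint-code ∷ list point-code ∷ Γ)
    σ b p xs = b ∷ p ∷ xs ∷ cs ∷ ps ∷ ρ

  satisfiableᵐ : List Code → List Constraint → Bool
  satisfiableᵐ ps cs = every (λ (_ , _ , c) → not (does (0# <? c))) (eliminateAllᵐ ps cs)

  satisfiable≡ : ∀ {Γ} (ρ : Env Γ) ps cs → eval satisfiableT ρ ps cs ≡ bit (satisfiableᵐ ps cs)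
  satisfiable≡ {Γ} ρ ps cs = trans (all≡ σ (lam satisfiableBody) (app (app eliminateAllT v1) v0) (λ _ → not-bit _))
      (cong (λ ks → bit (every (λ (_ , _ , c) → not (does (0# <? c))) ks)) (call₂ σ eliminateAllT v1 v0 (eliminateAll≡ σ)))
    where
    σ : Env (list constraint-code ∷ list point-code ∷ Γ)
    σ = cs ∷ ps ∷ ρ

  checkᵐ : List Segmentᶜ → Divisorᶜ → List Slopedᶜ → Bool
  checkᵐ ss F r = effectiveᵐ (F ++ divᵐ r) ∧ satisfiableᵐ (endsᵐ ss) (constraintsᵐ r)

  check≡ : ∀ {Γ} (ρ : Env Γ) ss F r → eval checkT ρ ss F r ≡ bit (checkᵐ ss F r)
  check≡ {Γ} ρ ss F r = trans (if-bit σ (app effectiveT totalT) (app (app satisfiableT (app endsT v2)) (app constraintsT v0)) 0r eff)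
      (both (effectiveᵐ (F ++ divᵐ r)) sat)
    where
    σ : Env (list slope-code ∷ divisor-code ∷ list segment-code ∷ Γ)
    σ = r ∷ F ∷ ss ∷ ρ
    eff : eval (app effectiveT totalT) σ ≡ bit (effectiveᵐ (F ++ divᵐ r))
    eff = trans (call₁ σ effectiveT totalT (effective≡ σ))
      (cong (λ E → bit (effectiveᵐ E)) (trans (call₂ σ appendT v1 (app divT v0) (append≡ {point-code ⊗ real} σ)) (cong (F ++_) (call₁ σ divT v0 (div≡ σ)))))
    sat : eval (app (app satisfiableT (app endsT v2)) (app constraintsT v0)) σ ≡ bit (satisfiableᵐ (endsᵐ ss) (constraintsᵐ r))
    sat = trans (call₂ σ satisfiableT (app endsT v2) (app constraintsT v0) (satisfiable≡ σ))
      (cong₂ (λ ps cs → bit (satisfiableᵐ ps cs)) (call₁ σ endsT v2 (ends≡ σ)) (call₁ σ constraintsT v0 (constraints≡ σ)))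
    both : ∀ c {b d} → b ≡ bit d → (if c then b else 0#) ≡ bit (c ∧ d)
    both true  e = e
    both false e = refl

  feasibleᵐ : List Carrier → List Segmentᶜ → Divisorᶜ → Bool
  feasibleᵐ cs ss F = some (checkᵐ ss F) (decorateᵐ cs ss)

  feasible≡ : ∀ {Γ} (ρ : Env Γ) cs ss F → eval feasibleT ρ cs ss F ≡ bit (feasibleᵐ cs ss F)
  feasible≡ {Γ} ρ cs ss F = trans (any≡ σ (app (app checkT v1) v0) (app (app decorateT v2) v1) (λ r → call₂′ r))
    (cong (λ rs → bit (some (checkᵐ ss F) rs)) (call₂ σ decorateT v2 v1 (decorate≡ σ)))
    where
    σ : Env (divisor-code ∷ list segment-code ∷ list real ∷ Γ)
    σ = F ∷ ss ∷ cs ∷ ρ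
    call₂′ : ∀ r → eval (app (app checkT v1) v0) σ r ≡ bit (checkᵐ ss F r)
    call₂′ r = check≡ σ (eval v1 σ) (eval v0 σ) r

  modelᵐ : List Segmentᶜ → Divisorᶜ → List Segmentᶜ
  modelᵐ ss F = refineᵐ (midpointsᵐ ss ++ supportᵐ F) ss

  model≡ : ∀ {Γ} (ρ : Env Γ) ss F → eval modelT ρ ss F ≡ modelᵐ ss F
  model≡ {Γ} ρ ss F = trans (call₂ σ refineT (app (app appendT (app midpointsT v1)) (app supportT v0)) v1 (refine≡ σ))
    (cong (λ qs → refineᵐ qs ss) (trans (call₂ σ appendT (app midpointsT v1) (app supportT v0) (append≡ {point-code} σ))
      (cong₂ _++_ (call₁ σ midpointsT v1 (midpoints≡ σ)) (call₁ σ supportT v0 (support≡ σ)))))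
    where
    σ : Env (divisor-code ∷ list segment-code ∷ Γ)
    σ = F ∷ ss ∷ ρ

  everywhereᵐ : List Carrier → List Segmentᶜ → List Code → Divisorᶜ → ℕ → Bool
  everywhereᵐ cs ss qs F n = every (λ E → feasibleᵐ cs ss (E ++ F)) (tuplesᵐ qs n)

  everywhere≡ : ∀ {Γ} (ρ : Env Γ) cs ss qs F n → eval everywhereT ρ cs ss qs F n ≡ bit (everywhereᵐ cs ss qs F n)
  everywhere≡ {Γ} ρ cs ss qs F n = trans (all≡ σ (lam everywhereBody) (app (app tuplesT v2) v0) body)
      (cong (λ Es → bit (every (λ E → feasibleᵐ cs ss (E ++ F)) Es)) (call₂ σ tuplesT v2 v0 (tuples≡ σ)))
    where
    σ : Env (nat ∷ divisor-code ∷ list point-code ∷ list segment-code ∷ list real ∷ Γ)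
    σ = n ∷ F ∷ qs ∷ ss ∷ cs ∷ ρ
    τ : Divisorᶜ → Env (divisor-code ∷ nat ∷ divisor-code ∷ list point-code ∷ list segment-code ∷ list real ∷ Γ)
    τ E = E ∷ σ
    body : ∀ E → eval everywhereBody (τ E) ≡ bit (feasibleᵐ cs ss (E ++ F))
    body E = trans (call₃ (τ E) feasibleT v5 v4 (app (app appendT v0) v2) (feasible≡ (τ E)))
      (cong (λ F′ → bit (feasibleᵐ cs ss F′)) (call₂ (τ E) appendT v0 v2 (append≡ {point-code ⊗ real} (τ E))))

  predᵐ : ℕ → ℤ
  predᵐ zero = -[1+ 0 ]
  predᵐ (suc n) = ⁺ n

  pred≡ : ∀ {Γ} (ρ : Env Γ) n → eval predT ρ n ≡ predᵐ n
  pred≡ ρ zero = refl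
  pred≡ ρ (suc n) = refl

  prepareᵐ : ⟦ InputType ⟧ → ⟦ Prepared ⟧
  prepareᵐ (n , es , D) = slopesᵐ D , M , (verticesᵐ n ++ endsᵐ M) , F
    where
    base = baseᵐ es 0
    F    = divisorᵐ base D
    M    = modelᵐ base F

  let₃ : ∀ {Γ I B F M O} (ρ : Env Γ) (X : Term (M ∷ F ∷ B ∷ I ∷ Γ) O) (m : Term (F ∷ B ∷ I ∷ Γ) M) (f : Term (B ∷ I ∷ Γ) F) (b : Term (I ∷ Γ) B)
    (i : ⟦ I ⟧) {b′ : ⟦ B ⟧} {f′ : ⟦ F ⟧} {m′ : ⟦ M ⟧} {o : ⟦ O ⟧} →
    eval b (i ∷ ρ) ≡ b′ → eval f (b′ ∷ i ∷ ρ) ≡ f′ → eval m (f′ ∷ b′ ∷ i ∷ ρ) ≡ m′ → eval X (m′ ∷ f′ ∷ b′ ∷ i ∷ ρ) ≡ o →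
    eval (lam (app (lam (app (lam (app (lam X) m)) f)) b)) ρ i ≡ o
  let₃ ρ X m f b i refl refl refl refl = refl

  prepare≡ : ∀ {Γ} (ρ : Env Γ) i → eval prepareT ρ i ≡ prepareᵐ i
  prepare≡ {Γ} ρ i@(n , es , D) = let₃ ρ assembleT (app (app modelT v1) v0) (app (app divisorT v0) (snd (snd v1))) (app (app baseT (fst (snd v0))) zero) i
      (call₂ σ baseT (fst (snd v0)) zero (base≡ σ)) (F≡ (baseᵐ es 0))
      (M≡ (baseᵐ es 0) (divisorᵐ (baseᵐ es 0) D))
      (assemble≡ (modelᵐ (baseᵐ es 0) (divisorᵐ (baseᵐ es 0) D)) (divisorᵐ (baseᵐ es 0) D) (baseᵐ es 0))
    where
    σ : Env (InputType ∷ Γ)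
    σ = i ∷ ρ
    F≡ : ∀ b → eval (app (app divisorT v0) (snd (snd v1))) (_∷_ {x = list segment-code} b (_∷_ {x = InputType} i ρ)) ≡ divisorᵐ b D
    F≡ b = call₂ {list segment-code ∷ InputType ∷ Γ} (b ∷ i ∷ ρ) divisorT v0 (snd (snd v1)) (divisor≡ {list segment-code ∷ InputType ∷ Γ} (b ∷ i ∷ ρ))
    M≡ : ∀ b F → eval (app (app modelT v1) v0) (_∷_ {x = divisor-code} F (_∷_ {x = list segment-code} b (_∷_ {x = InputType} i ρ))) ≡ modelᵐ b F
    M≡ b F = call₂ {divisor-code ∷ list segment-code ∷ InputType ∷ Γ} (F ∷ b ∷ i ∷ ρ) modelT v1 v0 (model≡ {divisor-code ∷ list segment-code ∷ InputType ∷ Γ} (F ∷ b ∷ i ∷ ρ))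
    assemble≡ : ∀ M F b → eval (assembleT {Γ}) (M ∷ F ∷ b ∷ i ∷ ρ) ≡ (slopesᵐ D , M , (verticesᵐ n ++ endsᵐ M) , F)
    assemble≡ M F b = cong₂ (λ cs qs → cs , M , qs , F) (call₁ τ slopesT (snd (snd v3)) (slopes≡ τ))
        (trans (call₂ τ appendT (app verticesT (fst v3)) (app endsT v0) (append≡ {point-code} τ))
          (cong₂ _++_ (call₁ τ verticesT (fst v3) (vertices≡ τ)) (call₁ τ endsT v0 (ends≡ τ))))
      where
      τ : Env (list segment-code ∷ divisor-code ∷ list segment-code ∷ InputType ∷ Γ)
      τ = M ∷ F ∷ b ∷ i ∷ ρ

  call₅ : ∀ {Γ A B C D E O} (ρ : Env Γ) (X : Term Γ (A ⇒ B ⇒ C ⇒ D ⇒ E ⇒ O)) a b c d e {f : ⟦ A ⟧ → ⟦ B ⟧ → ⟦ C ⟧ → ⟦ D ⟧ → ⟦ E ⟧ → ⟦ O ⟧} →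
    (∀ a b c d e → eval X ρ a b c d e ≡ f a b c d e) →
    eval (app (app (app (app (app X a) b) c) d) e) ρ ≡ f (eval a ρ) (eval b ρ) (eval c ρ) (eval d ρ) (eval e ρ)
  call₅ ρ X a b c d e h = h _ _ _ _ _

  continueᵐ : ⟦ Prepared ⟧ → ℕ → Bool
  continueᵐ (cs , ss , qs , F) = everywhereᵐ cs ss qs F

  step≡ : ∀ st k → eval stepT (_∷_ {x = Prepared ⊗ nat} (st , k) []) ≡ (if continueᵐ st k then inj₁ (st , suc k) else inj₂ (predᵐ k))
  step≡ st k = trans (if-bit σ continueT (inl (pair (fst v0) (suc (snd v0)))) (inr (app predT (snd v0)))
      (call₅ σ everywhereT (fst (fst v0)) (fst (snd (fst v0))) (fst (snd (snd (fst v0)))) (snd (snd (snd (fst v0)))) (snd v0) (everywhere≡ σ)))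
      (cong (λ r → if continueᵐ st k then inj₁ (st , suc k) else inj₂ r) (call₁ σ predT (snd v0) (pred≡ σ)))
    where
    σ : Env (Prepared ⊗ nat ∷ [])
    σ = (st , k) ∷ []

  start≡ : ∀ i → eval initialT (_∷_ {x = InputType} i []) ≡ (prepareᵐ i , 0)
  start≡ i = cong (_, 0) (call₁ {InputType ∷ []} (i ∷ []) prepareT v0 (prepare≡ {InputType ∷ []} (i ∷ [])))

  module _ {S I O : Type} (start : Term (I ∷ []) S) (step : Term (S ∷ []) (S ⊕ O)) where

    halt′ : ∀ {s o} → eval step (s ∷ []) ≡ inj₂ o → Semantics.Reaches R (program start step) s o
    halt′ = Semantics.halt

    next′ : ∀ {s s′ o} → eval step (s ∷ []) ≡ inj₁ s′ → Semantics.Reaches R (program start step) s′ o → Semantics.Reaches R (program start step) s o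
    next′ = Semantics.next

    computes′ : ∀ {i s o} → eval start (i ∷ []) ≡ s → Semantics.Reaches R (program start step) s o → Semantics.Computes R (program start step) i o
    computes′ refl r = r

-- Correctness of Fourier-Motzkin elimination.

module Elimination (R : RealField) where
  open Field R
  open Mirror R

  infix 1 _⇔ᵇ_
  record _⇔ᵇ_ (b : Bool) (P : Set) : Set where
    constructor iff
    field
      sound    : b ≡ true → P
      complete : P → b ≡ true
  open _⇔ᵇ_ public

  ≮-⇔ : ∀ x y → not (does (x <? y)) ⇔ᵇ y ≤ x
  ≮-⇔ x y with x <? y
  ... | yes p = iff (λ ()) (λ q → ⊥-elim (<⇒≱ p q))
  ... | no p  = iff (λ _ → ≮⇒≥ p) (λ _ → refl)

  ∧-⇔ : ∀ {a b P Q} → a ⇔ᵇ P → b ⇔ᵇ Q → a ∧ b ⇔ᵇ P × Q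
  ∧-⇔ {true}  p q = iff (λ h → sound p refl , sound q h) (λ (_ , y) → complete q y)
  ∧-⇔ {false} p q = iff (λ ()) (λ (x , _) → complete p x)

  every-⇔ : ∀ {A : Set} {p : A → Bool} {P : A → Set} → (∀ x → p x ⇔ᵇ P x) → ∀ xs → every p xs ⇔ᵇ (∀ {x} → x ∈ xs → P x)
  every-⇔ {A} {p} {P} h xs = iff (to xs) (from xs)
    where
    to : ∀ xs → every p xs ≡ true → ∀ {x} → x ∈ xs → P x
    to (x ∷ xs) e i with p x in eq
    to (x ∷ xs) e (here refl) | true = sound (h x) eq
    to (x ∷ xs) e (there i)   | true = to xs e i
    from : ∀ xs → (∀ {x} → x ∈ xs → P x) → every p xs ≡ true
    from [] k = refl
    from (x ∷ xs) k rewrite complete (h x) (k (here refl)) = from xs (k ∘ there)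

  every-false : ∀ {A : Set} (p : A → Bool) xs → every p xs ≡ false → ∃ λ x → x ∈ xs × p x ≡ false
  every-false p (x ∷ xs) e with p x in eq
  ... | false = x , here refl , eq
  ... | true with every-false p xs e
  ...   | y , i , e′ = y , there i , e′

  some-sound : ∀ {A : Set} (p : A → Bool) xs → some p xs ≡ true → ∃ λ x → x ∈ xs × p x ≡ true
  some-sound p (x ∷ xs) e with p x in eq
  ... | true = x , here refl , eq
  ... | false with some-sound p xs e
  ...   | y , i , e′ = y , there i , e′

  some-complete : ∀ {A : Set} (p : A → Bool) xs {x} → x ∈ xs → p x ≡ true → some p xs ≡ true
  some-complete p (x ∷ xs) (here refl) e rewrite e = refl
  some-complete p (x ∷ xs) (there i) e with p x
  ... | true  = refl
  ... | false = some-complete p xs i e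

  concatMap-∈⁻ : ∀ {X Y : Set} (f : X → List Y) xs {y} → y ∈ concatMap f xs → ∃ λ x → x ∈ xs × y ∈ f x
  concatMap-∈⁻ f (x ∷ xs) i with ∈ₚ.∈-++⁻ (f x) i
  ... | inj₁ j = x , here refl , j
  ... | inj₂ j with concatMap-∈⁻ f xs j
  ...   | x′ , k , l = x′ , there k , l

  concatMap-∈⁺ : ∀ {X Y : Set} (f : X → List Y) xs {x y} → x ∈ xs → y ∈ f x → y ∈ concatMap f xs
  concatMap-∈⁺ f (x ∷ xs) (here refl) j = ∈ₚ.∈-++⁺ˡ j
  concatMap-∈⁺ f (x ∷ xs) (there i) j = ∈ₚ.∈-++⁺ʳ (f x) (concatMap-∈⁺ f xs i j)

  Satisfies : (Code → Carrier) → Constraint → Set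
  Satisfies x (v , u , c) = x u + c ≤ x v

  Solves : (Code → Carrier) → List Constraint → Set
  Solves x cs = ∀ {k} → k ∈ cs → Satisfies x k

  -- `lower` and `upper` name the kind of bound that the constraint puts on the value at `w`; the
  -- cases follow the order of the tests in `eliminate₁ᵐ`.
  data Role (w : Code) : Constraint → Set where
    loop  : ∀ {v c} → Role w (v , v , c)
    lower : ∀ {u c} → u ≢ w → Role w (w , u , c)
    upper : ∀ {v c} → v ≢ w → Role w (v , w , c)
    other : ∀ {v u c} → v ≢ u → v ≢ w → u ≢ w → Role w (v , u , c)

  role : ∀ w k → Role w k
  role w (v , u , c) with v ≟C u
  ... | yes refl = loop
  ... | no v≢u with v ≟C w
  ...   | yes refl = lower (λ e → v≢u (sym e))
  ...   | no v≢w with u ≟C w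
  ...     | yes refl = upper v≢w
  ...     | no u≢w = other v≢u v≢w u≢w

  module _ (w : Code) (cs : List Constraint) where

    private
      if-yes : ∀ {A : Set} p q {t u : A} → p ≡ q → (if does (p ≟C q) then t else u) ≡ t
      if-yes p q e rewrite dec-true (p ≟C q) e = refl

      if-no : ∀ {A : Set} p q {t u : A} → p ≢ q → (if does (p ≟C q) then t else u) ≡ u
      if-no p q n rewrite dec-false (p ≟C q) n = refl

      loop≡ : ∀ v c → eliminate₁ᵐ w cs (v , v , c) ≡ (v , v , c) ∷ []
      loop≡ v c = if-yes v v refl

      lower≡ : ∀ u c → u ≢ w → eliminate₁ᵐ w cs (w , u , c) ≡ []
      lower≡ u c u≢w = trans (if-no w u (u≢w ∘ sym)) (if-yes w w refl)

      upper≡ : ∀ v c → v ≢ w → eliminate₁ᵐ w cs (v , w , c) ≡ concatMap (combineᵐ w (v , w , c)) cs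
      upper≡ v c v≢w = trans (if-no v w v≢w) (trans (if-no v w v≢w) (if-yes w w refl))

      other≡ : ∀ v u c → v ≢ u → v ≢ w → u ≢ w → eliminate₁ᵐ w cs (v , u , c) ≡ (v , u , c) ∷ []
      other≡ v u c v≢u v≢w u≢w = trans (if-no v u v≢u) (trans (if-no v w v≢w) (if-no u w u≢w))

      combine-∈⁻ : ∀ v c k k′ → k′ ∈ combineᵐ w (v , w , c) k → ∃ λ u → ∃ λ c′ → k ≡ (w , u , c′) × u ≢ w × k′ ≡ (v , u , c + c′)
      combine-∈⁻ v c (v′ , u′ , c′) k′ i = go (v′ ≟C w) (u′ ≟C w) i
        where
        go : (d : Dec (v′ ≡ w)) (d′ : Dec (u′ ≡ w)) → k′ ∈ (if does d then (if does d′ then [] else (v , u′ , c + c′) ∷ []) else []) →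
          ∃ λ u → ∃ λ c″ → (v′ , u′ , c′) ≡ (w , u , c″) × u ≢ w × k′ ≡ (v , u , c + c″)
        go (yes refl) (no u′≢w) (here refl) = u′ , c′ , refl , u′≢w , refl

    data Eliminated (k′ : Constraint) : Set where
      kept     : k′ ∈ cs → (proj₁ k′ ≡ proj₁ (proj₂ k′)) ⊎ (proj₁ k′ ≢ w × proj₁ (proj₂ k′) ≢ w) → Eliminated k′
      combined : ∀ {v c u c′} → (v , w , c) ∈ cs → v ≢ w → (w , u , c′) ∈ cs → u ≢ w → k′ ≡ (v , u , c + c′) → Eliminated k′

    eliminate-∈⁻ : ∀ {k′} → k′ ∈ eliminateᵐ w cs → Eliminated k′
    eliminate-∈⁻ {k′} i with concatMap-∈⁻ (eliminate₁ᵐ w cs) cs i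
    ... | k , j , l = go (role w k) j l
      where
      go : ∀ {k} → Role w k → k ∈ cs → k′ ∈ eliminate₁ᵐ w cs k → Eliminated k′
      go (loop {v} {c}) j l with subst (k′ ∈_) (loop≡ v c) l
      ... | here refl = kept j (inj₁ refl)
      go (lower {u} {c} u≢w) j l with subst (k′ ∈_) (lower≡ u c u≢w) l
      ... | ()
      go (other {v} {u} {c} v≢u v≢w u≢w) j l with subst (k′ ∈_) (other≡ v u c v≢u v≢w u≢w) l
      ... | here refl = kept j (inj₂ (v≢w , u≢w))
      go (upper {v} {c} v≢w) j l with concatMap-∈⁻ (combineᵐ w (v , w , c)) cs (subst (k′ ∈_) (upper≡ v c v≢w) l)
      ... | k₂ , j₂ , l₂ with combine-∈⁻ v c k₂ k′ l₂
      ...   | u , c′ , refl , u≢w , e = combined j v≢w j₂ u≢w e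

    kept-∈⁺ : ∀ {v u c} → (v , u , c) ∈ cs → v ≡ u ⊎ (v ≢ w × u ≢ w) → (v , u , c) ∈ eliminateᵐ w cs
    kept-∈⁺ {v} {u} {c} i h = concatMap-∈⁺ (eliminate₁ᵐ w cs) cs i (subst ((v , u , c) ∈_) (sym (stays h (v ≟C u))) (here refl))
      where
      stays : v ≡ u ⊎ (v ≢ w × u ≢ w) → Dec (v ≡ u) → eliminate₁ᵐ w cs (v , u , c) ≡ (v , u , c) ∷ []
      stays _ (yes refl) = loop≡ v c
      stays (inj₁ v≡u) (no v≢u) = ⊥-elim (v≢u v≡u)
      stays (inj₂ (v≢w , u≢w)) (no v≢u) = other≡ v u c v≢u v≢w u≢w

    combined-∈⁺ : ∀ {v c u c′} → (v , w , c) ∈ cs → v ≢ w → (w , u , c′) ∈ cs → u ≢ w → (v , u , c + c′) ∈ eliminateᵐ w cs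
    combined-∈⁺ {v} {c} {u} {c′} i v≢w j u≢w = concatMap-∈⁺ (eliminate₁ᵐ w cs) cs i
      (subst (_ ∈_) (sym (upper≡ v c v≢w)) (concatMap-∈⁺ (combineᵐ w (v , w , c)) cs j
        (subst (_ ∈_) (sym (trans (if-yes w w refl) (if-no u w u≢w))) (here refl))))

  -- Starting from 0, the value is first pushed below all upper bounds and then raised to each lower
  -- bound that exceeds it. Compatibility keeps a lower bound reached in this way below the upper
  -- bounds.
  between : ∀ los his → (∀ {l h} → l ∈ los → h ∈ his → l ≤ h) → ∃ λ m → (∀ {l} → l ∈ los → l ≤ m) × (∀ {h} → h ∈ his → m ≤ h)
  between [] [] c = 0# , (λ ()) , λ ()
  between [] (h ∷ his) c with between [] his (λ ())
  ... | m , _ , below with ≤-total m h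
  ...   | inj₁ m≤h = m , (λ ()) , λ { (here refl) → m≤h ; (there i) → below i }
  ...   | inj₂ h≤m = h , (λ ()) , λ { (here refl) → ≤-refl ; (there i) → ≤-trans h≤m (below i) }
  between (l ∷ los) his c with between los his (c ∘ there)
  ... | m , above , below with ≤-total m l
  ...   | inj₁ m≤l = l , (λ { (here refl) → ≤-refl ; (there i) → ≤-trans (above i) m≤l }) , c (here refl)
  ...   | inj₂ l≤m = m , (λ { (here refl) → l≤m ; (there i) → above i }) , below

  module _ (w : Code) (x : Code → Carrier) where

    lower-bound upper-bound : Constraint → List Carrier
    lower-bound (v , u , c) with v ≟C w | u ≟C w
    ... | yes _ | no _ = (x u + c) ∷ []
    ... | _     | _    = []
    upper-bound (v , u , c) with v ≟C w | u ≟C w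
    ... | no _ | yes _ = (x v - c) ∷ []
    ... | _    | _     = []

    lower-bound⁻ : ∀ k {l} → l ∈ lower-bound k → ∃ λ u → ∃ λ c → k ≡ (w , u , c) × u ≢ w × l ≡ x u + c
    lower-bound⁻ (v , u , c) i with v ≟C w | u ≟C w
    lower-bound⁻ (v , u , c) (here refl) | yes refl | no u≢w = u , c , refl , u≢w , refl
    lower-bound⁻ (v , u , c) () | yes _ | yes _
    lower-bound⁻ (v , u , c) () | no _ | yes _
    lower-bound⁻ (v , u , c) () | no _ | no _

    upper-bound⁻ : ∀ k {h} → h ∈ upper-bound k → ∃ λ v → ∃ λ c → k ≡ (v , w , c) × v ≢ w × h ≡ x v - c
    upper-bound⁻ (v , u , c) i with v ≟C w | u ≟C w
    upper-bound⁻ (v , u , c) (here refl) | no v≢w | yes refl = v , c , refl , v≢w , refl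
    upper-bound⁻ (v , u , c) () | yes _ | yes _
    upper-bound⁻ (v , u , c) () | yes _ | no _
    upper-bound⁻ (v , u , c) () | no _ | no _

    lower-bound⁺ : ∀ u c → u ≢ w → x u + c ∈ lower-bound (w , u , c)
    lower-bound⁺ u c u≢w with w ≟C w | u ≟C w
    ... | yes _ | no _ = here refl
    ... | no n  | _ = ⊥-elim (n refl)
    ... | _ | yes e = ⊥-elim (u≢w e)

    upper-bound⁺ : ∀ v c → v ≢ w → x v - c ∈ upper-bound (v , w , c)
    upper-bound⁺ v c v≢w with v ≟C w | w ≟C w
    ... | no _ | yes _ = here refl
    ... | yes e | _ = ⊥-elim (v≢w e)
    ... | _ | no n = ⊥-elim (n refl)

    -- The value at `w` is placed between its lower and its upper bounds; that each lower bound is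
    -- at most each upper one is what the combined constraints express.
    eliminate-sound : ∀ cs → Solves x (eliminateᵐ w cs) → ∃ λ y → Solves y cs
    eliminate-sound cs sol with between (concatMap lower-bound cs) (concatMap upper-bound cs) compatible
      where
      compatible : ∀ {l h} → l ∈ concatMap lower-bound cs → h ∈ concatMap upper-bound cs → l ≤ h
      compatible i j with concatMap-∈⁻ lower-bound cs i | concatMap-∈⁻ upper-bound cs j
      ... | k , i′ , l∈ | k₂ , j′ , h∈ with lower-bound⁻ k l∈ | upper-bound⁻ k₂ h∈
      ...   | u , c , refl , u≢w , refl | v , c′ , refl , v≢w , refl =
        le (le⁻ (sol (combined-∈⁺ w cs j′ v≢w i′ u≢w)))
          (solve 4 (λ xu xv c c′ → xv :- (xu :+ (c′ :+ c)) := (xv :- c′) :- (xu :+ c)) refl (x u) (x v) c c′)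
    ... | m , above , below = y , λ {k} i → satisfied (role w k) i
      where
      y : Code → Carrier
      y q = if does (q ≟C w) then m else x q
      y-w : y w ≡ m
      y-w = cong (if_then m else x w) (dec-true (w ≟C w) refl)
      y-≢ : ∀ {q} → q ≢ w → y q ≡ x q
      y-≢ {q} n = cong (if_then m else x q) (dec-false (q ≟C w) n)
      satisfied : ∀ {k} → Role w k → k ∈ cs → Satisfies y k
      satisfied (loop {v} {c}) i = le (le⁻ (sol (kept-∈⁺ w cs i (inj₁ refl))))
        (solve 3 (λ xv yv c → xv :- (xv :+ c) := yv :- (yv :+ c)) refl (x v) (y v) c)
      satisfied (lower {u} {c} u≢w) i = subst₂ (λ s t → s + c ≤ t) (sym (y-≢ u≢w)) (sym y-w) (above (concatMap-∈⁺ lower-bound cs i (lower-bound⁺ u c u≢w)))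
      satisfied (upper {v} {c} v≢w) i = subst₂ (λ s t → s + c ≤ t) (sym y-w) (sym (y-≢ v≢w))
        (le (le⁻ (below (concatMap-∈⁺ upper-bound cs i (upper-bound⁺ v c v≢w)))) (solve 3 (λ xv m c → (xv :- c) :- m := xv :- (m :+ c)) refl (x v) m c))
      satisfied (other {v} {u} {c} v≢u v≢w u≢w) i = subst₂ (λ s t → s + c ≤ t) (sym (y-≢ u≢w)) (sym (y-≢ v≢w)) (sol (kept-∈⁺ w cs i (inj₂ (v≢w , u≢w))))

    eliminate-complete : ∀ cs → Solves x cs → Solves x (eliminateᵐ w cs)
    eliminate-complete cs sol i with eliminate-∈⁻ w cs i
    ... | kept j _ = sol j
    ... | combined {v} {c} {u} {c′} j _ j′ _ refl = le (le⁻ (sol j) +≤ le⁻ (sol j′))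
      (solve 5 (λ xv xw xu c c′ → (xv :- (xw :+ c)) :+ (xw :- (xu :+ c′)) := xv :- (xu :+ (c :+ c′))) refl (x v) (x w) (x u) c c′)

  -- An invariant of the elimination: distinct ends of a constraint have not been eliminated yet.
  -- Once every point has been eliminated only constraints with equal ends can be left.
  Between : (Code → Set) → List Constraint → Set
  Between P cs = ∀ {v u c} → (v , u , c) ∈ cs → v ≡ u ⊎ (P v × P u)

  eliminate-between : ∀ {P} w cs → Between P cs → Between (λ q → P q × q ≢ w) (eliminateᵐ w cs)
  eliminate-between w cs h i with eliminate-∈⁻ w cs i
  ... | kept j (inj₁ e) = inj₁ e
  ... | kept j (inj₂ (v≢w , u≢w)) with h j
  ...   | inj₁ e = inj₁ e
  ...   | inj₂ (pv , pu) = inj₂ ((pv , v≢w) , (pu , u≢w))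
  eliminate-between w cs h i | combined j v≢w j′ u≢w refl with h j | h j′
  ...   | inj₁ e | _ = ⊥-elim (v≢w e)
  ...   | _ | inj₁ e = ⊥-elim (u≢w (sym e))
  ...   | inj₂ (pv , _) | inj₂ (_ , pu) = inj₂ ((pv , v≢w) , (pu , u≢w))

  eliminateAll-sound : ∀ ps cs x → Solves x (eliminateAllᵐ ps cs) → ∃ λ y → Solves y cs
  eliminateAll-sound [] cs x sol = x , sol
  eliminateAll-sound (p ∷ ps) cs x sol with eliminate-sound p x (eliminateAllᵐ ps cs) sol
  ... | y , sol′ = eliminateAll-sound ps cs y sol′

  eliminateAll-complete : ∀ ps cs x → Solves x cs → Solves x (eliminateAllᵐ ps cs)
  eliminateAll-complete [] cs x sol = sol
  eliminateAll-complete (p ∷ ps) cs x sol = eliminate-complete p x (eliminateAllᵐ ps cs) (eliminateAll-complete ps cs x sol)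

  eliminateAll-between : ∀ {P} ps cs → Between P cs → Between (λ q → P q × (q ∈ ps → ⊥)) (eliminateAllᵐ ps cs)
  eliminateAll-between [] cs h i with h i
  ... | inj₁ e = inj₁ e
  ... | inj₂ (pv , pu) = inj₂ ((pv , λ ()) , (pu , λ ()))
  eliminateAll-between {P} (p ∷ ps) cs h i with eliminate-between p (eliminateAllᵐ ps cs) (eliminateAll-between {P} ps cs h) i
  ... | inj₁ e = inj₁ e
  ... | inj₂ (((pv , nv) , v≢p) , ((pu , nu) , u≢p)) =
    inj₂ ((pv , λ { (here e) → v≢p e ; (there j) → nv j }) , (pu , λ { (here e) → u≢p e ; (there j) → nu j }))

  satisfiable-⇔ : ∀ ps cs → (∀ {v u c} → (v , u , c) ∈ cs → v ∈ ps × u ∈ ps) → satisfiableᵐ ps cs ⇔ᵇ (∃ λ x → Solves x cs)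
  satisfiable-⇔ ps cs inside = iff (to ∘ sound nonpositive) (complete nonpositive ∘ from)
    where
    nonpositive : satisfiableᵐ ps cs ⇔ᵇ (∀ {k} → k ∈ eliminateAllᵐ ps cs → proj₂ (proj₂ k) ≤ 0#)
    nonpositive = every-⇔ (λ k → ≮-⇔ 0# (proj₂ (proj₂ k))) (eliminateAllᵐ ps cs)
    to : (∀ {k} → k ∈ eliminateAllᵐ ps cs → proj₂ (proj₂ k) ≤ 0#) → ∃ λ x → Solves x cs
    -- The zero potential solves the final system because its constants are nonpositive; back
    -- substitution does the rest.
    to h = eliminateAll-sound ps cs (λ _ → 0#) (λ i → subst (_≤ 0#) (sym (+-identityˡ _)) (h i))
    from : (∃ λ x → Solves x cs) → ∀ {k} → k ∈ eliminateAllᵐ ps cs → proj₂ (proj₂ k) ≤ 0#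
    from (x , sol) {v , u , c} i with eliminateAll-between {_∈ ps} ps cs (λ j → inj₂ (inside j)) i
    ... | inj₂ ((v∈ , v∉) , _) = ⊥-elim (v∉ v∈)
    ... | inj₁ refl = le (le⁻ (eliminateAll-complete ps cs x sol i)) (solve 2 (λ xv c → xv :- (xv :+ c) := con 0ℤ :- c) refl (x v) c)

-- Codes of divisors and slope systems, and correctness of the feasibility test.

module Encoding {R : RealField} (G : MetricGraph R) where
  open RankDetermination G public
  open Semantics R public using (⟦_⟧)
  open Mirror R public using (Code; _≟C_; Segmentᶜ; Slopedᶜ; Divisorᶜ; Constraint; bit; every; some; coeffᵐ; effectiveᵐ; divᵐ; constraintsᵐ;
    endsᵐ; satisfiableᵐ; checkᵐ; decorateᵐ; decorateStepᵐ; feasibleᵐ; widenᵐ; widenByᵐ; growᵐ; slopesᵐ)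
  open Elimination R public using (_⇔ᵇ_; iff; sound; complete; ≮-⇔; ∧-⇔; every-⇔; every-false; some-sound; some-complete;
    concatMap-∈⁻; concatMap-∈⁺; Solves; satisfiable-⇔)

  code : Point → Code
  code (vertex w)         = - 1# , fromℕ (toℕ w)
  code (interior e t _ _) = fromℕ (toℕ e) , t

  -1<fromℕ : ∀ n → - 1# < fromℕ n
  -1<fromℕ n = lt (0<1 +< fromℕ-nonneg n) (solve 2 (λ o n → o :+ n := n :- (:- o)) refl 1# (fromℕ n))

  -- Edge indices are nonnegative reals and hence differ from the -1 that marks vertices.
  code-injective : ∀ {v w} → code v ≡ code w → v ≡ w
  code-injective {vertex v} {vertex w} eq = cong vertex (Finₚ.toℕ-injective (fromℕ-injective (cong proj₂ eq)))
  code-injective {vertex v} {interior e _ _ _} eq = ⊥-elim (<⇒≢ (-1<fromℕ (toℕ e)) (cong proj₁ eq))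
  code-injective {interior e _ _ _} {vertex w} eq = ⊥-elim (<⇒≢ (-1<fromℕ (toℕ e)) (sym (cong proj₁ eq)))
  code-injective {interior e t p q} {interior e′ t′ p′ q′} eq with Finₚ.toℕ-injective {i = e} {e′} (fromℕ-injective (cong proj₁ eq)) | cong proj₂ eq
  ... | refl | refl = refl

  codeSegment : Segment → Segmentᶜ
  codeSegment (e , a , b) = (code (at e a) , code (at e b)) , (fromℕ (toℕ e) , (a , b))

  codeDivisor : Divisor → Divisorᶜ
  codeDivisor = map λ (w , c) → code w , fromℤ c

  SlopedSegment : Set
  SlopedSegment = Segment × ℤ × ℤ

  codeSloped : SlopedSegment → Slopedᶜ
  codeSloped (s , m , n) = codeSegment s , (fromℤ m , fromℤ n)

  linkSloped : SlopedSegment → Sloped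
  linkSloped (s , m , n) = toLink s , m , n

  coeff-code : ∀ F v → coeffᵐ (codeDivisor F) (code v) ≡ fromℤ (coeff F v)
  coeff-code [] v = refl
  coeff-code ((w , c) ∷ F) v = go (w ≟P v) (code w ≟C code v)
    where
    acc = coeffᵐ (codeDivisor F) (code v)
    go : (d : Dec (w ≡ v)) (d′ : Dec (code w ≡ code v)) →
      (if does d′ then fromℤ c + acc else acc) ≡ fromℤ ((if does d then c else 0ℤ) ℤ.+ coeff F v)
    go (yes refl) (yes _) = trans (cong (λ z → fromℤ c + z) (coeff-code F v)) (sym (fromℤ-+ c (coeff F v)))
    go (no _) (no _) = trans (coeff-code F v) (cong fromℤ (sym (ℤₚ.+-identityˡ (coeff F v))))
    go (yes refl) (no n) = ⊥-elim (n refl)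
    go (no w≢v) (yes e) = ⊥-elim (w≢v (code-injective e))

  effective-⇔ : ∀ F → effectiveᵐ (codeDivisor F) ⇔ᵇ Effective F
  effective-⇔ F = iff (to ∘ sound entries) (complete entries ∘ from)
    where
    entries : effectiveᵐ (codeDivisor F) ⇔ᵇ (∀ {x} → x ∈ codeDivisor F → 0# ≤ coeffᵐ (codeDivisor F) (proj₁ x))
    entries = every-⇔ (λ x → ≮-⇔ (coeffᵐ (codeDivisor F) (proj₁ x)) 0#) (codeDivisor F)
    to : (∀ {x} → x ∈ codeDivisor F → 0# ≤ coeffᵐ (codeDivisor F) (proj₁ x)) → Effective F
    to h = effective-check F λ {w} {c} i → fromℤ-nonneg⁻ (subst (0# ≤_) (coeff-code F w) (h (∈ₚ.∈-map⁺ (λ (w , c) → code w , fromℤ c) i)))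
    from : Effective F → ∀ {x} → x ∈ codeDivisor F → 0# ≤ coeffᵐ (codeDivisor F) (proj₁ x)
    from eff i with ∈ₚ.∈-map⁻ (λ (w , c) → code w , fromℤ c) i
    ... | (w , c) , _ , refl = subst (0# ≤_) (sym (coeff-code F w)) (fromℤ-nonneg (eff w))

  div-code : ∀ ds → divᵐ (map codeSloped ds) ≡ codeDivisor (div (map linkSloped ds))
  div-code [] = refl
  div-code (((e , a , b) , m , n) ∷ ds) = cong (λ F → (code (at e a) , fromℤ m) ∷ (code (at e b) , fromℤ n) ∷ F) (div-code ds)

  constraintsOf : List SlopedSegment → List Constraint
  constraintsOf ds = constraintsᵐ (map codeSloped ds)

  satisfies⇒ : ∀ {s c t} → s + c ≤ t → c ≤ t - s
  satisfies⇒ {s} {c} {t} h = le (le⁻ h) (solve 3 (λ s c t → t :- (s :+ c) := (t :- s) :- c) refl s c t)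

  ⇒satisfies : ∀ {s c t} → c ≤ t - s → s + c ≤ t
  ⇒satisfies {s} {c} {t} h = le (le⁻ h) (solve 3 (λ s c t → (t :- s) :- c := t :- (s :+ c)) refl s c t)

  solves⇒valid : ∀ x ds → Solves x (constraintsOf ds) → All (Valid (x ∘ code)) (map linkSloped ds)
  solves⇒valid x [] sol = []
  solves⇒valid x (((e , a , b) , m , n) ∷ ds) sol =
    (satisfies⇒ (sol (here refl)) , satisfies⇒ (sol (there (here refl)))) ∷ solves⇒valid x ds (sol ∘ there ∘ there)

  endpoints : List SlopedSegment → List Point
  endpoints [] = []
  endpoints (((e , a , b) , _) ∷ ds) = at e a ∷ at e b ∷ endpoints ds

  -- Potentials of the constraint system are defined on all pairs of reals, so the values are
  -- transferred by looking up the finitely many end points that occur.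
  extend : (Point → Carrier) → List Point → Code → Carrier
  extend x [] q = 0#
  extend x (p ∷ ps) q = if does (code p ≟C q) then x p else extend x ps q

  extend-code : ∀ x ps {w} → w ∈ ps → extend x ps (code w) ≡ x w
  extend-code x (p ∷ ps) {w} i with code p ≟C code w
  ... | yes e = cong x (code-injective e)
  extend-code x (p ∷ ps) {w} (here refl) | no n = ⊥-elim (n refl)
  extend-code x (p ∷ ps) {w} (there i) | no n = extend-code x ps i

  valid⇒solves : ∀ x ds → All (Valid x) (map linkSloped ds) → ∃ λ y → Solves y (constraintsOf ds)
  valid⇒solves x ds va = extend x (endpoints ds) , go ds (λ i → extend-code x (endpoints ds) i) va
    where
    y = extend x (endpoints ds)
    go : ∀ ds′ → (∀ {w} → w ∈ endpoints ds′ → y (code w) ≡ x w) → All (Valid x) (map linkSloped ds′) → Solves y (constraintsOf ds′)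
    go [] h [] ()
    go (((e , a , b) , m , n) ∷ ds′) h ((p , q) ∷ va) (here refl) =
      subst₂ (λ s t → s + fromℤ m * (b - a) ≤ t) (sym (h (here refl))) (sym (h (there (here refl)))) (⇒satisfies p)
    go (((e , a , b) , m , n) ∷ ds′) h ((p , q) ∷ va) (there (here refl)) =
      subst₂ (λ s t → s + fromℤ n * (b - a) ≤ t) (sym (h (there (here refl)))) (sym (h (here refl))) (⇒satisfies q)
    go (_ ∷ ds′) h (_ ∷ va) (there (there i)) = go ds′ (h ∘ there ∘ there) va i

  endsOf : List Segment → List Code
  endsOf ss = endsᵐ (map codeSegment ss)

  constraints-inside : ∀ ds {v u c} → (v , u , c) ∈ constraintsOf ds → v ∈ endsOf (map proj₁ ds) × u ∈ endsOf (map proj₁ ds)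
  constraints-inside (d ∷ ds) (here refl) = there (here refl) , here refl
  constraints-inside (d ∷ ds) (there (here refl)) = here refl , there (here refl)
  constraints-inside (d ∷ ds) (there (there i)) with constraints-inside ds i
  ... | j , k = there (there j) , there (there k)

  Witness : Divisor → List SlopedSegment → Set
  Witness F ds = Effective (F ++ div (map linkSloped ds)) × ∃ λ x → All (Valid x) (map linkSloped ds)

  valid-⇔ : ∀ ds → satisfiableᵐ (endsOf (map proj₁ ds)) (constraintsOf ds) ⇔ᵇ (∃ λ x → All (Valid x) (map linkSloped ds))
  valid-⇔ ds = iff (λ t → let y , sol = sound solvable t in y ∘ code , solves⇒valid y ds sol)
                   (λ (x , va) → complete solvable (valid⇒solves x ds va))
    where
    solvable : satisfiableᵐ (endsOf (map proj₁ ds)) (constraintsOf ds) ⇔ᵇ (∃ λ y → Solves y (constraintsOf ds))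
    solvable = satisfiable-⇔ (endsOf (map proj₁ ds)) (constraintsOf ds) (constraints-inside ds)

  check-⇔ : ∀ F ds → checkᵐ (map codeSegment (map proj₁ ds)) (codeDivisor F) (map codeSloped ds) ⇔ᵇ Witness F ds
  check-⇔ F ds = ∧-⇔ (subst (λ E → effectiveᵐ E ⇔ᵇ Effective (F ++ div (map linkSloped ds))) divisor≡ (effective-⇔ (F ++ div (map linkSloped ds)))) (valid-⇔ ds)
    where
    divisor≡ : codeDivisor (F ++ div (map linkSloped ds)) ≡ codeDivisor F ++ divᵐ (map codeSloped ds)
    divisor≡ = trans (Listₚ.map-++ _ F _) (cong (λ E → codeDivisor F ++ E) (sym (div-code ds)))

  Integral : List Carrier → Set
  Integral cs = ∀ {c} → c ∈ cs → ∃ λ z → c ≡ fromℤ z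

  ContainsUpTo : ℕ → List Carrier → Set
  ContainsUpTo B cs = ∀ z → ℤ.- (⁺ B) ℤ.≤ z → z ℤ.≤ ⁺ B → fromℤ z ∈ cs

  decorations⁻ : ∀ cs ss {r} → Integral cs → r ∈ decorateᵐ cs (map codeSegment ss) → ∃ λ ds → map proj₁ ds ≡ ss × r ≡ map codeSloped ds
  decorations⁻ cs [] iz (here refl) = [] , refl , refl
  decorations⁻ cs (s ∷ ss) iz i with concatMap-∈⁻ _ (decorateᵐ cs (map codeSegment ss)) i
  ... | r , j , k with concatMap-∈⁻ _ cs k
  ...   | a , a∈ , l with concatMap-∈⁻ _ cs l
  ...     | b , b∈ , here refl with decorations⁻ cs ss iz j | iz a∈ | iz b∈
  ...       | ds , refl , refl | m , refl | n , refl = (s , m , n) ∷ ds , refl , refl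

  decorations⁺ : ∀ cs ds → All (λ (_ , m , n) → fromℤ m ∈ cs × fromℤ n ∈ cs) ds → map codeSloped ds ∈ decorateᵐ cs (map codeSegment (map proj₁ ds))
  decorations⁺ cs [] [] = here refl
  decorations⁺ cs ((s , m , n) ∷ ds) ((hm , hn) ∷ h) =
    concatMap-∈⁺ _ (decorateᵐ cs (map codeSegment (map proj₁ ds))) (decorations⁺ cs ds h) (concatMap-∈⁺ _ cs hm (concatMap-∈⁺ _ cs hn (here refl)))

  attach : ∀ ss r → map proj₁ r ≡ map toLink ss → ∃ λ ds → map proj₁ ds ≡ ss × r ≡ map linkSloped ds
  attach [] [] eq = [] , refl , refl
  attach (s ∷ ss) ((l , m , n) ∷ r) eq with Listₚ.∷-injectiveˡ eq | attach ss r (Listₚ.∷-injectiveʳ eq)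
  ... | refl | ds , refl , refl = (s , m , n) ∷ ds , refl , refl

  links≡ : ∀ ds → map proj₁ (map linkSloped ds) ≡ map toLink (map proj₁ ds)
  links≡ [] = refl
  links≡ (d ∷ ds) = cong (toLink (proj₁ d) ∷_) (links≡ ds)

  -- Soundness uses that the candidate slopes are integers; completeness uses that they include all
  -- integers up to `B`, together with `feasible-bounded`.
  feasible-⇔ : ∀ cs ss F B → Integral cs → ContainsUpTo B cs → Bounds B F → All Positive (map toLink ss) →
    feasibleᵐ cs (map codeSegment ss) (codeDivisor F) ⇔ᵇ Feasible (map toLink ss) F
  feasible-⇔ cs ss F B iz cont bd pos′ = iff (λ t → to (some-sound check (decorateᵐ cs (map codeSegment ss)) t)) from
    where
    check : List Slopedᶜ → Bool
    check = checkᵐ (map codeSegment ss) (codeDivisor F)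
    to : (∃ λ r → r ∈ decorateᵐ cs (map codeSegment ss) × check r ≡ true) → Feasible (map toLink ss) F
    to (r , i , h) with decorations⁻ cs ss iz i
    ... | ds , refl , refl with sound (check-⇔ F ds) h
    ...   | eff , x , va = feasible x (map linkSloped ds) (links≡ ds) va eff
    from : Feasible (map toLink ss) F → feasibleᵐ cs (map codeSegment ss) (codeDivisor F) ≡ true
    from F′ with feasible-bounded pos′ bd F′
    ... | feasible x r eq va eff , bds with attach ss r eq
    ...   | ds , refl , refl = some-complete check (decorateᵐ cs (map codeSegment ss))
      (decorations⁺ cs ds (All.map (λ ((l , h) , (l′ , h′)) → cont _ l h , cont _ l′ h′) (Allₚ.map⁻ bds)))
      (complete (check-⇔ F ds) (eff , x , va))

  positivePart : Divisor → ℕ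
  positivePart [] = 0
  positivePart ((_ , ⁺ n) ∷ D) = n ℕ.+ positivePart D
  positivePart ((_ , -[1+ _ ]) ∷ D) = positivePart D

  wsum-positivePart : ∀ U D → wsum U D ℤ.≤ ⁺ positivePart D
  wsum-positivePart U [] = ℤₚ.≤-refl
  wsum-positivePart U ((w , ⁺ n) ∷ D) = ℤₚ.+-mono-≤ (ind (U w)) (wsum-positivePart U D)
    where ind : ∀ b → (if b then ⁺ n else 0ℤ) ℤ.≤ ⁺ n
          ind true  = ℤₚ.≤-refl
          ind false = ℤ.+≤+ ℕ.z≤n
  wsum-positivePart U ((w , -[1+ n ]) ∷ D) = ℤₚ.≤-trans (ℤₚ.+-mono-≤ (ind (U w)) (wsum-positivePart U D)) (ℤₚ.≤-reflexive (ℤₚ.+-identityˡ _))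
    where ind : ∀ b → (if b then -[1+ n ] else 0ℤ) ℤ.≤ 0ℤ
          ind true  = ℤ.-≤+
          ind false = ℤₚ.≤-refl

  -- Subtracting points lowers the mass of every set, so the slopes computed from `D` once serve all
  -- tests.
  bounds-minus : ∀ qs D → Bounds (positivePart D) (minus qs D)
  bounds-minus qs D U = ℤₚ.≤-trans (ℤₚ.≤-reflexive (wsum-minus U qs D))
    (ℤₚ.≤-trans (ℤ-le (wsum-points U qs) (ℤsolve 2 (λ d e → e ⊜ d ⊖′ (d ⊖′ e)) refl (wsum U D) (wsum U (pts (⁺ 1) qs)))) (wsum-positivePart U D))

  slopesOf : Divisor → List Carrier
  slopesOf [] = 0# ∷ []
  slopesOf ((_ , ⁺ n) ∷ D) = widenByᵐ n (slopesOf D)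
  slopesOf ((_ , -[1+ _ ]) ∷ D) = slopesOf D

  encodeInput : InputDivisor → List ⟦ (nat ⊕ nat ⊗ real) ⊗ int ⟧
  encodeInput = map λ (x , c) → encodeLocation G x , c

  slopes-input : ∀ D → slopesᵐ (encodeInput D) ≡ slopesOf (divisor D)
  slopes-input [] = refl
  slopes-input ((x , ⁺ n) ∷ D) = cong (widenByᵐ n) (slopes-input D)
  slopes-input ((x , -[1+ n ]) ∷ D) = slopes-input D

  widen-integral : ∀ cs → Integral cs → Integral (widenᵐ cs)
  widen-integral cs iz i with concatMap-∈⁻ _ cs i
  ... | c , j , k with iz j
  widen-integral cs iz i | c , j , here refl | z , refl = z , refl
  widen-integral cs iz i | c , j , there (here refl) | z , refl = z ℤ.+ (⁺ 1) , sym (fromℤ-suc z)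
  widen-integral cs iz i | c , j , there (there (here refl)) | z , refl = z ℤ.- (⁺ 1) , sym (fromℤ-pred z)

  widenBy-integral : ∀ n cs → Integral cs → Integral (widenByᵐ n cs)
  widenBy-integral zero cs iz = iz
  widenBy-integral (suc n) cs iz = widen-integral (widenByᵐ n cs) (widenBy-integral n cs iz)

  slopesOf-integral : ∀ D → Integral (slopesOf D)
  slopesOf-integral [] (here refl) = 0ℤ , refl
  slopesOf-integral ((_ , ⁺ n) ∷ D) = widenBy-integral n (slopesOf D) (slopesOf-integral D)
  slopesOf-integral ((_ , -[1+ _ ]) ∷ D) = slopesOf-integral D

  suc-neg : ∀ B → ℤ.suc -[1+ B ] ≡ ℤ.- (⁺ B)
  suc-neg zero = refl
  suc-neg (suc B) = ℤₚ.[1+m]⊖[1+n]≡m⊖n 0 (suc B)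

  widen-contains : ∀ B cs → ContainsUpTo B cs → ContainsUpTo (suc B) (widenᵐ cs)
  widen-contains B cs cont z lo hi with (⁺ suc B) ℤₚ.≤? z | z ℤₚ.≤? -[1+ B ]
  ... | yes big | _ = concatMap-∈⁺ _ cs (cont (⁺ B) (ℤₚ.≤-trans (neg≤0 B) (ℤ.+≤+ ℕ.z≤n)) ℤₚ.≤-refl)
    (there (here (trans (cong fromℤ (trans (ℤₚ.≤-antisym hi big) (trans (cong ⁺_ (ℕₚ.+-comm 1 B)) refl))) (fromℤ-suc (⁺ B)))))
  ... | no _ | yes small = concatMap-∈⁺ _ cs (cont (ℤ.- (⁺ B)) ℤₚ.≤-refl (ℤₚ.≤-trans (neg≤0 B) (ℤ.+≤+ ℕ.z≤n)))
    (there (there (here (trans (cong fromℤ (trans (ℤₚ.≤-antisym small lo)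
      (trans (cong (λ n → ℤ.- (⁺ n)) (ℕₚ.+-comm 1 B)) (ℤₚ.neg-distrib-+ (⁺ B) (⁺ 1))))) (fromℤ-pred (ℤ.- (⁺ B)))))))
  ... | no notbig | no notsmall = concatMap-∈⁺ _ cs (cont z
      (subst (ℤ._≤ z) (suc-neg B) (ℤₚ.i<j⇒suc[i]≤j (ℤₚ.≰⇒> notsmall)))
      (ℤ-le (ℤ-le⁻ (ℤₚ.i<j⇒suc[i]≤j (ℤₚ.≰⇒> notbig))) (ℤsolve 2 (λ z B → (const (⁺ 1) ⊕′ B) ⊖′ (const (⁺ 1) ⊕′ z) ⊜ B ⊖′ z) refl z (⁺ B))))
    (here refl)

  widenBy-contains : ∀ n B cs → ContainsUpTo B cs → ContainsUpTo (n ℕ.+ B) (widenByᵐ n cs)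
  widenBy-contains zero B cs cont = cont
  widenBy-contains (suc n) B cs cont = widen-contains (n ℕ.+ B) (widenByᵐ n cs) (widenBy-contains n B cs cont)

  slopesOf-contains : ∀ D → ContainsUpTo (positivePart D) (slopesOf D)
  slopesOf-contains [] z lo hi = here (cong fromℤ (ℤₚ.≤-antisym hi lo))
  slopesOf-contains ((_ , ⁺ n) ∷ D) = widenBy-contains n (positivePart D) (slopesOf D) (slopesOf-contains D)
  slopesOf-contains ((_ , -[1+ _ ]) ∷ D) = slopesOf-contains D

-- The computed model, and termination of the search at the rank.

concat-singletons : ∀ {A : Set} n (f : Fin n → A) → concat (tabulate (λ i → f i ∷ [])) ≡ tabulate f
concat-singletons zero f = refl
concat-singletons (suc n) f = cong (f Fin.zero ∷_) (concat-singletons n (f ∘ Fin.suc))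

concatMap-singletons : ∀ {A B : Set} (f : A → B) xs → concatMap (λ x → f x ∷ []) xs ≡ map f xs
concatMap-singletons f [] = refl
concatMap-singletons f (x ∷ xs) = cong (f x ∷_) (concatMap-singletons f xs)

module Computation {R : RealField} (G : MetricGraph R) where
  open Encoding G
  open Programs using (program; Prepared; initialT; stepT)
  open Mirror R using (baseᵐ; vertexᵐ; locateᵐ; resolveᵐ; divisorᵐ; splitᵐ; refineᵐ; midpointsᵐ; supportᵐ; modelᵐ; verticesᵐ; tuplesᵐ;
    everywhereᵐ; predᵐ; prepareᵐ; start≡; step≡; edgeᵐ; eval; halt′; next′; computes′)

  baseModel : Model
  baseModel = record { segments = λ e → (e , 0# , length e) ∷ [] ; chain = λ e → [ length>0 e ] }

  whole : Edge → Segment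
  whole e = e , 0# , length e

  flat-base : flat baseModel ≡ tabulate whole
  flat-base = concat-singletons _ whole

  base-code : baseᵐ (tabulate (λ e → toℕ (source e) , toℕ (target e) , length e)) 0 ≡ map codeSegment (flat baseModel)
  base-code = trans (go _ (λ e → toℕ (source e) , toℕ (target e) , length e) 0)
      (trans (Listₚ.tabulate-cong same) (trans (sym (Listₚ.map-tabulate whole codeSegment)) (cong (map codeSegment) (sym flat-base))))
    where
    entry : ℕ × ℕ × Carrier → ℕ → Segmentᶜ
    entry (s , t , L) k = (vertexᵐ s , vertexᵐ t) , (fromℕ k , (0# , L))
    go : ∀ n (g : Fin n → ℕ × ℕ × Carrier) k → baseᵐ (tabulate g) k ≡ tabulate (λ i → entry (g i) (k ℕ.+ toℕ i))
    go zero g k = refl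
    go (suc n) g k = cong₂ _∷_ (cong (entry (g Fin.zero)) (sym (ℕₚ.+-identityʳ k)))
      (trans (go n (g ∘ Fin.suc) (suc k)) (Listₚ.tabulate-cong (λ i → cong (entry (g (Fin.suc i))) (sym (ℕₚ.+-suc k (toℕ i))))))
    same : ∀ e → entry (toℕ (source e) , toℕ (target e) , length e) (toℕ e) ≡ codeSegment (whole e)
    same e = cong (λ uv → uv , (fromℕ (toℕ e) , (0# , length e))) (cong₂ _,_ (cong code (sym (at-0 e))) (cong code (sym (at-length e))))

  locate-code : ∀ e t → locateᵐ (toℕ e) t (codeSegment (whole e)) ≡ code (at e t)
  locate-code e t = go (0# <? t) (t <? length e)
    where
    left′ : ¬ (0# < t) → at e t ≡ at e 0#
    left′ n with 0# <? t
    ... | yes p = ⊥-elim (n p)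
    ... | no _  = sym (at-0 e)
    right′ : 0# < t → ¬ (t < length e) → at e t ≡ at e (length e)
    right′ p n with 0# <? t | t <? length e
    ... | no m  | _     = ⊥-elim (m p)
    ... | yes _ | yes q = ⊥-elim (n q)
    ... | yes _ | no _  = sym (at-length e)
    go : (d : Dec (0# < t)) (d′ : Dec (t < length e)) →
      (if does d then (if does d′ then (fromℕ (toℕ e) , t) else code (at e (length e))) else code (at e 0#)) ≡ code (at e t)
    go (no n) _ = cong code (sym (left′ n))
    go (yes p) (no n) = cong code (sym (right′ p n))
    go (yes p) (yes q) = cong code (sym (at-interior e p q))

  edge-code-≢ : ∀ {e e′ : Edge} → e ≢ e′ → fromℕ (toℕ e) ≢ fromℕ (toℕ e′)
  edge-code-≢ n eq = n (Finₚ.toℕ-injective (fromℕ-injective eq))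

  resolve-code : ∀ x → resolveᵐ (map codeSegment (flat baseModel)) (encodeLocation G x) ≡ code (point x)
  resolve-code (vertex v) = refl
  resolve-code (location e t _ _) = trans
      (cong (λ ss → foldr f (fromℕ (toℕ e) , t) (map codeSegment ss)) (trans flat-base (sym (Listₚ.map-tabulate (λ i → i) whole))))
      (go (tabulate (λ i → i)) (∈ₚ.∈-allFin e))
    where
    f : Segmentᶜ → Code → Code
    f s b = if does (edgeᵐ s ≟ fromℕ (toℕ e)) then locateᵐ (toℕ e) t s else b
    go : ∀ es → e ∈ es → foldr f (fromℕ (toℕ e) , t) (map codeSegment (map whole es)) ≡ code (at e t)
    go (e′ ∷ es) i with e′ ≟F e
    ... | yes refl rewrite dec-true (fromℕ (toℕ e) ≟ fromℕ (toℕ e)) refl = locate-code e t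
    go (e′ ∷ es) (here refl) | no n = ⊥-elim (n refl)
    go (e′ ∷ es) (there i) | no n rewrite dec-false (fromℕ (toℕ e′) ≟ fromℕ (toℕ e)) (edge-code-≢ n) = go es i

  divisor-code′ : ∀ D → divisorᵐ (map codeSegment (flat baseModel)) (encodeInput D) ≡ codeDivisor (divisor D)
  divisor-code′ [] = refl
  divisor-code′ ((x , c) ∷ D) = cong₂ _∷_ (cong (_, fromℤ c) (resolve-code x)) (divisor-code′ D)

  split-code : ∀ p s → Proper s → splitᵐ (code p) (codeSegment s) ≡ map codeSegment (split p s)
  split-code (vertex w) (e , a , b) _ rewrite dec-false (fromℕ (toℕ e) ≟ - 1#) (λ eq → <⇒≢ (-1<fromℕ (toℕ e)) (sym eq)) = refl
  split-code p@(interior e′ t q r) s@(e , a , b) pr = go (e ≟F e′) (a <? t) (t <? b)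
    where
    whole′ : Segmentᶜ
    whole′ = codeSegment s
    pieces′ : List Segmentᶜ
    pieces′ = ((code (at e a) , code p) , (fromℕ (toℕ e) , (a , t))) ∷ ((code p , code (at e b)) , (fromℕ (toℕ e) , (t , b))) ∷ []
    go : (d : Dec (e ≡ e′)) (d₁ : Dec (a < t)) (d₂ : Dec (t < b)) →
      (if does (fromℕ (toℕ e) ≟ fromℕ (toℕ e′)) then (if does d₁ then (if does d₂ then pieces′ else whole′ ∷ []) else whole′ ∷ []) else whole′ ∷ [])
      ≡ map codeSegment (if does d ∧ (does d₁ ∧ does d₂) then (e , a , t) ∷ (e , t , b) ∷ [] else s ∷ [])
    go (no n) d₁ d₂ rewrite dec-false (fromℕ (toℕ e) ≟ fromℕ (toℕ e′)) (edge-code-≢ n) = refl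
    go (yes e≡e′) d₁ d₂ rewrite dec-true (fromℕ (toℕ e) ≟ fromℕ (toℕ e′)) (cong (λ i → fromℕ (toℕ i)) e≡e′) = inner d₁ d₂
      where
      at-t : at e t ≡ p
      at-t = same e≡e′ q r
        where
        same : ∀ {e″} → e ≡ e″ → .(q : 0# < t) .(r : t < length e″) → at e t ≡ interior e″ t q r
        same refl q r = at-interior e (recompute (0# <? t) q) (recompute (t <? length e) r)
      inner : (d₁ : Dec (a < t)) (d₂ : Dec (t < b)) →
        (if does d₁ then (if does d₂ then pieces′ else whole′ ∷ []) else whole′ ∷ [])
        ≡ map codeSegment (if does d₁ ∧ does d₂ then (e , a , t) ∷ (e , t , b) ∷ [] else s ∷ [])
      inner (no _) _ = refl
      inner (yes _) (no _) = refl
      inner (yes _) (yes _) = cong (λ w → ((code (at e a) , code w) , (fromℕ (toℕ e) , (a , t))) ∷ ((code w , code (at e b)) , (fromℕ (toℕ e) , (t , b))) ∷ []) (sym at-t)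

  refine-code : ∀ ps M → refineᵐ (map code ps) (map codeSegment (flat M)) ≡ map codeSegment (flat (refineAll ps M))
  refine-code [] M = refl
  refine-code (p ∷ ps) M = trans (cong (concatMap (splitᵐ (code p))) (refine-code ps M))
      (trans (go (flat (refineAll ps M)) (proper (refineAll ps M))) (cong (map codeSegment) (sym (flat-refine p (refineAll ps M)))))
    where
    go : ∀ ss → All Proper ss → concatMap (splitᵐ (code p)) (map codeSegment ss) ≡ map codeSegment (concatMap (split p) ss)
    go [] [] = refl
    go (s ∷ ss) (h ∷ hs) = trans (cong₂ _++_ (split-code p s h) (go ss hs)) (sym (Listₚ.map-++ codeSegment (split p s) (concatMap (split p) ss)))

  ½ : Carrier
  ½ = (1# + 1#) ⁻¹

  ½+½ : (1# + 1#) * ½ ≡ 1#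
  ½+½ = *-inverseʳ (0<⇒≢0 (0<1 +< <⇒≤ 0<1))

  -- The field axioms give no sign for inverses. If `½` were nonpositive, so would be its product
  -- with 1 + 1, which is 1.
  0<½ : 0# < ½
  0<½ with <-or-≥ 0# ½
  ... | inj₁ p = p
  ... | inj₂ n = ⊥-elim (<⇒≱ 0<1 (≤-trans (inj₂ (sym ½+½)) (≤-trans (inj₂ (*-comm _ _))
    (≤-trans (*-monoˡ (<⇒≤ (0<1 +< <⇒≤ 0<1)) n) (inj₂ (zeroˡ _))))))

  ½-pos : ∀ e → 0# < ½ * length e
  ½-pos e = *-pos 0<½ (length>0 e)

  ½-< : ∀ e → ½ * length e < length e
  ½-< e = lt (½-pos e) (trans (solve 2 (λ h L → h := (h :+ h) :- h) refl (½ * length e) 0#)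
    (cong (λ z → z - ½ * length e) (trans (solve 3 (λ o h L → h :* L :+ h :* L := (con (⁺ 2) :* h) :* L) refl 1# ½ (length e))
      (trans (cong (λ z → z * ½ * length e) two) (trans (cong (_* length e) ½+½) (*-identityˡ _))))))
    where
    two : fromℤ (⁺ 2) ≡ 1# + 1#
    two = cong (λ z → 1# + z) (+-identityʳ 1#)

  midpoint : Edge → Point
  midpoint e = interior e (½ * length e) (½-pos e) (½-< e)

  midpoints : List Point
  midpoints = tabulate midpoint

  midpoints-code : midpointsᵐ (map codeSegment (flat baseModel)) ≡ map code midpoints
  midpoints-code = trans (concatMap-singletons _ (map codeSegment (flat baseModel)))
    (trans (cong (λ ss → map _ (map codeSegment ss)) flat-base)
      (trans (cong (map _) (Listₚ.map-tabulate whole codeSegment)) (trans (Listₚ.map-tabulate (codeSegment ∘ whole) _) (sym (Listₚ.map-tabulate midpoint code)))))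

  support-code : ∀ F → supportᵐ (codeDivisor F) ≡ map code (map proj₁ F)
  support-code [] = refl
  support-code (x ∷ F) = cong (code (proj₁ x) ∷_) (support-code F)

  -- A segment with equal ends would be a whole loop.
  midpoints-loopless : ∀ M → (∀ e → On M (midpoint e)) → Loopless M
  midpoints-loopless M on {e} {a} {b} i eq = go (All.lookup (proper M) i)
    where
    go : Proper (e , a , b) → ⊥
    go (inj₁ 0<a , a<b , b≤L) = <⇒≢ a<b (sym (at-injective-interior 0<a (<-≤-trans a<b b≤L) (sym eq)))
    go (inj₂ 0≡a , a<b , inj₁ b<L) = <⇒≢ a<b (at-injective-interior (≤-<-trans (inj₂ 0≡a) a<b) b<L eq)
    go (inj₂ 0≡a , a<b , inj₂ b≡L) = true≢false (covers-intro {e} {a} {b} {½ * length e} {p = ½-pos e} {½-< e}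
      (subst (_< ½ * length e) 0≡a (½-pos e)) (subst (½ * length e <_) (sym b≡L) (½-< e))) (on e i)

  cutPoints : Divisor → List Point
  cutPoints F = midpoints ++ map proj₁ F

  model : Divisor → Model
  model F = refineAll (cutPoints F) baseModel

  cutPoints-code : ∀ F → midpointsᵐ (map codeSegment (flat baseModel)) ++ supportᵐ (codeDivisor F) ≡ map code (cutPoints F)
  cutPoints-code F = trans (cong₂ _++_ midpoints-code (support-code F)) (sym (Listₚ.map-++ code midpoints (map proj₁ F)))

  model-code : ∀ F → modelᵐ (map codeSegment (flat baseModel)) (codeDivisor F) ≡ map codeSegment (flat (model F))
  model-code F = trans (cong (λ qs → refineᵐ qs (map codeSegment (flat baseModel))) (cutPoints-code F)) (refine-code (cutPoints F) baseModel)

  model-supported : ∀ F → SupportedOn (model F) F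
  model-supported F {w} {c} i = refineAll-member (cutPoints F) baseModel {w} (∈ₚ.∈-++⁺ʳ midpoints (∈ₚ.∈-map⁺ proj₁ i))

  model-loopless : ∀ F → Loopless (model F)
  model-loopless F = midpoints-loopless (model F)
    (λ e → refineAll-member (cutPoints F) baseModel {midpoint e} (∈ₚ.∈-++⁺ˡ (∈ₚ.∈-tabulate⁺ e)))

  -- The model enters only as a loopless one that carries `F`; how it was computed matters for the
  -- input alone.
  module Search (F : Divisor) (A : Model) (A-supported : SupportedOn A F) (A-loopless : Loopless A) where

    points : List Code
    points = verticesᵐ #vertices ++ endsᵐ (map codeSegment (flat A))

    vertices⁻ : ∀ n {q} → q ∈ verticesᵐ n → ∃ λ k → k ℕ.< n × q ≡ vertexᵐ k
    vertices⁻ (suc n) (here refl) = n , ℕₚ.≤-refl , refl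
    vertices⁻ (suc n) (there i) with vertices⁻ n i
    ... | k , k<n , e = k , ℕₚ.m≤n⇒m≤1+n k<n , e

    vertices⁺ : ∀ n k → k ℕ.< n → vertexᵐ k ∈ verticesᵐ n
    vertices⁺ (suc n) k (ℕ.s≤s k≤n) with ℕₚ.m≤n⇒m<n∨m≡n k≤n
    ... | inj₂ refl = here refl
    ... | inj₁ k<n  = there (vertices⁺ n k k<n)

    ends⁻ : ∀ ss {q} → q ∈ endsᵐ (map codeSegment ss) → ∃ λ e → ∃ λ a → ∃ λ b → (e , a , b) ∈ ss × (q ≡ code (at e a) ⊎ q ≡ code (at e b))
    ends⁻ ((e , a , b) ∷ ss) (here refl) = e , a , b , here refl , inj₁ refl
    ends⁻ ((e , a , b) ∷ ss) (there (here refl)) = e , a , b , here refl , inj₂ refl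
    ends⁻ (_ ∷ ss) (there (there i)) with ends⁻ ss i
    ... | e , a , b , j , h = e , a , b , there j , h

    ends⁺ : ∀ ss {e a b} → (e , a , b) ∈ ss → code (at e a) ∈ endsᵐ (map codeSegment ss)
    ends⁺ (_ ∷ ss) (here refl) = here refl
    ends⁺ (_ ∷ ss) (there i) = there (there (ends⁺ ss i))

    points⁻ : ∀ {q} → q ∈ points → ∃ λ w → On A w × q ≡ code w
    points⁻ i with ∈ₚ.∈-++⁻ (verticesᵐ #vertices) i
    ... | inj₁ j with vertices⁻ #vertices j
    ...   | k , k<n , refl = vertex (Fin.fromℕ< k<n) , (λ _ → refl) , cong (λ m → - 1# , fromℕ m) (sym (Finₚ.toℕ-fromℕ< k<n))
    points⁻ i | inj₂ j with ends⁻ (flat A) j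
    ...   | e , a , b , k , inj₁ refl = at e a , proj₁ (ends-on-model A k) , refl
    ...   | e , a , b , k , inj₂ refl = at e b , proj₂ (ends-on-model A k) , refl

    points⁺ : ∀ w → On A w → code w ∈ points
    points⁺ (vertex v) on = ∈ₚ.∈-++⁺ˡ (vertices⁺ #vertices (toℕ v) (Finₚ.toℕ<n v))
    points⁺ w@(interior e t p q) on with Any.any? (λ (e , a , b) → at e a ≟P w) (flat A)
    ... | yes ∃s = found (flat A) ∃s (λ i → i)
      where
      found : ∀ ss → Any (λ (e , a , b) → at e a ≡ w) ss → (∀ {s} → s ∈ ss → s ∈ flat A) → code w ∈ points
      found ((e , a , b) ∷ ss) (here h) sub = subst (_∈ points) (cong code h) (∈ₚ.∈-++⁺ʳ (verticesᵐ #vertices) (ends⁺ (flat A) (sub (here refl))))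
      found (_ ∷ ss) (there i) sub = found ss i (sub ∘ there)
    -- With slope 1 after and 0 before every point, the ends at `w` count the segments starting
    -- there. Their number would be 0, whereas the total at an uncovered interior point is 1.
    ... | no ∄s = ⊥-elim (1≢0 (trans (sym (ends-on (λ _ _ → ⁺ 1) (λ _ _ → 0ℤ) A w on))
        (sumMap-zero (Slopes.ends (λ _ _ → ⁺ 1) (λ _ _ → 0ℤ) w) (flat A) zero-ends)))
      where
      1≢0 : ⁺ 1 ≡ 0ℤ → ⊥
      1≢0 ()
      if-zero : ∀ (b : Bool) → (if b then 0ℤ else 0ℤ) ≡ 0ℤ
      if-zero true  = refl
      if-zero false = refl
      zero-ends : ∀ {s} → s ∈ flat A → Slopes.ends (λ _ _ → ⁺ 1) (λ _ _ → 0ℤ) w s ≡ 0ℤ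
      zero-ends {e , a , b} i = cong₂ ℤ._+_ (if-cong (dec-false (at e a ≟P w) λ h → ∄s (Any.map (λ { refl → h }) i))) (if-zero (does (at e b ≟P w)))

    -1-code : - 1# ≡ fromℤ -1ℤ
    -1-code = cong (λ z → - z) (sym (+-identityʳ 1#))

    tuples⁻ : ∀ k {E} → E ∈ tuplesᵐ points k → ∃ λ ps → All (On A) ps × size ps ≡ k × E ≡ codeDivisor (pts -1ℤ ps)
    tuples⁻ zero (here refl) = [] , [] , refl , refl
    tuples⁻ (suc k) i with concatMap-∈⁻ _ points i
    ... | q , q∈ , j with concatMap-∈⁻ _ (tuplesᵐ points k) j
    ...   | E , E∈ , here refl with points⁻ q∈ | tuples⁻ k E∈
    ...     | w , on , refl | ps , ons , refl , refl = w ∷ ps , on ∷ ons , refl , cong (λ z → (code w , z) ∷ codeDivisor (pts -1ℤ ps)) -1-code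

    tuples⁺ : ∀ ps → All (On A) ps → codeDivisor (pts -1ℤ ps) ∈ tuplesᵐ points (size ps)
    tuples⁺ [] [] = here refl
    tuples⁺ (w ∷ ps) (on ∷ ons) = concatMap-∈⁺ _ points (points⁺ w on)
      (concatMap-∈⁺ _ (tuplesᵐ points (size ps)) (tuples⁺ ps ons) (here (cong (λ z → (code w , z) ∷ codeDivisor (pts -1ℤ ps)) (sym -1-code))))

    slopes : List Carrier
    slopes = slopesOf F

    test : Divisorᶜ → Bool
    test E = feasibleᵐ slopes (map codeSegment (flat A)) (E ++ codeDivisor F)

    test-⇔ : ∀ ps → test (codeDivisor (pts -1ℤ ps)) ⇔ᵇ Feasible (net A) (minus ps F)
    test-⇔ ps = subst (λ E → feasibleᵐ slopes (map codeSegment (flat A)) E ⇔ᵇ Feasible (net A) (minus ps F)) (Listₚ.map-++ _ (pts -1ℤ ps) F)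
      (feasible-⇔ slopes (flat A) (minus ps F) (positivePart F) (slopesOf-integral F) (slopesOf-contains F) (bounds-minus ps F) (positive-net A))

    holdsAt : ℕ → Bool
    holdsAt = everywhereᵐ slopes (map codeSegment (flat A)) points (codeDivisor F)

    holdsAt-true : ∀ k → holdsAt k ≡ true → Everywhere A F k
    holdsAt-true k h ps on refl = sound (test-⇔ ps) (sound (every-⇔ {P = λ E → test E ≡ true} (λ E → iff (λ e → e) (λ e → e)) (tuplesᵐ points (size ps))) h (tuples⁺ ps on))

    holdsAt-false : ∀ k → holdsAt k ≡ false → ∃ λ qs → All (On A) qs × size qs ≡ k × ¬ Feasible (net A) (minus qs F)
    holdsAt-false k h with every-false test (tuplesᵐ points k) h
    ... | E , i , no-test with tuples⁻ k i
    ...   | ps , on , len , refl = ps , on , len , λ feas → true≢false (complete (test-⇔ ps) feas) no-test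

    -- Whatever the sign of `deg F`, removing this many chips leaves a negative degree, so the test
    -- fails here at the latest.
    top : ℕ
    top = suc ℤ.∣ deg F ∣

    someVertex : Vertex
    someVertex = Fin.fromℕ< (ℕ.>-nonZero⁻¹ #vertices {{nonEmpty}})

    top-fails : ¬ Everywhere A F top
    top-fails ev = too-big (deg F) (subst (0ℤ ℤ.≤_) (trans (sym (wsum-all (minus ps F))) (trans (wsum-minus (λ _ → true) ps F)
        (cong₂ (λ d s → d ℤ.- s) (wsum-all F) (trans (wsum-all (pts (⁺ 1) ps)) (trans (length-sum ps) (cong ⁺_ (Listₚ.length-replicate top)))))))
        (degree-bound (positive-net A) (ev ps (Allₚ.replicate⁺ top (λ _ → refl)) (Listₚ.length-replicate top))))
      where
      ps : List Point
      ps = replicate top (vertex someVertex)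
      too-big : ∀ d → 0ℤ ℤ.≤ d ℤ.- (⁺ suc ℤ.∣ d ∣) → ⊥
      too-big (⁺ n) h with ℤₚ.0≤i-j⇒j≤i {⁺ n} {⁺ suc n} h
      ... | ℤ.+≤+ le = ℕₚ.1+n≰n le
      too-big -[1+ n ] h with ℤₚ.0≤i-j⇒j≤i { -[1+ n ]} {⁺ suc (suc n)} h
      ... | ()

    pred-value : ∀ k → predᵐ k ≡ (⁺ k) ℤ.- (⁺ 1)
    pred-value zero = refl
    pred-value (suc k) = sym (ℤₚ.[1+m]⊖[1+n]≡m⊖n k 0)

    prepared : ⟦ Prepared ⟧
    prepared = slopes , map codeSegment (flat A) , points , codeDivisor F

    Run : ℕ → ℤ → Set
    Run k = Semantics.Reaches R (program initialT stepT) (prepared , k)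

    next-state : ∀ k {b} → holdsAt k ≡ b → eval stepT (_∷_ {x = Prepared ⊗ nat} (prepared , k) []) ≡ (if b then inj₁ (prepared , suc k) else inj₂ (predᵐ k))
    next-state k h = trans (step≡ prepared k) (cong (λ b → if b then inj₁ (prepared , suc k) else inj₂ (predᵐ k)) h)

    -- The fuel counts the tests left before `top`, where success is impossible. That all earlier
    -- tests succeeded is carried along, since `rank-criterion` asks for it at the first failure.
    search : ∀ fuel k → k ℕ.+ fuel ≡ top → (∀ j → j ℕ.< k → Everywhere A F j) → ∃ λ r → Run k r × IsRank F r
    search′ : ∀ fuel k → k ℕ.+ fuel ≡ top → (∀ j → j ℕ.< k → Everywhere A F j) → (b : Bool) → holdsAt k ≡ b → ∃ λ r → Run k r × IsRank F r
    search fuel k eq lower = search′ fuel k eq lower (holdsAt k) refl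
    search′ fuel k eq lower false h = predᵐ k , halt′ initialT stepT (next-state k h) , subst (IsRank F) (sym (pred-value k))
      (rank-criterion A F k A-loopless A-supported lower (holdsAt-false k h))
    search′ zero k eq lower true h = ⊥-elim (top-fails (subst (Everywhere A F) (trans (sym (ℕₚ.+-identityʳ k)) eq) (holdsAt-true k h)))
    search′ (suc fuel) k eq lower true h = later (search fuel (suc k) (trans (sym (ℕₚ.+-suc k fuel)) eq) lower′)
      where
      lower′ : ∀ j → j ℕ.< suc k → Everywhere A F j
      lower′ j (ℕ.s≤s j≤k) with ℕₚ.m≤n⇒m<n∨m≡n j≤k
      ... | inj₁ j<k  = lower j j<k
      ... | inj₂ refl = holdsAt-true k h
      later : (∃ λ r → Run (suc k) r × IsRank F r) → ∃ λ r → Run k r × IsRank F r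
      later (r , run , rank) = r , next′ initialT stepT (next-state k h) run , rank

  module Input (D : InputDivisor) where
    F = divisor D
    A = model F
    open Search F A (λ {w} {c} → model-supported F {w} {c}) (model-loopless F)

    finish : List Segmentᶜ → Divisorᶜ → ⟦ Prepared ⟧
    finish M F = slopesᵐ (encodeInput D) , M , (verticesᵐ #vertices ++ endsᵐ M) , F

    prepared-code : prepareᵐ (encode G D) ≡ prepared
    prepared-code = trans (cong (λ b → finish (modelᵐ b (divisorᵐ b (encodeInput D))) (divisorᵐ b (encodeInput D))) base-code)
      (trans (cong (λ F → finish (modelᵐ (map codeSegment (flat baseModel)) F) F) (divisor-code′ D))
        (trans (cong (λ M → finish M (codeDivisor (divisor D))) (model-code F))
          (cong (λ cs → cs , map codeSegment (flat A) , points , codeDivisor (divisor D)) (slopes-input D))))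

    computes-rank : ∃ λ r → Semantics.Computes R (program initialT stepT) (encode G D) r × IsRank (divisor D) r
    computes-rank = finally (search top 0 refl (λ _ ()))
      where
      finally : (∃ λ r → Run 0 r × IsRank (divisor D) r) → ∃ λ r → Semantics.Computes R (program initialT stepT) (encode G D) r × IsRank (divisor D) r
      finally (r , run , rank) = r , computes′ initialT stepT {encode G D} {prepared , 0} {r} (trans (start≡ (encode G D)) (cong (_, 0) prepared-code)) run , rank

theorem4p1 : Σ (Program InputType int) λ P →
    (R : RealField) (G : MetricGraph R) (D : Geometry.InputDivisor G) →
    ∃ λ (r : ℤ) →
    Semantics.Computes R P (encode G D) r × Geometry.IsRank G (Geometry.divisor G D) r
theorem4p1 = Programs.program Programs.initialT Programs.stepT , λ R G D → Computation.Input.computes-rank G D
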